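{- Let $r\ge 2$, let $s_1,s_2,\dots,s_{r-1}$ be positive integers and let $H$ be any $r$-uniform hypergraph with $v=|V(H)|$ vertices and $e=|E(H)|$ edges. Then there exists a constant $c>0$ such that for every integer $p\ge c$, $$ex\big(n,H,K^{(r)}_{s_1,s_2,\dots,s_{r-1},p}\big)=\Omega\!\left(n^{\,v-\frac{e}{s_1s_2\cdots s_{r-1}}}\right)$$ as $n\to\infty$.
   Context: For $r$-uniform hypergraphs $T$ and $F$, $ex(n,T,F)$ denotes the maximum number of copies of $T$ (subhypergraphs isomorphic to $T$) in an $n$-vertex $r$-uniform hypergraph containing no subhypergraph isomorphic to $F$. $K^{(r)}_{t_1,\dots,t_r}$ denotes the complete $r$-partite $r$-uniform hypergraph with parts of sizes $t_1,\dots,t_r$: its vertex set is a disjoint union of parts $V_1,\dots,V_r$ with $|V_i|=t_i$, and its edges are exactly the $r$-sets containing one vertex from each part. -}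

module Defs where

open import Data.Nat using (ℕ; zero; suc; _+_; _*_; _^_; _≤_)
open import Data.Bool using (Bool; true; false; T; if_then_else_; _∧_)
open import Data.Fin using (Fin; zero; suc; splitAt; _≟_)
open import Data.Fin.Subset using (Subset; ⁅_⁆; _∪_; ⊥; ⊤; ∣_∣; inside; outside)
open import Data.List as List using (List; []; _∷_; _++_; length; filter; allFin)
open import Data.Vec as Vec using (Vec; []; _∷_; lookup)
open import Data.Sum using (inj₁; inj₂)
open import Data.Product using (Σ; ∃; ∃-syntax; _×_; _,_)
open import Relation.Nullary using (¬_)
open import Relation.Nullary.Decidable using (⌊_⌋)
open import Relation.Binary.PropositionalEquality using (_≡_; _≢_)
open import Function using (_⇔_)
open import Function.Definitions using (Injective)
import Data.Nat as ℕ
open import Data.Bool.ListAction using (and)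

productV : ∀ {k} → Vec ℕ k → ℕ
productV = Vec.foldr _ _*_ 1

record Hypergraph (n : ℕ) : Set where
  field
    edge : Subset n → Bool
open Hypergraph public

Uniform : ∀ {n} → ℕ → Hypergraph n → Set
Uniform r G = ∀ e → T (edge G e) → ∣ e ∣ ≡ r

allSubsets : (n : ℕ) → List (Subset n)
allSubsets zero = [] ∷ []
allSubsets (suc n) = List.map (outside ∷_) (allSubsets n) ++ List.map (inside ∷_) (allSubsets n)

edgeCount : ∀ {v} → Hypergraph v → ℕ
edgeCount {v} H = length (filter (λ e → T? (edge H e)) (allSubsets v))
  where
  open import Relation.Nullary using (Dec; yes; no)
  T? : (b : Bool) → Dec (T b)
  T? true = yes _
  T? false = no (λ ())

img : ∀ {v n} → (Fin v → Fin n) → Subset v → Subset n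
img {v} φ e = List.foldr (λ x acc → (if lookup e x then ⁅ φ x ⁆ else ⊥) ∪ acc) ⊥ (allFin v)

-- An embedding of T into G: an injective vertex map sending edges of T to edges of G.
-- Its image (vertex set img φ ⊤, edge set {img φ e : e ∈ E(T)}) is a subhypergraph of G
-- isomorphic to T; every such subhypergraph (copy of T) arises this way.
record Embedding {v n : ℕ} (Tg : Hypergraph v) (G : Hypergraph n) : Set where
  field
    map : Fin v → Fin n
    injective : Injective _≡_ _≡_ map
    preserves : ∀ e → T (edge Tg e) → T (edge G (img map e))
open Embedding public

Contains : ∀ {v n} → Hypergraph v → Hypergraph n → Set
Contains F G = Embedding F G

CopyEdge : ∀ {v n} {Tg : Hypergraph v} {G : Hypergraph n} → Embedding Tg G → Subset n → Set
CopyEdge {v} {Tg = Tg} φ e' = ∃[ e ] (T (edge Tg e) × img (map φ) e ≡ e')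

SameCopy : ∀ {v n} {Tg : Hypergraph v} {G : Hypergraph n} → Embedding Tg G → Embedding Tg G → Set
SameCopy φ ψ = (img (map φ) ⊤ ≡ img (map ψ) ⊤) × (∀ e' → CopyEdge φ e' ⇔ CopyEdge ψ e')

AtLeastCopies : ∀ {v n} → ℕ → Hypergraph v → Hypergraph n → Set
AtLeastCopies X Tg G =
  Σ (Fin X → Embedding Tg G) λ cs → ∀ i j → i ≢ j → ¬ SameCopy (cs i) (cs j)

partOf : ∀ {r} (ts : Vec ℕ r) → Fin (Vec.sum ts) → Fin r
partOf (t ∷ ts) i with splitAt t i
... | inj₁ _ = zero
... | inj₂ j = suc (partOf ts j)

countInPart : ∀ {r} (ts : Vec ℕ r) → Subset (Vec.sum ts) → Fin r → ℕ
countInPart ts e i = length (filter (λ x → T? (lookup e x ∧ ⌊ partOf ts x ≟ i ⌋)) (allFin (Vec.sum ts)))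
  where
  open import Relation.Nullary using (Dec; yes; no)
  T? : (b : Bool) → Dec (T b)
  T? true = yes _
  T? false = no (λ ())

KPartite : ∀ {r} (ts : Vec ℕ r) → Hypergraph (Vec.sum ts)
edge (KPartite {r} ts) e = and (List.map (λ i → countInPart ts e i ℕ.≡ᵇ 1) (allFin r))

{-# OPTIONS --safe #-}
module Submission where

-- The hypergraph G lives on v disjoint copies of K^S, where K is a prime field with q ≈ n^(1/S) elements and S = s₁⋯s_k. An edge
-- e of H is placed on labels (y_b), b ∈ e, when a polynomial P takes the value W e at the point encoding e and y. Every choice of
-- labels satisfies the conditions for exactly one value vector W, so by pigeonhole some W yields at least q^(Sv - e(H)) copies.
-- A copy of K_{s₁,…,s_k,p} gives S points, separated away from one block, such that the S restrictions of P to that block have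
-- many common zeros y ∈ K^S, hence common zeros with many distinct values t of one coordinate y_i. Eliminating the other S - 1
-- coordinates by a Macaulay-type matrix M(t), this bounds the number of values of t unless M(t) is singular for every t. Shifting P
-- in suitable directions replaces M(η) by M(η) + μ, singular for at most N of the q values of μ, independently for D + 1 values of η.
-- So a random P is bad for given points with probability at most (N / q)^(D+1), which beats the number of choices once D and q
-- are large, and P can be chosen good for all of them. This replaces the Lang–Weil bound in Bukh's random algebraic construction.

-- `W` is found by averaging only after P is fixed, so P has to be good for all right-hand sides at
-- once; this is why an event carries the values `ω`, at the cost of a factor q^S in the number of
-- events.
--
-- The obstacle is that one singularity condition is only known to have probability at most N / q,
-- whereas the number of events is a fixed power of q. Testing at D + 1 values of t gains a factor 1
-- / q each time, while a larger D costs only constants: the exponent of q in the number of events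
-- depends on v and S alone. All S restrictions come from the one polynomial P, and each of them has
-- to be shifted in its own prescribed way; this is possible because the S points differ outside the
-- common block.
--
-- The number of common zeros that is tolerated depends on v and S but not on q, so p can be fixed
-- before n grows. Fractional exponents are avoided by comparing S-th powers: q^S is of order n, and
-- q^(Sv - e) copies amount to n^(v - e/S).

-- Ring identities by reflection

module RingSolver where
  open import Algebra.Bundles using (CommutativeRing; RawRing)
  open import Relation.Binary.PropositionalEquality as ≡ using (_≡_)

  -- The stdlib ring solver decides identities involving cancellation only if zero coefficients are recognised,
  -- so the coefficients are taken to be formal differences (a , b) of naturals, standing for a · 1 - b · 1.
  module DifferenceSolver {c ℓ} (R : CommutativeRing c ℓ) where
    open CommutativeRing R
    open import Algebra.Properties.Ring ring using (-‿distribˡ-*; -‿distribʳ-*; -‿involutive; -0#≈0#)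
    open import Algebra.Properties.AbelianGroup +-abelianGroup using (⁻¹-∙-comm)
    open import Algebra.Properties.Semiring.Mult.TCOptimised semiring using (_×_; ×1-homo-*; ×-homo-+)
    open import Algebra.Properties.CommutativeSemigroup (CommutativeRing.+-commutativeSemigroup R) using (interchange)
    open import Algebra.Solver.Ring.AlmostCommutativeRing
    open import Data.Nat as ℕ using (ℕ; zero; suc)
    open import Data.Product using (_,_) renaming (_×_ to _∧_)
    open import Data.Maybe using (Maybe; just; nothing)
    open import Relation.Nullary using (yes; no)
    open import Relation.Binary.Reasoning.Setoid setoid

    coefficients : RawRing _ _
    coefficients = record
      { Carrier = ℕ ∧ ℕ ; _≈_ = _≡_
      ; _+_ = λ (a , b) (c , d) → a ℕ.+ c , b ℕ.+ d
      ; _*_ = λ (a , b) (c , d) → a ℕ.* c ℕ.+ b ℕ.* d , a ℕ.* d ℕ.+ b ℕ.* c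
      ; -_ = λ (a , b) → b , a
      ; 0# = 0 , 0 ; 1# = 1 , 0 }

    -- The case b = 0 is separate so that the constants (0 , 0) and (1 , 0) evaluate to `0#` and
    -- `1#` by computation.
    ⟦_⟧ : ℕ ∧ ℕ → Carrier
    ⟦ a , zero ⟧ = a × 1#
    ⟦ a , suc b ⟧ = a × 1# - suc b × 1#

    ⟦⟧-diff : ∀ a b → ⟦ a , b ⟧ ≈ a × 1# - b × 1#
    ⟦⟧-diff a zero = sym (trans (+-congˡ -0#≈0#) (+-identityʳ _))
    ⟦⟧-diff a (suc b) = refl

    diff-+ : ∀ a b c d → (a + c) - (b + d) ≈ (a - b) + (c - d)
    diff-+ a b c d = trans (+-congˡ (sym (⁻¹-∙-comm b d))) (interchange a c (- b) (- d))

    diff-* : ∀ a b c d → (a * c + b * d) - (a * d + b * c) ≈ (a - b) * (c - d)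
    diff-* a b c d = begin
      (a * c + b * d) - (a * d + b * c)         ≈⟨ diff-+ _ _ _ _ ⟩
      (a * c - a * d) + (b * d - b * c)         ≈⟨ +-cong (sub a c d) (trans (sub b d c) (flip b d c)) ⟩
      a * (c - d) + (- b) * (c - d)             ≈⟨ distribʳ _ _ _ ⟨
      (a - b) * (c - d)                         ∎
      where
      sub : ∀ x y z → x * y - x * z ≈ x * (y - z)
      sub x y z = trans (+-congˡ (-‿distribʳ-* x z)) (sym (distribˡ x y (- z)))
      flip : ∀ x y z → x * (y - z) ≈ (- x) * (z - y)
      flip x y z = begin
        x * (y - z)         ≈⟨ -‿involutive _ ⟨
        - (- (x * (y - z))) ≈⟨ -‿cong (-‿distribʳ-* _ _) ⟩
        - (x * - (y - z))   ≈⟨ -‿distribˡ-* _ _ ⟩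
        (- x) * - (y - z)   ≈⟨ *-congˡ (trans (sym (⁻¹-∙-comm y (- z))) (trans (+-congˡ (-‿involutive z)) (+-comm _ _))) ⟩
        (- x) * (z - y)     ∎

    morphism : coefficients -Raw-AlmostCommutative⟶ fromCommutativeRing R
    morphism = record
      { ⟦_⟧ = ⟦_⟧
      ; +-homo = λ (a , b) (c , d) → begin
          ⟦ a ℕ.+ c , b ℕ.+ d ⟧                      ≈⟨ ⟦⟧-diff (a ℕ.+ c) (b ℕ.+ d) ⟩
          (a ℕ.+ c) × 1# - (b ℕ.+ d) × 1#            ≈⟨ +-cong (×-homo-+ 1# a c) (-‿cong (×-homo-+ 1# b d)) ⟩
          (a × 1# + c × 1#) - (b × 1# + d × 1#)      ≈⟨ diff-+ _ _ _ _ ⟩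
          (a × 1# - b × 1#) + (c × 1# - d × 1#)      ≈⟨ +-cong (⟦⟧-diff a b) (⟦⟧-diff c d) ⟨
          ⟦ a , b ⟧ + ⟦ c , d ⟧                      ∎
      ; *-homo = λ (a , b) (c , d) → begin
          ⟦ a ℕ.* c ℕ.+ b ℕ.* d , a ℕ.* d ℕ.+ b ℕ.* c ⟧  ≈⟨ ⟦⟧-diff (a ℕ.* c ℕ.+ b ℕ.* d) (a ℕ.* d ℕ.+ b ℕ.* c) ⟩
          (a ℕ.* c ℕ.+ b ℕ.* d) × 1# - (a ℕ.* d ℕ.+ b ℕ.* c) × 1#
            ≈⟨ +-cong (homo a c b d) (-‿cong (homo a d b c)) ⟩
          (a × 1# * (c × 1#) + b × 1# * (d × 1#)) - (a × 1# * (d × 1#) + b × 1# * (c × 1#)) ≈⟨ diff-* _ _ _ _ ⟩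
          (a × 1# - b × 1#) * (c × 1# - d × 1#)      ≈⟨ *-cong (⟦⟧-diff a b) (⟦⟧-diff c d) ⟨
          ⟦ a , b ⟧ * ⟦ c , d ⟧                      ∎
      ; -‿homo = λ (a , b) → begin
          ⟦ b , a ⟧               ≈⟨ ⟦⟧-diff b a ⟩
          b × 1# - a × 1#         ≈⟨ +-comm _ _ ⟩
          - (a × 1#) + b × 1#     ≈⟨ +-congˡ (-‿involutive _) ⟨
          - (a × 1#) - - (b × 1#) ≈⟨ ⁻¹-∙-comm _ _ ⟩
          - (a × 1# - b × 1#)     ≈⟨ -‿cong (⟦⟧-diff a b) ⟨
          - ⟦ a , b ⟧             ∎
      ; 0-homo = refl
      ; 1-homo = refl }
      where
      homo : ∀ a c b d → (a ℕ.* c ℕ.+ b ℕ.* d) × 1# ≈ a × 1# * (c × 1#) + b × 1# * (d × 1#)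
      homo a c b d = trans (×-homo-+ 1# (a ℕ.* c) (b ℕ.* d)) (+-cong (×1-homo-* a c) (×1-homo-* b d))

    equal? : ∀ p q → Maybe (⟦ p ⟧ ≈ ⟦ q ⟧)
    equal? (a , b) (c , d) with a ℕ.+ d ℕ.≟ c ℕ.+ b
    ... | no _ = nothing
    ... | yes eq = just (begin
        ⟦ a , b ⟧                       ≈⟨ ⟦⟧-diff a b ⟩
        a × 1# - b × 1#                 ≈⟨ cancel (d × 1#) ⟨
        (a × 1# + d × 1#) - (b × 1# + d × 1#) ≈⟨ +-congʳ (trans (sym (×-homo-+ 1# a d)) (trans (reflexive (≡.cong (_× 1#) eq)) (×-homo-+ 1# c b))) ⟩
        (c × 1# + b × 1#) - (b × 1# + d × 1#) ≈⟨ +-congˡ (-‿cong (+-comm _ _)) ⟩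
        (c × 1# + b × 1#) - (d × 1# + b × 1#) ≈⟨ cancel (b × 1#) ⟩
        c × 1# - d × 1#                 ≈⟨ ⟦⟧-diff c d ⟨
        ⟦ c , d ⟧                       ∎)
      where
      cancel : ∀ {x y} z → (x + z) - (y + z) ≈ x - y
      cancel {x} {y} z = trans (diff-+ x y z z) (trans (+-congˡ (-‿inverseʳ z)) (+-identityʳ _))

    open import Algebra.Solver.Ring coefficients (fromCommutativeRing R) morphism equal? public
      using (solve; _:=_; _:+_; _:*_; _:-_; :-_; con; Polynomial)

    :0 :1 : ∀ {n} → Polynomial n
    :0 = con (0 , 0)
    :1 = con (1 , 0)

-- Polynomial functions over a field: degrees, roots, Lagrange interpolation, linear systems

module Polynomials where
  open import Data.Nat as ℕ using (ℕ; zero; suc)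
  import Data.Nat.Properties as ℕₚ
  open import Data.Fin using (Fin; zero; suc; punchIn; punchOut; combine; _↑ˡ_; _↑ʳ_)
  import Data.Fin.Properties as Finₚ
  open import Data.Vec.Functional using (insertAt; removeAt)
  import Data.Vec.Functional.Properties as VFₚ
  open import Data.Product using (∃; _×_; _,_; proj₁; proj₂)
  open import Function using (_∘_)
  open import Function.Definitions using (Injective)
  open import Relation.Nullary using (Dec; yes; no; contradiction; ¬?)
  open import Relation.Binary.PropositionalEquality
  open import Algebra.Bundles using (CommutativeRing)
  open import Algebra.Structures using (IsCommutativeRing)
  open RingSolver

  record FieldOn (K : Set) : Set where
    field
      _⊕_ _⊗_ : K → K → K
      ⊖_ : K → K
      𝟘 𝟙 : K
      isCommutativeRing : IsCommutativeRing _≡_ _⊕_ _⊗_ ⊖_ 𝟘 𝟙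
      inv : K → K
      inverseʳ : ∀ x → x ≢ 𝟘 → x ⊗ inv x ≡ 𝟙
      𝟙≢𝟘 : 𝟙 ≢ 𝟘
      _≟K_ : (x y : K) → Dec (x ≡ y)

  module FieldTheory {K : Set} (F : FieldOn K) where
    open FieldOn F using (inv; inverseʳ; _≟K_) renaming (𝟙≢𝟘 to 1≢0) public

    commutativeRing : CommutativeRing _ _
    commutativeRing = record { isCommutativeRing = FieldOn.isCommutativeRing F }

    open CommutativeRing commutativeRing public
      using (_+_; _*_; -_; _-_; 0#; 1#; +-identityˡ; +-identityʳ; *-identityˡ; *-identityʳ;
             zeroˡ; zeroʳ; +-comm; *-comm; +-assoc; *-assoc; distribˡ; distribʳ; -‿inverseʳ; -‿inverseˡ; semiring; +-commutativeMonoid)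

    open DifferenceSolver commutativeRing public using (solve; _:=_; _:+_; _:*_; _:-_; :-_; :0; :1)

    open import Algebra.Properties.Semiring.Sum semiring public
      using (sum; sum-cong-≗; *-distribˡ-sum; *-distribʳ-sum; ∑-distrib-+; ∑-comm; sum-remove; sum-replicate-zero)

    open ≡-Reasoning

    x-y≡0⇒x≡y : ∀ x y → x - y ≡ 0# → x ≡ y
    x-y≡0⇒x≡y x y eq = begin
      x            ≡⟨ lem x y ⟩
      (x - y) + y  ≡⟨ cong (_+ y) eq ⟩
      0# + y       ≡⟨ +-identityˡ y ⟩
      y            ∎
      where
      lem : ∀ x y → x ≡ (x - y) + y
      lem = solve 2 (λ x y → x := (x :- y) :+ y) refl

    *-cancel-0 : ∀ x y → x ≢ 0# → x * y ≡ 0# → y ≡ 0#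
    *-cancel-0 x y x≢0 xy≡0 = begin
      y                ≡⟨ *-identityˡ y ⟨
      1# * y           ≡⟨ cong (_* y) (inverseʳ x x≢0) ⟨
      (x * inv x) * y  ≡⟨ lem x (inv x) y ⟩
      inv x * (x * y)  ≡⟨ cong (inv x *_) xy≡0 ⟩
      inv x * 0#       ≡⟨ zeroʳ _ ⟩
      0#               ∎
      where
      lem : ∀ x i y → (x * i) * y ≡ i * (x * y)
      lem = solve 3 (λ x i y → (x :* i) :* y := i :* (x :* y)) refl

    *-≢0 : ∀ x y → x ≢ 0# → y ≢ 0# → x * y ≢ 0#
    *-≢0 x y x≢0 y≢0 xy≡0 = y≢0 (*-cancel-0 x y x≢0 xy≡0)

    sum-zero : ∀ {n} (f : Fin n → K) → (∀ i → f i ≡ 0#) → sum f ≡ 0#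
    sum-zero {n} f eq = trans (sum-cong-≗ eq) (sum-replicate-zero n)

    sum-single : ∀ {n} (f : Fin n → K) i → (∀ j → j ≢ i → f j ≡ 0#) → sum f ≡ f i
    sum-single {suc n} f i eq = begin
      sum f                    ≡⟨ sum-remove {i = i} f ⟩
      f i + sum (removeAt f i) ≡⟨ cong (f i +_) (sum-zero _ (λ j → eq _ (Finₚ.punchInᵢ≢i i j))) ⟩
      f i + 0#                 ≡⟨ +-identityʳ _ ⟩
      f i                      ∎

    sum-++ : ∀ m {n} (f : Fin (m ℕ.+ n) → K) → sum f ≡ sum (λ i → f (i ↑ˡ n)) + sum (λ j → f (m ↑ʳ j))
    sum-++ zero f = sym (+-identityˡ _)
    sum-++ (suc m) f = trans (cong (f zero +_) (sum-++ m (f ∘ suc))) (sym (+-assoc _ _ _))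

    sum-combine : ∀ m {n} (f : Fin (m ℕ.* n) → K) → sum f ≡ sum (λ i → sum (λ j → f (combine {m} i j)))
    sum-combine zero f = refl
    sum-combine (suc m) {n} f = trans (sum-++ n f) (cong (sum (λ j → f (j ↑ˡ m ℕ.* n)) +_) (sum-combine m (λ j → f (n ↑ʳ j))))

    ∏ : ∀ {n} → (Fin n → K) → K
    ∏ {zero} f = 1#
    ∏ {suc n} f = f zero * ∏ (f ∘ suc)

    ∏-cong : ∀ {n} {f g : Fin n → K} → (∀ i → f i ≡ g i) → ∏ f ≡ ∏ g
    ∏-cong {zero} eq = refl
    ∏-cong {suc n} eq = cong₂ _*_ (eq zero) (∏-cong (eq ∘ suc))

    ∏-one : ∀ {n} (f : Fin n → K) → (∀ i → f i ≡ 1#) → ∏ f ≡ 1#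
    ∏-one {zero} f eq = refl
    ∏-one {suc n} f eq = trans (cong₂ _*_ (eq zero) (∏-one _ (eq ∘ suc))) (*-identityˡ 1#)

    ∏-zero : ∀ {n} (f : Fin n → K) i → f i ≡ 0# → ∏ f ≡ 0#
    ∏-zero f zero eq = trans (cong (_* ∏ (f ∘ suc)) eq) (zeroˡ _)
    ∏-zero f (suc i) eq = trans (cong (f zero *_) (∏-zero (f ∘ suc) i eq)) (zeroʳ (f zero))

    ∏-≢0 : ∀ {n} (f : Fin n → K) → (∀ i → f i ≢ 0#) → ∏ f ≢ 0#
    ∏-≢0 {zero} f nz = 1≢0
    ∏-≢0 {suc n} f nz = *-≢0 _ _ (nz zero) (∏-≢0 _ (nz ∘ suc))

    ∏-* : ∀ {n} (f g : Fin n → K) → ∏ (λ i → f i * g i) ≡ ∏ f * ∏ g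
    ∏-* {zero} f g = sym (*-identityˡ 1#)
    ∏-* {suc n} f g = trans (cong (f zero * g zero *_) (∏-* (f ∘ suc) (g ∘ suc))) (lem _ _ _ _)
      where
      lem : ∀ a b c d → (a * b) * (c * d) ≡ (a * c) * (b * d)
      lem = solve 4 (λ a b c d → (a :* b) :* (c :* d) := (a :* c) :* (b :* d)) refl

    -- Polynomials are represented by the functions they induce; Deg d is "degree at most d".
    Deg : ℕ → (K → K) → Set
    Deg zero f = ∃ λ c → ∀ x → f x ≡ c
    Deg (suc d) f = ∃ λ c → ∃ λ g → Deg d g × (∀ x → f x ≡ c + x * g x)

    Deg-cong : ∀ d {f g} → (∀ x → f x ≡ g x) → Deg d f → Deg d g
    Deg-cong zero eq (c , p) = c , λ x → trans (sym (eq x)) (p x)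
    Deg-cong (suc d) eq (c , g , dg , p) = c , g , dg , λ x → trans (sym (eq x)) (p x)

    Deg-const : ∀ d c → Deg d (λ _ → c)
    Deg-const zero c = c , λ _ → refl
    Deg-const (suc d) c = c , (λ _ → 0#) , Deg-const d 0# , λ x → lem c x
      where
      lem : ∀ c x → c ≡ c + x * 0#
      lem = solve 2 (λ c x → c := c :+ x :* :0) refl

    Deg-suc : ∀ d {f} → Deg d f → Deg (suc d) f
    Deg-suc zero {f} (c , p) = Deg-cong 1 (sym ∘ p) (Deg-const 1 c)
    Deg-suc (suc d) (c , g , dg , p) = c , g , Deg-suc d dg , p

    Deg-mono : ∀ {d e f} → d ℕ.≤ e → Deg d f → Deg e f
    Deg-mono {d} {e} {f} d≤e df = subst (λ k → Deg k f) (ℕₚ.m∸n+n≡m d≤e) (go (e ℕ.∸ d))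
      where
      go : ∀ k → Deg (k ℕ.+ d) f
      go zero = df
      go (suc k) = Deg-suc _ (go k)

    Deg-+ : ∀ d {f g} → Deg d f → Deg d g → Deg d (λ x → f x + g x)
    Deg-+ zero (c , p) (c′ , p′) = c + c′ , λ x → cong₂ _+_ (p x) (p′ x)
    Deg-+ (suc d) (c , f , df , p) (c′ , g , dg , p′) =
      c + c′ , (λ x → f x + g x) , Deg-+ d df dg , λ x → trans (cong₂ _+_ (p x) (p′ x)) (lem c c′ x (f x) (g x))
      where
      lem : ∀ c c′ x a b → (c + x * a) + (c′ + x * b) ≡ (c + c′) + x * (a + b)
      lem = solve 5 (λ c c′ x a b → (c :+ x :* a) :+ (c′ :+ x :* b) := (c :+ c′) :+ x :* (a :+ b)) refl

    Deg-scale : ∀ d k {f} → Deg d f → Deg d (λ x → k * f x)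
    Deg-scale zero k (c , p) = k * c , λ x → cong (k *_) (p x)
    Deg-scale (suc d) k (c , f , df , p) =
      k * c , (λ x → k * f x) , Deg-scale d k df , λ x → trans (cong (k *_) (p x)) (lem k c x (f x))
      where
      lem : ∀ k c x a → k * (c + x * a) ≡ k * c + x * (k * a)
      lem = solve 4 (λ k c x a → k :* (c :+ x :* a) := k :* c :+ x :* (k :* a)) refl

    Deg-* : ∀ d e {f g} → Deg d f → Deg e g → Deg (d ℕ.+ e) (λ x → f x * g x)
    Deg-* zero e (c , p) dg = Deg-cong e (λ x → cong (_* _) (sym (p x))) (Deg-scale e c dg)
    Deg-* (suc d) e {g = g} (c , f , df , p) dg =
      Deg-cong (suc d ℕ.+ e) (λ x → trans (lem c x (f x) (g x)) (cong (_* g x) (sym (p x))))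
        (Deg-+ (suc d ℕ.+ e) (Deg-mono (ℕₚ.m≤n+m e (suc d)) (Deg-scale e c dg))
          (0# , (λ x → f x * g x) , Deg-* d e df dg , λ x → sym (+-identityˡ _)))
      where
      lem : ∀ c x a b → c * b + x * (a * b) ≡ (c + x * a) * b
      lem = solve 4 (λ c x a b → c :* b :+ x :* (a :* b) := (c :+ x :* a) :* b) refl

    Deg-sub : ∀ d {f g} → Deg d f → Deg d g → Deg d (λ x → f x - g x)
    Deg-sub d {f} {g} df dg = Deg-cong d (λ x → lem (f x) (g x)) (Deg-+ d df (Deg-scale d (- 1#) dg))
      where
      lem : ∀ a b → a + (- 1#) * b ≡ a - b
      lem = solve 2 (λ a b → a :+ (:- :1) :* b := a :- b) refl

    Deg-linear : ∀ a k → Deg 1 (λ x → (x - a) * k)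
    Deg-linear a k = (- a) * k , (λ _ → k) , Deg-const 0 k , λ x → lem x a k
      where
      lem : ∀ x a k → (x - a) * k ≡ (- a) * k + x * k
      lem = solve 3 (λ x a k → (x :- a) :* k := (:- a) :* k :+ x :* k) refl

    Deg-∏ : ∀ {n} d (f : Fin n → K → K) → (∀ i → Deg d (f i)) → Deg (n ℕ.* d) (λ x → ∏ (λ i → f i x))
    Deg-∏ {zero} d f df = Deg-const 0 1#
    Deg-∏ {suc n} d f df = Deg-* d (n ℕ.* d) (df zero) (Deg-∏ d (f ∘ suc) (df ∘ suc))

    Deg-sum : ∀ {n} d (f : Fin n → K → K) → (∀ i → Deg d (f i)) → Deg d (λ x → sum (λ i → f i x))
    Deg-sum {zero} d f df = Deg-const d 0#
    Deg-sum {suc n} d f df = Deg-+ d (df zero) (Deg-sum d (f ∘ suc) (df ∘ suc))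

    divide : ∀ d {f} a → Deg (suc d) f → ∃ λ g → Deg d g × (∀ x → f x ≡ f a + (x - a) * g x)
    divide zero {f} a (c , g , (c′ , q) , p) = (λ _ → c′) , Deg-const 0 c′ , λ x → begin
      f x                       ≡⟨ p x ⟩
      c + x * g x               ≡⟨ cong (λ y → c + x * y) (q x) ⟩
      c + x * c′                ≡⟨ lem c x c′ a ⟩
      (c + a * c′) + (x - a) * c′ ≡⟨ cong (λ y → (c + a * y) + (x - a) * c′) (q a) ⟨
      (c + a * g a) + (x - a) * c′ ≡⟨ cong (_+ (x - a) * c′) (p a) ⟨
      f a + (x - a) * c′ ∎
      where
      lem : ∀ c x k a → c + x * k ≡ (c + a * k) + (x - a) * k
      lem = solve 4 (λ c x k a → c :+ x :* k := (c :+ a :* k) :+ (x :- a) :* k) refl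
    divide (suc d) {f} a (c , g , dg , p) with divide d a dg
    ... | h , dh , q = (λ x → g a + x * h x) , (g a , h , dh , λ _ → refl) , λ x → begin
      f x                       ≡⟨ p x ⟩
      c + x * g x               ≡⟨ cong (λ y → c + x * y) (q x) ⟩
      c + x * (g a + (x - a) * h x)  ≡⟨ lem c x a (g a) (h x) ⟩
      (c + a * g a) + (x - a) * (g a + x * h x) ≡⟨ cong (_+ _) (p a) ⟨
      f a + (x - a) * (g a + x * h x) ∎
      where
      lem : ∀ c x a k h → c + x * (k + (x - a) * h) ≡ (c + a * k) + (x - a) * (k + x * h)
      lem = solve 5 (λ c x a k h → c :+ x :* (k :+ (x :- a) :* h) := (c :+ a :* k) :+ (x :- a) :* (k :+ x :* h)) refl

    -- Divide by `x - ν zero` and induct. Over a finite field every function has some degree, so a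
    -- degree bound is informative only when this many distinct nodes exist; hence the node families
    -- supplied throughout.
    roots⇒zero : ∀ d {f} → Deg d f → (ν : Fin (suc d) → K) → Injective _≡_ _≡_ ν → (∀ i → f (ν i) ≡ 0#) → ∀ x → f x ≡ 0#
    roots⇒zero zero (c , p) ν inj r x = trans (p x) (trans (sym (p (ν zero))) (r zero))
    roots⇒zero (suc d) {f} df ν inj r x with divide d (ν zero) df
    ... | g , dg , q = begin
        f x                                    ≡⟨ q x ⟩
        f (ν zero) + (x - ν zero) * g x        ≡⟨ cong₂ (λ a b → a + (x - ν zero) * b) (r zero) (roots⇒zero d dg (ν ∘ suc) (Finₚ.suc-injective ∘ inj) g-zero x) ⟩
        0# + (x - ν zero) * 0#                 ≡⟨ lem _ ⟩
        0# ∎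
      where
      lem : ∀ y → 0# + y * 0# ≡ 0#
      lem = solve 1 (λ y → :0 :+ y :* :0 := :0) refl
      g-zero : ∀ i → g (ν (suc i)) ≡ 0#
      g-zero i = *-cancel-0 (ν (suc i) - ν zero) _
        (λ eq → contradiction (inj (x-y≡0⇒x≡y _ _ eq)) λ ())
        (begin
          (ν (suc i) - ν zero) * g (ν (suc i)) ≡⟨ +-identityˡ _ ⟨
          0# + (ν (suc i) - ν zero) * g (ν (suc i)) ≡⟨ cong (_+ _) (r zero) ⟨
          f (ν zero) + (ν (suc i) - ν zero) * g (ν (suc i)) ≡⟨ q _ ⟨
          f (ν (suc i)) ≡⟨ r (suc i) ⟩
          0# ∎)

    -- The Lagrange basis polynomial of the node `ν c`; `punchIn c` runs through the other nodes.
    ℓ : ∀ {d} (ν : Fin (suc d) → K) → Fin (suc d) → K → K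
    ℓ ν c x = ∏ (λ i → (x - ν (punchIn c i)) * inv (ν c - ν (punchIn c i)))

    Deg-ℓ : ∀ {d} (ν : Fin (suc d) → K) c → Deg d (ℓ ν c)
    Deg-ℓ {d} ν c = subst (λ k → Deg k (ℓ ν c)) (ℕₚ.*-identityʳ d) (Deg-∏ {d} 1 (λ i x → (x - ν (punchIn c i)) * inv (ν c - ν (punchIn c i))) (λ i → Deg-linear _ _))

    ℓ-same : ∀ {d} (ν : Fin (suc d) → K) → Injective _≡_ _≡_ ν → ∀ c → ℓ ν c (ν c) ≡ 1#
    ℓ-same ν inj c = ∏-one _ (λ i → inverseʳ _ (λ eq → Finₚ.punchInᵢ≢i c i (sym (inj (x-y≡0⇒x≡y _ _ eq)))))

    ℓ-diff : ∀ {d} (ν : Fin (suc d) → K) c c′ → c′ ≢ c → ℓ ν c (ν c′) ≡ 0#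
    ℓ-diff ν c c′ ne = ∏-zero _ p (begin
      (ν c′ - ν (punchIn c p)) * k ≡⟨ cong (λ e → (ν c′ - ν e) * k) (Finₚ.punchIn-punchOut (ne ∘ sym)) ⟩
      (ν c′ - ν c′) * k            ≡⟨ cong (_* k) (-‿inverseʳ _) ⟩
      0# * k                       ≡⟨ zeroˡ k ⟩
      0#                           ∎)
      where
      p = punchOut (ne ∘ sym)
      k = inv (ν c - ν (punchIn c p))

    lagrange : ∀ {d f} (ν : Fin (suc d) → K) → Injective _≡_ _≡_ ν → Deg d f → ∀ x → f x ≡ sum (λ c → ℓ ν c x * f (ν c))
    lagrange {d} {f} ν inj df x = x-y≡0⇒x≡y _ _
      (roots⇒zero d (Deg-sub d df (Deg-sum d _ (λ c → Deg-cong d (λ y → *-comm _ _) (Deg-scale d (f (ν c)) (Deg-ℓ ν c)))))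
        ν inj (λ i → trans (cong (λ y → f (ν i) - y) (atNode i)) (-‿inverseʳ _)) x)
      where
      atNode : ∀ i → sum (λ c → ℓ ν c (ν i) * f (ν c)) ≡ f (ν i)
      atNode i = trans (sum-single _ i (λ c ne → trans (cong (_* f (ν c)) (ℓ-diff ν c i (ne ∘ sym))) (zeroˡ _)))
                   (trans (cong (_* f (ν i)) (ℓ-same ν inj i)) (*-identityˡ _))

    -- Gaussian elimination: a zero first equation is dropped, and otherwise it is solved for a
    -- pivot unknown `j₀`, which is substituted into the remaining equations.
    homogeneous : ∀ {m n} → m ℕ.< n → (A : Fin m → Fin n → K) →
      ∃ λ (x : Fin n → K) → (∃ λ j → x j ≢ 0#) × (∀ i → sum (λ j → A i j * x j) ≡ 0#)
    homogeneous {zero} {suc n} m<n A = (λ _ → 1#) , (zero , 1≢0) , λ ()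
    homogeneous {suc m} {suc n} (ℕ.s≤s m<n) A with Finₚ.any? (λ j → ¬? (A zero j ≟K 0#))
    ... | no allZero = let x , nz , sol = homogeneous (ℕₚ.m<n⇒m<1+n m<n) (A ∘ suc) in
          x , nz , λ { zero → sum-zero _ (λ j → trans (cong (_* x j) (A0 j)) (zeroˡ _)) ; (suc i) → sol i }
      where
      A0 : ∀ j → A zero j ≡ 0#
      A0 j with A zero j ≟K 0#
      ... | yes eq = eq
      ... | no ne = contradiction (j , ne) allZero
    ... | yes (j₀ , pivot) = x , (punchIn j₀ (proj₁ nz) , x-nz) , sol′
      where
      p = inv (A zero j₀)
      B : Fin m → Fin n → K
      B i j = A (suc i) (punchIn j₀ j) - (A (suc i) j₀ * p) * A zero (punchIn j₀ j)
      IH = homogeneous m<n B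
      x′ = proj₁ IH
      nz = proj₁ (proj₂ IH)
      rest = sum (λ j → A zero (punchIn j₀ j) * x′ j)
      x = insertAt x′ j₀ (- (p * rest))
      x-nz : x (punchIn j₀ (proj₁ nz)) ≢ 0#
      x-nz eq = proj₂ nz (trans (sym (VFₚ.insertAt-punchIn x′ j₀ _ (proj₁ nz))) eq)
      expand : ∀ i → sum (λ j → A i j * x j) ≡ A i j₀ * (- (p * rest)) + sum (λ j → A i (punchIn j₀ j) * x′ j)
      expand i = trans (sum-remove {i = j₀} (λ j → A i j * x j))
        (cong₂ _+_ (cong (A i j₀ *_) (VFₚ.insertAt-lookup x′ j₀ _))
          (sum-cong-≗ (λ j → cong (A i (punchIn j₀ j) *_) (VFₚ.insertAt-punchIn x′ j₀ _ j))))
      lem₀ : ∀ a p r → a * (- (p * r)) + r ≡ r - (a * p) * r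
      lem₀ = solve 3 (λ a p r → a :* (:- (p :* r)) :+ r := r :- (a :* p) :* r) refl
      lem₁ : ∀ r → r - 1# * r ≡ 0#
      lem₁ = solve 1 (λ r → r :- :1 :* r := :0) refl
      lem₂ : ∀ a b c y → (a - b * c) * y ≡ a * y + (- b) * (c * y)
      lem₂ = solve 4 (λ a b c y → (a :- b :* c) :* y := a :* y :+ (:- b) :* (c :* y)) refl
      lem₃ : ∀ a p r s → a * (- (p * r)) + s ≡ s + (- (a * p)) * r
      lem₃ = solve 4 (λ a p r s → a :* (:- (p :* r)) :+ s := s :+ (:- (a :* p)) :* r) refl
      sol′ : ∀ i → sum (λ j → A i j * x j) ≡ 0#
      sol′ zero = begin
        _ ≡⟨ expand zero ⟩
        A zero j₀ * (- (p * rest)) + rest ≡⟨ lem₀ _ _ _ ⟩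
        rest - (A zero j₀ * p) * rest ≡⟨ cong (λ k → rest - k * rest) (inverseʳ _ pivot) ⟩
        rest - 1# * rest ≡⟨ lem₁ _ ⟩
        0# ∎
      sol′ (suc i) = begin
        _ ≡⟨ expand (suc i) ⟩
        A (suc i) j₀ * (- (p * rest)) + sum (λ j → A (suc i) (punchIn j₀ j) * x′ j) ≡⟨ lem₃ _ _ _ _ ⟩
        sum (λ j → A (suc i) (punchIn j₀ j) * x′ j) + (- (A (suc i) j₀ * p)) * rest
          ≡⟨ cong (sum (λ j → A (suc i) (punchIn j₀ j) * x′ j) +_) (*-distribˡ-sum (- (A (suc i) j₀ * p)) (λ j → A zero (punchIn j₀ j) * x′ j)) ⟩
        sum (λ j → A (suc i) (punchIn j₀ j) * x′ j) + sum (λ j → (- (A (suc i) j₀ * p)) * (A zero (punchIn j₀ j) * x′ j))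
          ≡⟨ ∑-distrib-+ (λ j → A (suc i) (punchIn j₀ j) * x′ j) _ ⟨
        sum (λ j → A (suc i) (punchIn j₀ j) * x′ j + (- (A (suc i) j₀ * p)) * (A zero (punchIn j₀ j) * x′ j))
          ≡⟨ sum-cong-≗ (λ j → lem₂ (A (suc i) (punchIn j₀ j)) (A (suc i) j₀ * p) (A zero (punchIn j₀ j)) (x′ j)) ⟨
        sum (λ j → B i j * x′ j) ≡⟨ proj₂ (proj₂ IH) i ⟩
        0# ∎

-- Matrices with polynomial entries: singularity and kernel vectors

module PolynomialMatrices where
  open Polynomials
  open import Data.Nat as ℕ using (ℕ; zero; suc)
  import Data.Nat.Properties as ℕₚ
  open import Data.Fin as Fin using (Fin; zero; suc; combine; remQuot)
  import Data.Fin.Properties as Finₚ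
  open import Data.Product using (∃; _×_; _,_; proj₁; proj₂)
  open import Data.Empty using (⊥)
  open import Function using (_∘_)
  open import Function.Definitions using (Injective)
  open import Relation.Nullary using (¬_; Dec; yes; no; contradiction; ¬?)
  open import Relation.Binary.PropositionalEquality

  -- This fixes the number Δ of coefficients per multiplier: N (Δ + D + 1) equations in (N + 1) Δ
  -- unknowns are underdetermined once Δ > N (D + 1), and Δ = (N + 1)(D + 1) is such a value.
  more-unknowns : ∀ N D → N ℕ.* suc (suc N ℕ.* suc D ℕ.+ D) ℕ.< suc N ℕ.* (suc N ℕ.* suc D)
  more-unknowns N D = begin-strict
    N ℕ.* suc (Δ ℕ.+ D)         ≡⟨ cong (N ℕ.*_) (ℕₚ.+-suc Δ D) ⟨
    N ℕ.* (Δ ℕ.+ suc D)         ≡⟨ ℕₚ.*-distribˡ-+ N Δ (suc D) ⟩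
    N ℕ.* Δ ℕ.+ N ℕ.* suc D     <⟨ ℕₚ.+-monoʳ-< (N ℕ.* Δ) (ℕₚ.*-monoˡ-< (suc D) (ℕₚ.n<1+n N)) ⟩
    N ℕ.* Δ ℕ.+ Δ               ≡⟨ ℕₚ.+-comm (N ℕ.* Δ) Δ ⟩
    suc N ℕ.* Δ                 ∎
    where
    open ℕₚ.≤-Reasoning
    Δ = suc N ℕ.* suc D

  module PencilTheory {K : Set} (F : FieldOn K) where
    open FieldTheory F
    open ≡-Reasoning

    Matrix : ℕ → Set
    Matrix N = Fin N → Fin N → K

    -- Singularity is witnessed by a left kernel vector, so no determinant or characteristic
    -- polynomial is needed; singular shifts are counted by the independence of eigenvectors.
    LeftSingular : ∀ {N} → Matrix N → Set
    LeftSingular {N} A = ∃ λ (w : Fin N → K) → (∃ λ g → w g ≢ 0#) × (∀ g′ → sum (λ g → w g * A g g′) ≡ 0#)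

    δ : ∀ {N} → Matrix N
    δ i j with i Fin.≟ j
    ... | yes _ = 1#
    ... | no _ = 0#

    δ-same : ∀ {N} (i : Fin N) → δ i i ≡ 1#
    δ-same i with i Fin.≟ i
    ... | yes _ = refl
    ... | no ne = contradiction refl ne

    δ-diff : ∀ {N} {i j : Fin N} → i ≢ j → δ i j ≡ 0#
    δ-diff {i = i} {j} ne with i Fin.≟ j
    ... | yes eq = contradiction eq ne
    ... | no _ = refl

    sum-δʳ : ∀ {N} (w : Fin N → K) j → sum (λ g → w g * δ g j) ≡ w j
    sum-δʳ w j = trans (sum-single _ j (λ g ne → trans (cong (w g *_) (δ-diff ne)) (zeroʳ _)))
                       (trans (cong (w j *_) (δ-same j)) (lem (w j)))
      where
      lem : ∀ x → x * 1# ≡ x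
      lem = solve 1 (λ x → x :* :1 := x) refl

    allZero? : ∀ {n} (w : Fin n → K) → Dec (∃ λ g → w g ≢ 0#)
    allZero? w = Finₚ.any? (λ g → ¬? (w g ≟K 0#))

    ¬nonzero⇒zero : ∀ {n} {w : Fin n → K} → ¬ (∃ λ g → w g ≢ 0#) → ∀ g → w g ≡ 0#
    ¬nonzero⇒zero {w = w} none g with w g ≟K 0#
    ... | yes eq = eq
    ... | no ne = contradiction (g , ne) none

    sum-swap-* : ∀ {m n} (c : Fin m → K) (f : Fin m → Fin n → K) (a : Fin n → K) →
      sum (λ i → c i * sum (λ j → f i j * a j)) ≡ sum (λ j → sum (λ i → c i * f i j) * a j)
    sum-swap-* c f a = begin
      sum (λ i → c i * sum (λ j → f i j * a j))   ≡⟨ sum-cong-≗ (λ i → *-distribˡ-sum (c i) (λ j → f i j * a j)) ⟩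
      sum (λ i → sum (λ j → c i * (f i j * a j))) ≡⟨ ∑-comm (λ i j → c i * (f i j * a j)) ⟩
      sum (λ j → sum (λ i → c i * (f i j * a j))) ≡⟨ sum-cong-≗ (λ j → sum-cong-≗ (λ i → sym (*-assoc (c i) (f i j) (a j)))) ⟩
      sum (λ j → sum (λ i → (c i * f i j) * a j)) ≡⟨ sum-cong-≗ (λ j → *-distribʳ-sum (a j) (λ i → c i * f i j)) ⟨
      sum (λ j → sum (λ i → c i * f i j) * a j)   ∎

    -- Apply A to the relation and combine the result with `μ zero` times the relation: the first
    -- vector cancels, and the others keep the coefficients `c i * (μ i - μ zero)`, which vanish by
    -- induction.
    eigenvectors-independent : ∀ {N T} (A : Matrix N) (w : Fin T → Fin N → K) (μ : Fin T → K) →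
      Injective _≡_ _≡_ μ → (∀ i → ∃ λ g → w i g ≢ 0#) →
      (∀ i g′ → sum (λ g → w i g * A g g′) ≡ - (μ i * w i g′)) →
      (c : Fin T → K) → (∀ g → sum (λ i → c i * w i g) ≡ 0#) → ∀ i → c i ≡ 0#
    eigenvectors-independent {N} {suc T} A w μ inj nz eig c rel = λ { zero → head-zero ; (suc i) → tail-zero i }
      where
      scaled : ∀ g → sum (λ i → (c i * μ i) * w i g) ≡ 0#
      scaled g = begin
        sum (λ i → (c i * μ i) * w i g)               ≡⟨ sum-cong-≗ (λ i → lem (c i) (μ i) (w i g)) ⟩
        sum (λ i → (- 1#) * (c i * - (μ i * w i g)))  ≡⟨ *-distribˡ-sum (- 1#) (λ i → c i * - (μ i * w i g)) ⟨
        (- 1#) * sum (λ i → c i * - (μ i * w i g))    ≡⟨ cong ((- 1#) *_) (sum-cong-≗ (λ i → cong (c i *_) (sym (eig i g)))) ⟩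
        (- 1#) * sum (λ i → c i * sum (λ h → w i h * A h g)) ≡⟨ cong ((- 1#) *_) (sum-swap-* c w (λ h → A h g)) ⟩
        (- 1#) * sum (λ h → sum (λ i → c i * w i h) * A h g) ≡⟨ cong ((- 1#) *_) (sum-zero _ (λ h → trans (cong (_* A h g) (rel h)) (zeroˡ _))) ⟩
        (- 1#) * 0#                                   ≡⟨ zeroʳ _ ⟩
        0#                                            ∎
        where
        lem : ∀ c m w → (c * m) * w ≡ (- 1#) * (c * - (m * w))
        lem = solve 3 (λ c m w → (c :* m) :* w := (:- :1) :* (c :* (:- (m :* w)))) refl
      c′ : Fin (suc T) → K
      c′ i = c i * (μ i - μ zero)
      rel′ : ∀ g → sum (λ i → c′ i * w i g) ≡ 0#
      rel′ g = begin
        sum (λ i → c′ i * w i g) ≡⟨ sum-cong-≗ (λ i → lem (c i) (μ i) (μ zero) (w i g)) ⟩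
        sum (λ i → (c i * μ i) * w i g + (- μ zero) * (c i * w i g)) ≡⟨ ∑-distrib-+ (λ i → (c i * μ i) * w i g) (λ i → (- μ zero) * (c i * w i g)) ⟩
        sum (λ i → (c i * μ i) * w i g) + sum (λ i → (- μ zero) * (c i * w i g))
          ≡⟨ cong₂ _+_ (scaled g) (sym (*-distribˡ-sum (- μ zero) (λ i → c i * w i g))) ⟩
        0# + (- μ zero) * sum (λ i → c i * w i g) ≡⟨ cong (λ y → 0# + (- μ zero) * y) (rel g) ⟩
        0# + (- μ zero) * 0# ≡⟨ trans (+-identityˡ _) (zeroʳ _) ⟩
        0# ∎
        where
        lem : ∀ c m n w → (c * (m - n)) * w ≡ (c * m) * w + (- n) * (c * w)
        lem = solve 4 (λ c m n w → (c :* (m :- n)) :* w := (c :* m) :* w :+ (:- n) :* (c :* w)) refl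
      tail-rel : ∀ g → sum (λ i → c′ (suc i) * w (suc i) g) ≡ 0#
      tail-rel g = begin
        s                              ≡⟨ lem (c zero) (μ zero) (w zero g) s ⟨
        c′ zero * w zero g + s         ≡⟨ rel′ g ⟩
        0#                             ∎
        where
        s = sum (λ i → c′ (suc i) * w (suc i) g)
        lem : ∀ c m w s → (c * (m - m)) * w + s ≡ s
        lem = solve 4 (λ c m w s → (c :* (m :- m)) :* w :+ s := s) refl
      tail-zero : ∀ i → c (suc i) ≡ 0#
      tail-zero i = *-cancel-0 (μ (suc i) - μ zero) _
        (λ eq → contradiction (inj (x-y≡0⇒x≡y _ _ eq)) λ ())
        (trans (*-comm _ _) (eigenvectors-independent A (w ∘ suc) (μ ∘ suc) (Finₚ.suc-injective ∘ inj) (nz ∘ suc) (eig ∘ suc) (c′ ∘ suc) tail-rel i))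
      head-zero : c zero ≡ 0#
      head-zero = *-cancel-0 (w zero g) _ (proj₂ (nz zero)) (begin
        w zero g * c zero      ≡⟨ *-comm _ _ ⟩
        c zero * w zero g      ≡⟨ +-identityʳ _ ⟨
        c zero * w zero g + 0# ≡⟨ cong (c zero * w zero g +_) (sum-zero _ (λ i → trans (cong (_* w (suc i) g) (tail-zero i)) (zeroˡ _))) ⟨
        sum (λ i → c i * w i g) ≡⟨ rel g ⟩
        0# ∎)
        where
        g = proj₁ (nz zero)

    -- A singular shift by μ makes -μ an eigenvalue of A, and N + 1 eigenvectors in K^N are
    -- dependent.
    few-singular-shifts : ∀ {N} (A : Matrix N) (μ : Fin (suc N) → K) → Injective _≡_ _≡_ μ →
      (∀ i → LeftSingular (λ g g′ → A g g′ + μ i * δ g g′)) → ⊥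
    few-singular-shifts {N} A μ inj sing = proj₂ nonzero (eigenvectors-independent A w μ inj (λ i → proj₁ (proj₂ (sing i))) eig c rel (proj₁ nonzero))
      where
      w : Fin (suc N) → Fin N → K
      w i = proj₁ (sing i)
      eig : ∀ i g′ → sum (λ g → w i g * A g g′) ≡ - (μ i * w i g′)
      eig i g′ = x-y≡0⇒x≡y _ _ (begin
        sum (λ g → w i g * A g g′) - - (μ i * w i g′)  ≡⟨ lem₁ _ _ ⟩
        sum (λ g → w i g * A g g′) + μ i * w i g′      ≡⟨ cong (λ y → sum (λ g → w i g * A g g′) + μ i * y) (sum-δʳ (w i) g′) ⟨
        sum (λ g → w i g * A g g′) + μ i * sum (λ g → w i g * δ g g′) ≡⟨ cong (sum (λ g → w i g * A g g′) +_) (*-distribˡ-sum (μ i) (λ g → w i g * δ g g′)) ⟩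
        sum (λ g → w i g * A g g′) + sum (λ g → μ i * (w i g * δ g g′)) ≡⟨ ∑-distrib-+ (λ g → w i g * A g g′) _ ⟨
        sum (λ g → w i g * A g g′ + μ i * (w i g * δ g g′)) ≡⟨ sum-cong-≗ (λ g → lem₂ (w i g) (A g g′) (μ i) (δ g g′)) ⟩
        sum (λ g → w i g * (A g g′ + μ i * δ g g′))    ≡⟨ proj₂ (proj₂ (sing i)) g′ ⟩
        0# ∎)
        where
        lem₁ : ∀ a b → a - - b ≡ a + b
        lem₁ = solve 2 (λ a b → a :- (:- b) := a :+ b) refl
        lem₂ : ∀ w a m d → w * a + m * (w * d) ≡ w * (a + m * d)
        lem₂ = solve 4 (λ w a m d → w :* a :+ m :* (w :* d) := w :* (a :+ m :* d)) refl
      dependency = homogeneous (ℕₚ.n<1+n N) (λ g i → w i g)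
      c = proj₁ dependency
      nonzero = proj₁ (proj₂ dependency)
      rel : ∀ g → sum (λ i → c i * w i g) ≡ 0#
      rel g = trans (sum-cong-≗ (λ i → *-comm (c i) (w i g))) (proj₂ (proj₂ dependency) g)

    pow : K → ℕ → K
    pow x zero = 1#
    pow x (suc a) = x * pow x a

    module _ {N D} (M : K → Matrix N) (M-deg : ∀ g g′ → Deg D (λ t → M t g g′)) (η₀ : K) where

      -- Expanding around `η₀` makes the value at `η₀` the constant coefficient.
      poly : ∀ {Δ} → (Fin Δ → K) → K → K
      poly x t = sum (λ a → pow (t - η₀) (Fin.toℕ a) * x a)

      poly-step : ∀ {Δ} (x : Fin (suc Δ) → K) t → poly x t ≡ x zero + (t - η₀) * poly (x ∘ suc) t
      poly-step x t = cong₂ _+_ (*-identityˡ _)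
        (trans (sum-cong-≗ (λ a → *-assoc (t - η₀) (pow (t - η₀) (Fin.toℕ a)) (x (suc a))))
               (sym (*-distribˡ-sum (t - η₀) (λ a → pow (t - η₀) (Fin.toℕ a) * x (suc a)))))

      -- The bound Δ, one more than necessary for Δ coefficients, spares a special treatment of Δ =
      -- 0.
      Deg-poly : ∀ {Δ} (x : Fin Δ → K) → Deg Δ (poly x)
      Deg-poly {zero} x = Deg-const 0 0#
      Deg-poly {suc Δ} x = Deg-cong (suc Δ) (λ t → sym (poly-step x t))
        (Deg-+ (suc Δ) (Deg-const (suc Δ) (x zero))
          (Deg-cong (suc Δ) (λ t → cong (_* poly (x ∘ suc) t) (*-identityʳ′ (t - η₀)))
            (Deg-* 1 Δ (Deg-linear η₀ 1#) (Deg-poly (x ∘ suc)))))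
        where
        *-identityʳ′ : ∀ x → x * 1# ≡ x
        *-identityʳ′ = solve 1 (λ x → x :* :1 := x) refl

      row : ∀ {Δ} → (Fin N → Fin Δ → K) → Fin N → K → K
      row x g′ t = sum (λ g → poly (x g) t * M t g g′)

      Deg-row : ∀ {Δ} (x : Fin N → Fin Δ → K) g′ → Deg (Δ ℕ.+ D) (row x g′)
      Deg-row {Δ} x g′ = Deg-sum (Δ ℕ.+ D) _ (λ g → Deg-* Δ D (Deg-poly (x g)) (M-deg g g′))

      -- The lowest nonzero coefficient (in powers of t - η₀) of a polynomial syzygy of M would be a left kernel vector of M η₀.
      zero-row⇒zero : ∀ {Δ T} → suc (Δ ℕ.+ D) ℕ.≤ T → (ρ : Fin T → K) → Injective _≡_ _≡_ ρ → (∀ i → ρ i ≢ η₀) →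
        ¬ LeftSingular (M η₀) → (x : Fin N → Fin Δ → K) → (∀ g′ t → row x g′ t ≡ 0#) → ∀ g a → x g a ≡ 0#
      zero-row⇒zero {suc Δ} Δ+D<T ρ ρ-inj ρ≢η₀ regular x row≡0 = λ { g zero → constant≡0 g ; g (suc a) → IH g a }
        where
        poly-η₀ : ∀ g → poly (x g) η₀ ≡ x g zero
        poly-η₀ g = trans (poly-step (x g) η₀) (lem (x g zero) η₀ _)
          where
          lem : ∀ c t y → c + (t - t) * y ≡ c
          lem = solve 3 (λ c t y → c :+ (t :- t) :* y := c) refl
        constant≡0 : ∀ g → x g zero ≡ 0#
        constant≡0 = ¬nonzero⇒zero (λ nz → regular ((λ g → x g zero) , nz , λ g′ →
          trans (sum-cong-≗ (λ g → cong (_* M η₀ g g′) (sym (poly-η₀ g)))) (row≡0 g′ η₀)))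
        factor : ∀ g′ t → (t - η₀) * row (λ g → x g ∘ suc) g′ t ≡ 0#
        factor g′ t = begin
          (t - η₀) * row (λ g → x g ∘ suc) g′ t ≡⟨ *-distribˡ-sum (t - η₀) (λ g → poly (x g ∘ suc) t * M t g g′) ⟩
          sum (λ g → (t - η₀) * (poly (x g ∘ suc) t * M t g g′)) ≡⟨ sum-cong-≗ (λ g → trans (lem (t - η₀) (poly (x g ∘ suc) t) (M t g g′)) (cong (λ c → (c + (t - η₀) * poly (x g ∘ suc) t) * M t g g′) (sym (constant≡0 g)))) ⟩
          sum (λ g → (x g zero + (t - η₀) * poly (x g ∘ suc) t) * M t g g′) ≡⟨ sum-cong-≗ (λ g → cong (_* M t g g′) (sym (poly-step (x g) t))) ⟩
          row x g′ t ≡⟨ row≡0 g′ t ⟩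
          0# ∎
          where
          lem : ∀ k y m → k * (y * m) ≡ (0# + k * y) * m
          lem = solve 3 (λ k y m → k :* (y :* m) := (:0 :+ k :* y) :* m) refl
        -- `factor` can be cancelled only where t differs from `η₀`. The nodes `ρ` avoid `η₀` and
        -- are numerous enough for the degree, so vanishing at them extends to all t, including
        -- `η₀`.
        row′≡0 : ∀ g′ t → row (λ g → x g ∘ suc) g′ t ≡ 0#
        row′≡0 g′ = roots⇒zero (Δ ℕ.+ D) (Deg-row (λ g → x g ∘ suc) g′)
          (λ i → ρ (Fin.inject≤ i fewer)) (Finₚ.inject≤-injective fewer fewer _ _ ∘ ρ-inj)
          (λ i → *-cancel-0 (ρ (Fin.inject≤ i fewer) - η₀) _ (λ eq → ρ≢η₀ _ (x-y≡0⇒x≡y _ _ eq)) (factor g′ _))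
          where
          fewer = ℕₚ.≤-trans (ℕₚ.n≤1+n _) Δ+D<T
        IH = zero-row⇒zero (ℕₚ.≤-trans (ℕₚ.n≤1+n _) Δ+D<T) ρ ρ-inj ρ≢η₀ regular (λ g → x g ∘ suc) row′≡0

    -- Siegel's argument: row operations with polynomial coefficients turn the rows of M into a single scalar R(t) (1,…,1),
    -- and R vanishes wherever M t kills a vector of coordinate sum 1.
    few-kernel-vectors : ∀ {N D Δ} (M : K → Matrix (suc N)) → (∀ g g′ → Deg D (λ t → M t g g′)) →
      N ℕ.* suc (Δ ℕ.+ D) ℕ.< suc N ℕ.* Δ →
      (η₀ : K) → ¬ LeftSingular (M η₀) →
      (ρ : Fin (suc (Δ ℕ.+ D)) → K) → Injective _≡_ _≡_ ρ → (∀ i → ρ i ≢ η₀) →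
      (τ : Fin (suc (Δ ℕ.+ D)) → K) → Injective _≡_ _≡_ τ →
      (u : Fin (suc (Δ ℕ.+ D)) → Fin (suc N) → K) → (∀ i → sum (u i) ≡ 1#) →
      (∀ i g → sum (λ g′ → M (τ i) g g′ * u i g′) ≡ 0#) → ⊥
    few-kernel-vectors {N} {D} {Δ} M M-deg small η₀ regular ρ ρ-inj ρ≢η₀ τ τ-inj u u-sum u-ker =
      proj₂ nonzero (trans (cong z (sym (Finₚ.combine-remQuot {suc N} Δ (proj₁ nonzero))))
        (zero-row⇒zero M M-deg η₀ ℕₚ.≤-refl ρ ρ-inj ρ≢η₀ regular x rows≡0 (proj₁ index) (proj₂ index)))
      where
      T = suc (Δ ℕ.+ D)
      -- One equation for each column g″ + 1 and each node: the entries of the combined row in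
      -- columns g″ + 1 and 0 agree at `ρ c`. Agreement at Δ + D + 1 nodes is agreement for all t,
      -- by degree.
      entry : Fin N × Fin T → Fin (suc N) × Fin Δ → K
      entry (g″ , c) (g , a) = pow (ρ c - η₀) (Fin.toℕ a) * (M (ρ c) g (suc g″) - M (ρ c) g zero)
      coefficient : Fin (N ℕ.* T) → Fin (suc N ℕ.* Δ) → K
      coefficient r s = entry (remQuot {N} T r) (remQuot {suc N} Δ s)
      solution = homogeneous small coefficient
      z = proj₁ solution
      nonzero = proj₁ (proj₂ solution)
      index = remQuot {suc N} Δ (proj₁ nonzero)
      x : Fin (suc N) → Fin Δ → K
      x g a = z (combine {suc N} {Δ} g a)
      row′ = row M M-deg η₀ x
      p : Fin (suc N) → K → K
      p g = poly M M-deg η₀ (x g)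
      difference-sum : ∀ g″ t → sum (λ g → p g t * (M t g (suc g″) - M t g zero)) ≡ row′ (suc g″) t - row′ zero t
      difference-sum g″ t = begin
        sum (λ g → p g t * (M t g (suc g″) - M t g zero)) ≡⟨ sum-cong-≗ (λ g → lem₁ (p g t) (M t g (suc g″)) (M t g zero)) ⟩
        sum (λ g → p g t * M t g (suc g″) + (- 1#) * (p g t * M t g zero)) ≡⟨ ∑-distrib-+ (λ g → p g t * M t g (suc g″)) (λ g → (- 1#) * (p g t * M t g zero)) ⟩
        row′ (suc g″) t + sum (λ g → (- 1#) * (p g t * M t g zero)) ≡⟨ cong (row′ (suc g″) t +_) (*-distribˡ-sum (- 1#) (λ g → p g t * M t g zero)) ⟨
        row′ (suc g″) t + (- 1#) * row′ zero t ≡⟨ lem₂ (row′ (suc g″) t) (row′ zero t) ⟩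
        row′ (suc g″) t - row′ zero t ∎
        where
        lem₁ : ∀ p a b → p * (a - b) ≡ p * a + (- 1#) * (p * b)
        lem₁ = solve 3 (λ p a b → p :* (a :- b) := p :* a :+ (:- :1) :* (p :* b)) refl
        lem₂ : ∀ a b → a + (- 1#) * b ≡ a - b
        lem₂ = solve 2 (λ a b → a :+ (:- :1) :* b := a :- b) refl
      at-ρ : ∀ g″ c → row′ (suc g″) (ρ c) - row′ zero (ρ c) ≡ 0#
      at-ρ g″ c = begin
        row′ (suc g″) (ρ c) - row′ zero (ρ c) ≡⟨ difference-sum g″ (ρ c) ⟨
        sum (λ g → p g (ρ c) * Q g) ≡⟨ sum-cong-≗ (λ g → *-distribʳ-sum (Q g) (λ a → pow (ρ c - η₀) (Fin.toℕ a) * x g a)) ⟩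
        sum (λ g → sum (λ a → (pow (ρ c - η₀) (Fin.toℕ a) * x g a) * Q g)) ≡⟨ sum-cong-≗ {suc N} (λ g → sum-cong-≗ {Δ} (λ a → same g a)) ⟩
        sum (λ g → sum (λ a → coefficient (combine {N} {T} g″ c) (combine {suc N} {Δ} g a) * z (combine {suc N} {Δ} g a))) ≡⟨ sum-combine (suc N) (λ s → coefficient (combine {N} {T} g″ c) s * z s) ⟨
        sum (λ s → coefficient (combine {N} {T} g″ c) s * z s) ≡⟨ proj₂ (proj₂ solution) (combine {N} {T} g″ c) ⟩
        0# ∎
        where
        Q : Fin (suc N) → K
        Q g = M (ρ c) g (suc g″) - M (ρ c) g zero
        lem : ∀ w x q → (w * x) * q ≡ (w * q) * x
        lem = solve 3 (λ w x q → (w :* x) :* q := (w :* q) :* x) refl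
        same : ∀ g a → (pow (ρ c - η₀) (Fin.toℕ a) * x g a) * Q g ≡ coefficient (combine {N} {T} g″ c) (combine {suc N} {Δ} g a) * z (combine {suc N} {Δ} g a)
        same g a = trans (lem (pow (ρ c - η₀) (Fin.toℕ a)) (x g a) (Q g)) (cong (_* x g a)
          (sym (cong₂ entry (Finₚ.remQuot-combine {N} {T} g″ c) (Finₚ.remQuot-combine {suc N} {Δ} g a))))
      equal-rows : ∀ g′ t → row′ g′ t ≡ row′ zero t
      equal-rows zero t = refl
      equal-rows (suc g″) t = x-y≡0⇒x≡y _ _
        (roots⇒zero (Δ ℕ.+ D) (Deg-sub (Δ ℕ.+ D) (Deg-row M M-deg η₀ x (suc g″)) (Deg-row M M-deg η₀ x zero)) ρ ρ-inj (at-ρ g″) t)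
      at-τ : ∀ i → row′ zero (τ i) ≡ 0#
      at-τ i = begin
        row′ zero (τ i)                                   ≡⟨ *-identityˡ _ ⟨
        1# * row′ zero (τ i)                              ≡⟨ cong (_* row′ zero (τ i)) (u-sum i) ⟨
        sum (u i) * row′ zero (τ i)                       ≡⟨ *-distribʳ-sum (row′ zero (τ i)) (u i) ⟩
        sum (λ g′ → u i g′ * row′ zero (τ i))             ≡⟨ sum-cong-≗ (λ g′ → trans (*-comm _ _) (cong (_* u i g′) (sym (equal-rows g′ (τ i))))) ⟩
        sum (λ g′ → row′ g′ (τ i) * u i g′)               ≡⟨ sum-swap-* (λ g → p g (τ i)) (M (τ i)) (u i) ⟨
        sum (λ g → p g (τ i) * sum (λ g′ → M (τ i) g g′ * u i g′)) ≡⟨ sum-zero _ (λ g → trans (cong (p g (τ i) *_) (u-ker i g)) (zeroʳ _)) ⟩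
        0#                                                ∎
      rows≡0 : ∀ g′ t → row′ g′ t ≡ 0#
      rows≡0 g′ t = trans (equal-rows g′ t) (roots⇒zero (Δ ℕ.+ D) (Deg-row M M-deg η₀ x zero) τ τ-inj at-τ t)

    -- The element of `Fin N` makes N a successor; Δ is N (D + 1).
    few-kernel-vectors⁺ : ∀ {N D} → Fin N → (M : K → Matrix N) → (∀ g g′ → Deg D (λ t → M t g g′)) →
      let T = suc (N ℕ.* suc D ℕ.+ D) in
      (η₀ : K) → ¬ LeftSingular (M η₀) →
      (ρ : Fin T → K) → Injective _≡_ _≡_ ρ → (∀ i → ρ i ≢ η₀) →
      (τ : Fin T → K) → Injective _≡_ _≡_ τ →
      (u : Fin T → Fin N → K) → (∀ i → sum (u i) ≡ 1#) →
      (∀ i g → sum (λ g′ → M (τ i) g g′ * u i g′) ≡ 0#) → ⊥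
    few-kernel-vectors⁺ {suc N} {D} _ M M-deg = few-kernel-vectors {Δ = suc N ℕ.* suc D} M M-deg (more-unknowns N D)

-- Interpolation on grids and certificates for the absence of common zeros

module Certificates where
  open Polynomials
  open PolynomialMatrices
  open import Data.Nat as ℕ using (ℕ; zero; suc)
  import Data.Nat.Properties as ℕₚ
  open import Data.Fin as Fin using (Fin; zero; suc; combine; remQuot; punchIn; punchOut; finToFun; funToFin)
  import Data.Fin.Properties as Finₚ
  open import Data.Vec.Functional using (_∷_; head; tail)
  open import Data.Product using (∃; _×_; _,_; proj₁; proj₂)
  open import Function using (_∘_)
  open import Function.Definitions using (Injective)
  open import Relation.Nullary using (Dec; yes; no; contradiction; ¬?)
  open import Relation.Binary.PropositionalEquality

  funToFin-cong : ∀ {m n} {f g : Fin m → Fin n} → f ≗ g → funToFin f ≡ funToFin g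
  funToFin-cong {zero} eq = refl
  funToFin-cong {suc m} eq = cong₂ combine (eq zero) (funToFin-cong (eq ∘ suc))

  finToFun-injective : ∀ {m n} {k l : Fin (n ℕ.^ m)} → finToFun {n} {m} k ≗ finToFun l → k ≡ l
  finToFun-injective {m} {n} {k} {l} eq =
    trans (sym (Finₚ.funToFin-finToFin {m} {n} k)) (trans (funToFin-cong eq) (Finₚ.funToFin-finToFin {m} {n} l))

  ≢⇒differ : ∀ {m n} {k l : Fin (n ℕ.^ m)} → k ≢ l → ∃ λ i → finToFun {n} {m} k i ≢ finToFun l i
  ≢⇒differ {m} {n} {k} {l} ne =
    Finₚ.¬∀⟶∃¬ m (λ i → finToFun k i ≡ finToFun l i) (λ i → finToFun k i Fin.≟ finToFun l i) (λ eq → ne (finToFun-injective eq))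

  missed-value : ∀ {n} (f : Fin n → Fin (suc n)) → ∃ λ j → ∀ i → f i ≢ j
  missed-value {n} f with Finₚ.any? (λ j → Finₚ.all? (λ i → ¬? (f i Fin.≟ j)))
  ... | yes found = found
  ... | no none = contradiction collision (λ (j , k , j<k , eq) → Finₚ.<⇒≢ j<k
          (trans (sym (proj₂ (preimage j))) (trans (cong f eq) (proj₂ (preimage k)))))
    where
    preimage : ∀ j → ∃ λ i → f i ≡ j
    preimage j with Finₚ.any? (λ i → f i Fin.≟ j)
    ... | yes p = p
    ... | no ¬p = contradiction (j , λ i eq → ¬p (i , eq)) none
    collision = Finₚ.pigeonhole (ℕₚ.n<1+n n) (proj₁ ∘ preimage)

  module TensorTheory {K : Set} (F : FieldOn K) where
    open FieldTheory F
    open PencilTheory F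
    open ≡-Reasoning

    Point : ℕ → Set
    Point n = Fin n → K

    Respects : ∀ {n} → (Point n → K) → Set
    Respects Φ = ∀ {z z′} → z ≗ z′ → Φ z ≡ Φ z′

    -- Axis-parallel lines are described by a property because they arise in several shapes, through
    -- `_∷_`, `insertAt` and `place`, and points are functions compared only pointwise.
    Line : ∀ {n} → Fin n → (K → Point n) → Set
    Line i c = (∀ t → c t i ≡ t) × (∀ j → j ≢ i → ∀ t t′ → c t j ≡ c t′ j)

    -- A bound on the degree in each variable separately is what makes interpolation on a product
    -- grid exact.
    SepDeg : ∀ {n} → ℕ → (Point n → K) → Set
    SepDeg d Φ = ∀ i c → Line i c → Deg d (λ t → Φ (c t))

    Deg-constant : ∀ {f : K → K} → (∀ t t′ → f t ≡ f t′) → Deg 0 f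
    Deg-constant {f} con = f 0# , λ t → con t 0#

    ∏-constant : ∀ {n} {f : Fin n → K → K} → (∀ j t t′ → f j t ≡ f j t′) → ∀ t t′ → ∏ (λ j → f j t) ≡ ∏ (λ j → f j t′)
    ∏-constant con t t′ = ∏-cong (λ j → con j t t′)

    Deg-∏-single : ∀ {n} d (f : Fin n → K → K) i → Deg d (f i) → (∀ j → j ≢ i → ∀ t t′ → f j t ≡ f j t′) → Deg d (λ t → ∏ (λ j → f j t))
    Deg-∏-single d f zero df con = subst (λ k → Deg k (λ t → ∏ (λ j → f j t))) (ℕₚ.+-identityʳ d)
      (Deg-* d 0 df (Deg-constant (∏-constant {f = f ∘ suc} (λ j → con (suc j) (λ ())))))
    Deg-∏-single d f (suc i) df con =
      Deg-* 0 d (Deg-constant (con zero (λ ()))) (Deg-∏-single d (f ∘ suc) i df (λ j ne → con (suc j) (ne ∘ Finₚ.suc-injective)))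

    SepDeg-* : ∀ {n} d e {Φ Ψ : Point n → K} → SepDeg d Φ → SepDeg e Ψ → SepDeg (d ℕ.+ e) (λ z → Φ z * Ψ z)
    SepDeg-* d e sΦ sΨ i c line = Deg-* d e (sΦ i c line) (sΨ i c line)

    SepDeg-∏ : ∀ {n} d (f : Fin n → K → K) → (∀ i → Deg d (f i)) → SepDeg d (λ z → ∏ (λ i → f i (z i)))
    SepDeg-∏ d f df i c (cᵢ , c≢) = Deg-∏-single d (λ j t → f j (c t j)) i
      (Deg-cong d (λ t → cong (f i) (sym (cᵢ t))) (df i)) (λ j ne t t′ → cong (f j) (c≢ j ne t t′))

    module Grid {d} (ν : Fin (suc d) → K) (ν-inj : Injective _≡_ _≡_ ν) where

      gridPoint : ∀ {n} → Fin (suc d ℕ.^ n) → Point n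
      gridPoint {n} g = ν ∘ finToFun {suc d} {n} g

      basis : ∀ {n} → Fin (suc d ℕ.^ n) → Point n → K
      basis {n} g z = ∏ (λ i → ℓ ν (finToFun {suc d} {n} g i) (z i))

      -- Lagrange interpolation in the first variable, then induction for each value of that
      -- variable; a grid index splits accordingly by `combine`.
      interpolate : ∀ {n} (Φ : Point n → K) → Respects Φ → SepDeg d Φ → ∀ z → Φ z ≡ sum (λ g → basis {n} g z * Φ (gridPoint {n} g))
      interpolate {zero} Φ resp sep z = begin
        Φ z            ≡⟨ resp (λ ()) ⟩
        Φ (gridPoint {0} zero)   ≡⟨ lem _ ⟩
        1# * Φ (gridPoint {0} zero) + 0# ∎
        where
        lem : ∀ x → x ≡ 1# * x + 0#
        lem = solve 1 (λ x → x := :1 :* x :+ :0) refl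
      interpolate {suc n} Φ resp sep z = begin
        Φ z                                          ≡⟨ resp (λ { zero → refl ; (suc i) → refl }) ⟩
        Φ (head z ∷ tail z)                          ≡⟨ lagrange ν ν-inj (sep zero (λ t → t ∷ tail z) ((λ t → refl) , λ { zero ne → contradiction refl ne ; (suc j) ne t t′ → refl })) (head z) ⟩
        sum (λ c → ℓ ν c (head z) * Φ (ν c ∷ tail z)) ≡⟨ sum-cong-≗ {suc d} (λ c → cong (ℓ ν c (head z) *_) (interpolate {n} (λ y → Φ (ν c ∷ y)) (resp-tail c) (sep-tail c) (tail z))) ⟩
        sum (λ c → ℓ ν c (head z) * sum (λ g → basis {n} g (tail z) * Φ (ν c ∷ gridPoint {n} g)))
          ≡⟨ sum-cong-≗ {suc d} (λ c → *-distribˡ-sum (ℓ ν c (head z)) (λ g → basis {n} g (tail z) * Φ (ν c ∷ gridPoint {n} g))) ⟩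
        sum (λ c → sum (λ g → ℓ ν c (head z) * (basis {n} g (tail z) * Φ (ν c ∷ gridPoint {n} g))))
          ≡⟨ sum-cong-≗ {suc d} (λ c → sum-cong-≗ {suc d ℕ.^ n} (λ g → same c g)) ⟩
        sum (λ c → sum (λ g → term (combine {suc d} {suc d ℕ.^ n} c g))) ≡⟨ sum-combine (suc d) {suc d ℕ.^ n} term ⟨
        sum term ∎
        where
        term : Fin (suc d ℕ.^ suc n) → K
        term g = basis {suc n} g z * Φ (gridPoint {suc n} g)
        resp-tail : ∀ c → Respects (λ y → Φ (ν c ∷ y))
        resp-tail c eq = resp (λ { zero → refl ; (suc i) → eq i })
        sep-tail : ∀ c → SepDeg d (λ y → Φ (ν c ∷ y))
        sep-tail c i γ (γᵢ , γ≢) = sep (suc i) (λ t → ν c ∷ γ t)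
          (γᵢ , λ { zero ne t t′ → refl ; (suc j) ne t t′ → γ≢ j (ne ∘ cong suc) t t′ })
        digits : ∀ c g → finToFun {suc d} {suc n} (combine {suc d} {suc d ℕ.^ n} c g) ≗ (c ∷ finToFun {suc d} {n} g)
        digits c g zero = cong proj₁ (Finₚ.remQuot-combine {suc d} {suc d ℕ.^ n} c g)
        digits c g (suc i) = cong (λ r → finToFun {suc d} {n} (proj₂ r) i) (Finₚ.remQuot-combine {suc d} {suc d ℕ.^ n} c g)
        same : ∀ c g → ℓ ν c (head z) * (basis {n} g (tail z) * Φ (ν c ∷ gridPoint {n} g)) ≡ term (combine {suc d} {suc d ℕ.^ n} c g)
        same c g = trans (sym (*-assoc _ _ _)) (cong₂ _*_
          (∏-cong {suc n} {λ i → ℓ ν ((c ∷ finToFun {suc d} {n} g) i) (z i)} (λ i → cong (λ e → ℓ ν e (z i)) (sym (digits c g i))))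
          (resp (λ { zero → cong ν (sym (digits c g zero)) ; (suc i) → cong ν (sym (digits c g (suc i))) })))

      -- The coefficients are the values at the grid points. A uniformly random `c` is thus a
      -- uniformly random polynomial of degree at most d in each variable, and the coefficients of a
      -- given polynomial are read off by evaluation.
      combination : ∀ {n} → (Fin (suc d ℕ.^ n) → K) → Point n → K
      combination {n} c z = sum (λ g → basis {n} g z * c g)

      combination-respects : ∀ {n} c → Respects (combination {n} c)
      combination-respects {n} c eq = sum-cong-≗ {suc d ℕ.^ n} (λ g → cong (_* c g) (∏-cong {n} (λ i → cong (ℓ ν _) (eq i))))

      combination-SepDeg : ∀ {n} c → SepDeg d (combination {n} c)
      combination-SepDeg {n} c i γ line = Deg-sum d _ (λ g → Deg-cong d (λ t → *-comm (c g) _)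
        (Deg-scale d (c g) (SepDeg-∏ d (λ j → ℓ ν (finToFun {suc d} {n} g j)) (λ j → Deg-ℓ ν _) i γ line)))

      combination-+ : ∀ {n} c c′ z → combination {n} (λ g → c g + c′ g) z ≡ combination {n} c z + combination {n} c′ z
      combination-+ {n} c c′ z = trans (sum-cong-≗ {suc d ℕ.^ n} (λ g → distribˡ (basis {n} g z) (c g) (c′ g)))
        (∑-distrib-+ (λ g → basis {n} g z * c g) (λ g → basis {n} g z * c′ g))

    -- Certificate that n + 1 polynomials G_j of degree ≤ D in each of n variables have no common zero.
    -- The nodes κ form n + 1 blocks of D; bump j vanishes at a point having some coordinate in block j. A grid point g has
    -- only n coordinates, so it avoids some block, chosen g, and its Lagrange basis polynomial is multiplier g · bump (chosen g).
    -- Expanding multiplier g · G_(chosen g) in the Lagrange basis gives a square matrix which is the identity when G = bump and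
    -- which annihilates (basis g z)_g at every common zero z.
    module Certificate (n D′ : ℕ) (κ : Fin (suc n ℕ.* suc D′) → K) (κ-inj : Injective _≡_ _≡_ κ) where
      D = suc D′
      -- This is (n + 1) D - 1, in a form for which `suc d` computes to the number of nodes `κ`. It
      -- is also the degree in each variable of a multiplier, n D - 1, plus that of a polynomial of
      -- the system, D.
      d = D′ ℕ.+ n ℕ.* D
      N = suc d ℕ.^ n
      open Grid {d} κ κ-inj

      block : Fin (suc n ℕ.* D) → Fin (suc n)
      block c = proj₁ (remQuot {suc n} D c)

      offset : Fin (suc n ℕ.* D) → Fin D
      offset c = proj₂ (remQuot {suc n} D c)

      combine-block : ∀ c → combine (block c) (offset c) ≡ c
      combine-block c = Finₚ.combine-remQuot {suc n} D c

      -- Among the nodes it vanishes exactly on block j; the factors `1#` give it the shape of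
      -- `Deg-linear`.
      H : Fin (suc n) → K → K
      H j x = ∏ {D} (λ l → (x - κ (combine j l)) * 1#)

      Deg-H : ∀ j → Deg D (H j)
      Deg-H j = subst (λ k → Deg k (H j)) (ℕₚ.*-identityʳ D) (Deg-∏ {D} 1 _ (λ l → Deg-linear (κ (combine j l)) 1#))

      H-same : ∀ j c → block c ≡ j → H j (κ c) ≡ 0#
      H-same j c refl = ∏-zero {D} (λ l → (κ c - κ (combine (block c) l)) * 1#) (offset c)
        (trans (cong (λ e → (κ c - κ e) * 1#) (combine-block c)) (lem (κ c)))
        where
        lem : ∀ x → (x - x) * 1# ≡ 0#
        lem = solve 1 (λ x → (x :- x) :* :1 := :0) refl

      H-diff : ∀ j c → block c ≢ j → H j (κ c) ≢ 0#
      H-diff j c ne = ∏-≢0 {D} _ (λ l → *-≢0 _ _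
        (λ eq → ne (trans (cong block (κ-inj {c} {combine j l} (x-y≡0⇒x≡y _ _ eq))) (cong proj₁ (Finₚ.remQuot-combine j l)))) 1≢0)

      reducedNode : Fin (suc n) → Fin (n ℕ.* D) → K
      reducedNode j r = κ (combine (punchIn j (proj₁ (remQuot {n} D r))) (proj₂ (remQuot {n} D r)))

      reduced : ∀ j c → block c ≢ j → Fin (n ℕ.* D)
      reduced j c ne = combine (punchOut (ne ∘ sym)) (offset c)

      reducedNode-reduced : ∀ j c (ne : block c ≢ j) → reducedNode j (reduced j c ne) ≡ κ c
      reducedNode-reduced j c ne = cong κ (trans
        (cong (λ r → combine (punchIn j (proj₁ r)) (proj₂ r)) (Finₚ.remQuot-combine (punchOut (ne ∘ sym)) (offset c)))
        (trans (cong (λ b → combine b (offset c)) (Finₚ.punchIn-punchOut (ne ∘ sym))) (combine-block c)))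

      reducedNode-injective : ∀ j → Injective _≡_ _≡_ (reducedNode j)
      reducedNode-injective j {r} {s} eq = trans (sym (Finₚ.combine-remQuot {n} D r))
        (trans (cong₂ combine (Finₚ.punchIn-injective j _ _ (proj₁ both)) (proj₂ both)) (Finₚ.combine-remQuot {n} D s))
        where
        both = Finₚ.combine-injective {suc n} {D} _ _ _ _ (κ-inj eq)

      -- `ℓ` for a number of nodes, here n D, that is not visibly a successor; for k = 0 there is no
      -- index to define it at.
      α′ : ∀ {k} (ν : Fin k → K) → Fin k → K → K
      α′ {suc k} ν = ℓ ν

      Deg-α′ : ∀ {k} (ν : Fin k → K) r → Deg (k ℕ.∸ 1) (α′ ν r)
      Deg-α′ {suc k} ν r = Deg-ℓ ν r

      α′-same : ∀ {k} (ν : Fin k → K) → Injective _≡_ _≡_ ν → ∀ r → α′ ν r (ν r) ≡ 1#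
      α′-same {suc k} = ℓ-same

      α′-diff : ∀ {k} (ν : Fin k → K) r s → s ≢ r → α′ ν r (ν s) ≡ 0#
      α′-diff {suc k} = ℓ-diff

      -- The cofactor of `H j` in the Lagrange basis polynomial of node c over all nodes: on block j
      -- the factor `H j` vanishes, and on the other nodes a Lagrange polynomial for those n D nodes
      -- does the work, rescaled by the value of `H j` at node c.
      α : ∀ j c → block c ≢ j → K → K
      α j c ne x = inv (H j (κ c)) * α′ (reducedNode j) (reduced j c ne) x

      Deg-α : ∀ j c ne → Deg (n ℕ.* D ℕ.∸ 1) (α j c ne)
      Deg-α j c ne = Deg-scale _ _ (Deg-α′ (reducedNode j) (reduced j c ne))

      α-same : ∀ j c ne → α j c ne (κ c) * H j (κ c) ≡ 1#
      α-same j c ne = begin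
        (inv h * α′ (reducedNode j) r (κ c)) * h ≡⟨ cong (λ x → (inv h * α′ (reducedNode j) r x) * h) (reducedNode-reduced j c ne) ⟨
        (inv h * α′ (reducedNode j) r (reducedNode j r)) * h ≡⟨ cong (λ x → (inv h * x) * h) (α′-same (reducedNode j) (reducedNode-injective j) r) ⟩
        (inv h * 1#) * h ≡⟨ lem h (inv h) ⟩
        h * inv h ≡⟨ inverseʳ h (H-diff j c ne) ⟩
        1# ∎
        where
        h = H j (κ c)
        r = reduced j c ne
        lem : ∀ x y → (y * 1#) * x ≡ x * y
        lem = solve 2 (λ x y → (y :* :1) :* x := x :* y) refl

      α-diff : ∀ j c ne c′ → c′ ≢ c → α j c ne (κ c′) * H j (κ c′) ≡ 0#
      α-diff j c ne c′ c′≢c with block c′ Fin.≟ j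
      ... | yes eq = trans (cong (α j c ne (κ c′) *_) (H-same j c′ eq)) (zeroʳ _)
      ... | no ne′ = trans (cong (_* H j (κ c′)) (trans (cong (inv (H j (κ c)) *_) (trans
          (cong (α′ (reducedNode j) (reduced j c ne)) (sym (reducedNode-reduced j c′ ne′)))
          (α′-diff (reducedNode j) _ _ different))) (zeroʳ _))) (zeroˡ _)
        where
        different : reduced j c′ ne′ ≢ reduced j c ne
        different eq = c′≢c (κ-inj (trans (sym (reducedNode-reduced j c′ ne′)) (trans (cong (reducedNode j) eq) (reducedNode-reduced j c ne))))

      digit : Fin N → Fin n → Fin (suc n ℕ.* D)
      digit = finToFun {suc d} {n}

      freeBlock : ∀ g → ∃ λ j → ∀ i → block (digit g i) ≢ j
      freeBlock g = missed-value (block ∘ digit g)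

      chosen : Fin N → Fin (suc n)
      chosen g = proj₁ (freeBlock g)

      multiplier : Fin N → Point n → K
      multiplier g y = ∏ (λ i → α (chosen g) (digit g i) (proj₂ (freeBlock g) i) (y i))

      bump : Fin (suc n) → Point n → K
      bump j y = ∏ (λ i → H j (y i))

      bump-respects : ∀ j → Respects (bump j)
      bump-respects j eq = ∏-cong {n} (λ i → cong (H j) (eq i))

      bump-SepDeg : ∀ j → SepDeg D (bump j)
      bump-SepDeg j = SepDeg-∏ D (λ _ → H j) (λ _ → Deg-H j)

      multiplier-bump : ∀ g g′ → multiplier g (gridPoint {n} g′) * bump (chosen g) (gridPoint {n} g′) ≡ δ g g′
      multiplier-bump g g′ = trans (sym (∏-* {n} _ _)) (by-cases (g Fin.≟ g′))
        where
        factor : Fin n → K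
        factor i = α (chosen g) (digit g i) (proj₂ (freeBlock g) i) (κ (digit g′ i)) * H (chosen g) (κ (digit g′ i))
        by-cases : Dec (g ≡ g′) → ∏ factor ≡ δ g g′
        by-cases (yes refl) = trans (∏-one factor (λ i → α-same (chosen g) (digit g i) (proj₂ (freeBlock g) i))) (sym (δ-same g))
        by-cases (no ne) = let i , differ = ≢⇒differ {n} {suc d} ne in
          trans (∏-zero factor i (α-diff (chosen g) (digit g i) (proj₂ (freeBlock g) i) (digit g′ i) (differ ∘ sym))) (sym (δ-diff ne))

      System : Set
      System = Fin (suc n) → K → Point n → K

      record Regular (G : System) : Set where
        field
          respects : ∀ j t → Respects (G j t)
          degree-y : ∀ j t → SepDeg D (G j t)
          degree-t : ∀ j y → Deg D (λ t → G j t y)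

      matrix : System → K → Matrix N
      matrix G t g g′ = multiplier g (gridPoint {n} g′) * G (chosen g) t (gridPoint {n} g′)

      Deg-matrix : ∀ {G} → Regular G → ∀ g g′ → Deg D (λ t → matrix G t g g′)
      Deg-matrix reg g g′ = Deg-scale D _ (Regular.degree-t reg (chosen g) (gridPoint {n} g′))

      -- Interpolation of the constant 1; it supplies the normalisation of the kernel vectors.
      basis-sum : ∀ z → sum (λ g → basis {n} g z) ≡ 1#
      basis-sum z = sym (trans (interpolate {n} (λ _ → 1#) (λ _ → refl) (λ i c line → Deg-const d 1#) z)
        (sum-cong-≗ {N} (λ g → trans (*-comm _ _) (*-identityˡ _))))

      basis-kernel : ∀ {G} → Regular G → ∀ t z → (∀ j → G j t z ≡ 0#) → ∀ g → sum (λ g′ → matrix G t g g′ * basis {n} g′ z) ≡ 0#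
      basis-kernel {G} reg t z root g = begin
        sum (λ g′ → matrix G t g g′ * basis {n} g′ z) ≡⟨ sum-cong-≗ {N} (λ g′ → *-comm (matrix G t g g′) (basis {n} g′ z)) ⟩
        sum (λ g′ → basis {n} g′ z * Φ (gridPoint {n} g′)) ≡⟨ interpolate {n} Φ Φ-resp Φ-sep z ⟨
        Φ z ≡⟨ cong (multiplier g z *_) (root (chosen g)) ⟩
        multiplier g z * 0# ≡⟨ zeroʳ _ ⟩
        0# ∎
        where
        Φ : Point n → K
        Φ y = multiplier g y * G (chosen g) t y
        Φ-resp : Respects Φ
        Φ-resp eq = cong₂ _*_ (∏-cong {n} (λ i → cong (α (chosen g) (digit g i) (proj₂ (freeBlock g) i)) (eq i))) (Regular.respects reg (chosen g) t eq)
        -- The truncated subtraction is exact only for m ≥ 1, which the direction `i : Fin n` of a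
        -- line guarantees.
        degrees : ∀ m → Fin m → m ℕ.* D ℕ.∸ 1 ℕ.+ D ≡ D′ ℕ.+ m ℕ.* D
        degrees (suc m) _ = trans (ℕₚ.+-suc (D′ ℕ.+ m ℕ.* D) D′) (trans (cong suc (ℕₚ.+-comm (D′ ℕ.+ m ℕ.* D) D′)) (sym (ℕₚ.+-suc D′ (D′ ℕ.+ m ℕ.* D))))
        Φ-sep : SepDeg d Φ
        Φ-sep i c line = subst (λ k → Deg k (λ t → Φ (c t))) (degrees n i)
          (SepDeg-* (n ℕ.* D ℕ.∸ 1) D {multiplier g} {G (chosen g) t} (SepDeg-∏ (n ℕ.* D ℕ.∸ 1) _ (λ i → Deg-α (chosen g) (digit g i) (proj₂ (freeBlock g) i))) (Regular.degree-y reg (chosen g) t) i c line)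

      matrix-perturb : ∀ {G G′ t μ} → (∀ j y → G′ j t y ≡ G j t y + μ * bump j y) → ∀ g g′ → matrix G′ t g g′ ≡ matrix G t g g′ + μ * δ g g′
      matrix-perturb {G} {G′} {t} {μ} eq g g′ = begin
        m * G′ (chosen g) t y                      ≡⟨ cong (m *_) (eq (chosen g) y) ⟩
        m * (G (chosen g) t y + μ * bump (chosen g) y) ≡⟨ lem m (G (chosen g) t y) μ (bump (chosen g) y) ⟩
        m * G (chosen g) t y + μ * (m * bump (chosen g) y) ≡⟨ cong (λ e → m * G (chosen g) t y + μ * e) (multiplier-bump g g′) ⟩
        m * G (chosen g) t y + μ * δ g g′ ∎
        where
        y = gridPoint {n} g′
        m = multiplier g y
        lem : ∀ m a u b → m * (a + u * b) ≡ m * a + u * (m * b)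
        lem = solve 4 (λ m a u b → m :* (a :+ u :* b) := m :* a :+ u :* (m :* b)) refl

-- Configurations to be avoided and the perturbations that make them rare

module Events where
  open Polynomials
  open PolynomialMatrices
  open Certificates
  open import Data.Nat as ℕ using (ℕ; zero; suc)
  import Data.Nat.Properties as ℕₚ
  open import Data.Fin as Fin using (Fin; zero; suc; combine; remQuot; punchIn; punchOut; finToFun; funToFin)
  import Data.Fin.Properties as Finₚ
  open import Data.Vec.Functional using (_∷_; insertAt)
  import Data.Vec.Functional.Properties as VFₚ
  open import Data.Product using (∃; _×_; _,_; proj₁; proj₂; uncurry)
  open import Data.Empty using (⊥)
  open import Function using (_∘_)
  open import Function.Definitions using (Injective)
  open import Relation.Nullary using (¬_; Dec; yes; no; contradiction; _×-dec_; map′)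
  open import Relation.Binary.PropositionalEquality

  data PunchView {n} (i : Fin (suc n)) : Fin (suc n) → Set where
    here : PunchView i i
    there : ∀ l → PunchView i (punchIn i l)

  punchView : ∀ {n} (i j : Fin (suc n)) → PunchView i j
  punchView i j with i Fin.≟ j
  ... | yes refl = here
  ... | no ne = subst (PunchView i) (Finₚ.punchIn-punchOut ne) (there (punchOut ne))

  module EventTheory {q : ℕ} (F : FieldOn (Fin q)) where
    K = Fin q
    open FieldTheory F
    open PencilTheory F
    open TensorTheory F
    open ≡-Reasoning

    leftSingular? : ∀ {N} (A : Matrix N) → Dec (LeftSingular A)
    leftSingular? {N} A = map′ (λ (k , sing) → finToFun k , sing) (λ (w , (g , nz) , ker) →
        funToFin w , (g , λ eq → nz (trans (sym (Finₚ.finToFun-funToFin w g)) eq)) ,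
        λ g′ → trans (sum-cong-≗ {N} (λ h → cong (_* A h g′) (Finₚ.finToFun-funToFin w h))) (ker g′))
      (Finₚ.any? (λ k → allZero? (finToFun {q} {N} k) ×-dec Finₚ.all? (λ g′ → sum (λ g → finToFun {q} {N} k g * A g g′) ≟K 0#)))

    Line-insertAt : ∀ {n} (y : Point n) i → Line i (insertAt y i)
    Line-insertAt y i = (λ t → VFₚ.insertAt-lookup y i t) , λ j ne t t′ → const-at j ne t t′ (punchView i j)
      where
      const-at : ∀ j → j ≢ i → ∀ t t′ → PunchView i j → insertAt y i t j ≡ insertAt y i t′ j
      const-at .i ne t t′ here = contradiction refl ne
      const-at .(punchIn i l) ne t t′ (there l) = trans (VFₚ.insertAt-punchIn y i t l) (sym (VFₚ.insertAt-punchIn y i t′ l))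

    Line-insertAt-punchIn : ∀ {n} (γ : K → Point n) l → Line l γ → ∀ i t₀ → Line (punchIn i l) (λ t → insertAt (γ t) i t₀)
    Line-insertAt-punchIn γ l (γₗ , γ≢) i t₀ =
      (λ t → trans (VFₚ.insertAt-punchIn (γ t) i t₀ l) (γₗ t)) , λ j ne t t′ → const-at j ne t t′ (punchView i j)
      where
      const-at : ∀ j → j ≢ punchIn i l → ∀ t t′ → PunchView i j → insertAt (γ t) i t₀ j ≡ insertAt (γ t′) i t₀ j
      const-at .i ne t t′ here = trans (VFₚ.insertAt-lookup (γ t) i t₀) (sym (VFₚ.insertAt-lookup (γ t′) i t₀))
      const-at .(punchIn i l′) ne t t′ (there l′) = trans (VFₚ.insertAt-punchIn (γ t) i t₀ l′)
        (trans (γ≢ l′ (ne ∘ cong (punchIn i)) t t′) (sym (VFₚ.insertAt-punchIn (γ t′) i t₀ l′)))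

    insertAt-cong : ∀ {n} {y y′ : Point n} i t → y ≗ y′ → insertAt y i t ≗ insertAt y′ i t
    insertAt-cong {y = y} {y′} i t eq j with punchView i j
    ... | here = trans (VFₚ.insertAt-lookup y i t) (sym (VFₚ.insertAt-lookup y′ i t))
    ... | there l = trans (VFₚ.insertAt-punchIn y i t l) (trans (eq l) (sym (VFₚ.insertAt-punchIn y′ i t l)))

    -- A point assigns to each of v blocks an element of K^(1+S): block b holds (1 , y) if it is occupied by the label y ∈ K^S.
    module Places (v n : ℕ) where
      S = suc n
      m = v ℕ.* suc S

      BlockPoint : Set
      BlockPoint = Fin v → Point (suc S)

      flat : BlockPoint → Point m
      flat z r = uncurry z (remQuot {v} (suc S) r)

      flat-combine : ∀ z b i → flat z (combine b i) ≡ z b i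
      flat-combine z b i = cong (uncurry z) (Finₚ.remQuot-combine {v} b i)

      combine-remQuot′ : ∀ (r : Fin m) → combine {v} (proj₁ (remQuot {v} (suc S) r)) (proj₂ (remQuot {v} (suc S) r)) ≡ r
      combine-remQuot′ = Finₚ.combine-remQuot {v} (suc S)

      place : Fin v → Point S → BlockPoint → BlockPoint
      place b y a b′ with b′ Fin.≟ b
      ... | yes _ = 1# ∷ y
      ... | no _ = a b′

      place-same : ∀ b y a i → place b y a b i ≡ (1# ∷ y) i
      place-same b y a i with b Fin.≟ b
      ... | yes _ = refl
      ... | no ne = contradiction refl ne

      place-diff : ∀ b y a b′ → b′ ≢ b → ∀ i → place b y a b′ i ≡ a b′ i
      place-diff b y a b′ ne i with b′ Fin.≟ b
      ... | yes eq = contradiction eq ne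
      ... | no _ = refl

      place-cong : ∀ b {y y′} a → y ≗ y′ → ∀ b′ i → place b y a b′ i ≡ place b y′ a b′ i
      place-cong b a eq b′ i with b′ Fin.≟ b
      place-cong b a eq b′ zero | yes _ = refl
      place-cong b a eq b′ (suc i) | yes _ = eq i
      ... | no _ = refl

      Line-place : ∀ b a i (y : K → Point S) → Line i y → Line (combine {v} b (suc i)) (λ t → flat (place b (y t) a))
      Line-place b a i y (yᵢ , y≢) =
        (λ t → trans (flat-combine (place b (y t) a) b (suc i)) (trans (place-same b (y t) a (suc i)) (yᵢ t))) ,
        λ r ne t t′ → const-at _ (λ eq → ne (trans (sym (combine-remQuot′ r)) eq)) t t′
        where
        const-at : ∀ p → combine {v} (proj₁ p) (proj₂ p) ≢ combine {v} b (suc i) → ∀ t t′ →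
          uncurry (place b (y t) a) p ≡ uncurry (place b (y t′) a) p
        const-at (b′ , x) ne t t′ with b′ Fin.≟ b
        const-at (b′ , zero) ne t t′ | yes _ = refl
        const-at (b′ , suc j) ne t t′ | yes refl = y≢ j (λ eq → ne (cong (combine {v} b ∘ suc) eq)) t t′
        ... | no _ = refl

      -- The nodes `κ` serve the certificate; the nodes `η` serve both as the grid that parametrises
      -- P and as the places t where singularity is tested. The condition n ≤ D leaves room for the
      -- n linear factors of a `separator`.
      module Family (D′ : ℕ) (n≤D : n ℕ.≤ suc D′)
        (κ : Fin (suc n ℕ.* suc D′) → K) (κ-inj : Injective _≡_ _≡_ κ)
        (η : Fin (suc (suc D′)) → K) (η-inj : Injective _≡_ _≡_ η) where
        D = suc D′
        open Certificate n D′ κ κ-inj using (N; System; Regular; matrix; Deg-matrix; bump; bump-respects; bump-SepDeg; matrix-perturb; basis-sum; basis-kernel)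
        module C = Certificate n D′ κ κ-inj
        open Grid {D} η η-inj using (combination; combination-respects; combination-SepDeg; combination-+; interpolate; gridPoint)

        Coefficients : Set
        Coefficients = Fin (suc D ℕ.^ m) → K

        P : Coefficients → BlockPoint → K
        P c z = combination {m} c (flat z)

        P-respects : ∀ c {z z′ : BlockPoint} → (∀ b i → z b i ≡ z′ b i) → P c z ≡ P c z′
        P-respects c eq = combination-respects {m} c (λ r → eq (proj₁ (remQuot {v} (suc S) r)) (proj₂ (remQuot {v} (suc S) r)))

        -- `b` is the block of the large part, `i` the coordinate in which its labels take many
        -- values, `a j` the point given by the j-th choice of vertices from the other parts, and
        -- `ω j` the value demanded of P there.
        record Event : Set where
          field
            b : Fin v
            i : Fin S
            a : Fin S → BlockPoint
            ω : Fin S → K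

        module _ (ev : Event) where
          open Event ev

          system : Coefficients → System
          system c j t y = P c (place b (insertAt y i t) (a j)) - ω j

          system-regular : ∀ c → Regular (system c)
          system-regular c = record
            { respects = λ j t eq → cong (_- ω j) (P-respects c (place-cong b (a j) (insertAt-cong i t eq)))
            ; degree-y = λ j t l γ line → Deg-sub D (combination-SepDeg {m} c (combine {v} b (suc (punchIn i l))) _
                (Line-place b (a j) (punchIn i l) _ (Line-insertAt-punchIn γ l line i t))) (Deg-const D (ω j))
            ; degree-t = λ j y → Deg-sub D (combination-SepDeg {m} c (combine {v} b (suc i)) _
                (Line-place b (a j) i _ (Line-insertAt y i))) (Deg-const D (ω j)) }

          eventMatrix : Coefficients → K → Matrix N
          eventMatrix c = matrix (system c)

          -- The places t = η l react independently to the directions below, so badness is an intersection of D + 1 rare events.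
          Bad : Coefficients → Set
          Bad c = ∀ l → LeftSingular (eventMatrix c (η l))

          bad? : ∀ c → Dec (Bad c)
          bad? c = Finₚ.all? (λ l → leftSingular? (eventMatrix c (η l)))

          -- The difference has to lie outside block b because `place` overwrites that block.
          Separated : Set
          Separated = ∀ j j′ → j ≢ j′ → ∃ λ b′ → ∃ λ i′ → b′ ≢ b × a j b′ i′ ≢ a j′ b′ i′

          -- A single polynomial equal to bump j (y) · blend t at the j-th point of the event, for all j simultaneously;
          -- adding it shifts the matrix at t = η l by the scalar μ l.
          module Direction (separated : Separated) (μ : Fin (suc D) → K) where

            sepBlock : ∀ j j′ → Fin v
            sepBlock j j′ = proj₁ (separated j (punchIn j j′) (λ eq → Finₚ.punchInᵢ≢i j j′ (sym eq)))

            sepBlock≢ : ∀ j j′ → sepBlock j j′ ≢ b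
            sepBlock≢ j j′ = proj₁ (proj₂ (proj₂ (separated j (punchIn j j′) (λ eq → Finₚ.punchInᵢ≢i j j′ (sym eq)))))

            sepIndex : ∀ j j′ → Fin (suc S)
            sepIndex j j′ = proj₁ (proj₂ (separated j (punchIn j j′) (λ eq → Finₚ.punchInᵢ≢i j j′ (sym eq))))

            sep≢ : ∀ j j′ → a j (sepBlock j j′) (sepIndex j j′) ≢ a (punchIn j j′) (sepBlock j j′) (sepIndex j j′)
            sep≢ j j′ = proj₂ (proj₂ (proj₂ (separated j (punchIn j j′) (λ eq → Finₚ.punchInᵢ≢i j j′ (sym eq)))))

            own other scale : ∀ j (j′ : Fin n) → K
            own j j′ = a j (sepBlock j j′) (sepIndex j j′)
            other j j′ = a (punchIn j j′) (sepBlock j j′) (sepIndex j j′)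
            scale j j′ = inv (own j j′ - other j j′)

            coordinate : ∀ j (j′ : Fin n) → Fin m
            coordinate j j′ = combine {v} (sepBlock j j′) (sepIndex j j′)

            -- One linear factor for each other point, in a coordinate where it differs from point
            -- j, normalised to be 1 at point j and 0 at the other point.
            separator : Fin S → Point m → K
            separator j z = ∏ (λ j′ → (z (coordinate j j′) - other j j′) * scale j j′)

            -- Degree D in t leaves exactly the D + 1 values at the `η l` free, so the shifts `μ l`
            -- can be prescribed independently.
            blend : K → K
            blend t = sum (λ l → ℓ η l t * μ l)

            Deg-blend : Deg D blend
            Deg-blend = Deg-sum D _ (λ l → Deg-cong D (λ t → *-comm (μ l) _) (Deg-scale D (μ l) (Deg-ℓ η l)))

            blend-η : ∀ l → blend (η l) ≡ μ l
            blend-η l = trans (sum-single _ l (λ k ne → trans (cong (_* μ k) (ℓ-diff η k l (ne ∘ sym))) (zeroˡ _)))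
              (trans (cong (_* μ l) (ℓ-same η η-inj l)) (*-identityˡ _))

            inner : Fin S → Point S → K
            inner j y = bump j (y ∘ punchIn i) * blend (y i)

            inner-respects : ∀ j → Respects (inner j)
            inner-respects j eq = cong₂ _*_ (bump-respects j (λ l → eq (punchIn i l))) (cong blend (eq i))

            inner-SepDeg : ∀ j → SepDeg D (inner j)
            inner-SepDeg j i′ γ (γᵢ , γ≢) with punchView i i′
            ... | here = Deg-* 0 D
                  (Deg-constant (λ t t′ → bump-respects j (λ l → γ≢ (punchIn i l) (Finₚ.punchInᵢ≢i i l) t t′)))
                  (Deg-cong D (λ t → cong blend (sym (γᵢ t))) Deg-blend)
            ... | there l = subst (λ k → Deg k (λ t → inner j (γ t))) (ℕₚ.+-identityʳ D) (Deg-* D 0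
                  (bump-SepDeg j l (λ t → γ t ∘ punchIn i) (γᵢ , λ l′ ne t t′ → γ≢ (punchIn i l′) (ne ∘ Finₚ.punchIn-injective i l′ l) t t′))
                  (Deg-constant (λ t t′ → cong blend (γ≢ i (λ eq → Finₚ.punchInᵢ≢i i l (sym eq)) t t′))))

            slot : Point m → Point S
            slot z x = z (combine {v} b (suc x))

            U : Point m → K
            U z = sum (λ j → separator j z * inner j (slot z))

            U-respects : Respects U
            U-respects eq = sum-cong-≗ {S} (λ j → cong₂ _*_
              (∏-cong {n} (λ j′ → cong (λ x → (x - other j j′) * scale j j′) (eq (coordinate j j′))))
              (inner-respects j (λ x → eq (combine {v} b (suc x)))))

            -- The two factors share no variable: in block b only `inner` varies, with degree D, and
            -- elsewhere only `separator`, with degree at most n ≤ D.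
            U-SepDeg : SepDeg D U
            U-SepDeg r γ (γᵣ , γ≢) = Deg-sum D _ (λ j → summand j (b Fin.≟ rᵇ))
              where
              rᵇ = proj₁ (remQuot {v} (suc S) r)
              rⁱ = proj₂ (remQuot {v} (suc S) r)
              away : ∀ {b′ i′} → b′ ≢ rᵇ → ∀ t t′ → γ t (combine {v} b′ i′) ≡ γ t′ (combine {v} b′ i′)
              away {b′} {i′} ne = γ≢ (combine {v} b′ i′) (λ eq → ne (cong proj₁ (trans (sym (Finₚ.remQuot-combine {v} b′ i′)) (cong (remQuot {v} (suc S)) eq))))
              slot-line : ∀ j → b ≡ rᵇ → ∀ x → x ≡ rⁱ → Deg D (λ t → inner j (slot (γ t)))
              -- Coordinate 0 of block b, the mark of an occupied block, is not read by `slot`.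
              slot-line j eq zero eq′ = Deg-mono {0} {D} ℕ.z≤n (Deg-constant (λ t t′ → inner-respects j (λ x →
                γ≢ _ (λ at-r → contradiction (trans (sym (cong proj₂ (Finₚ.remQuot-combine {v} b (suc x)))) (trans (cong (proj₂ ∘ remQuot {v} (suc S)) at-r) (sym eq′))) λ ()) t t′)))
              slot-line j eq (suc x) eq′ = inner-SepDeg j x (slot ∘ γ)
                ((λ t → trans (cong (γ t) at-r) (γᵣ t)) ,
                 λ x′ ne t t′ → γ≢ _ (λ at-r′ → ne (Finₚ.suc-injective (proj₂ (Finₚ.combine-injective {v} {suc S} b (suc x′) b (suc x) (trans at-r′ (sym at-r)))))) t t′)
                where
                at-r : combine {v} b (suc x) ≡ r
                at-r = trans (cong₂ (combine {v}) eq eq′) (combine-remQuot′ r)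
              factor : ∀ j j′ → Deg 1 (λ t → (γ t (coordinate j j′) - other j j′) * scale j j′)
              factor j j′ with coordinate j j′ Fin.≟ r
              ... | yes eq = Deg-cong 1 (λ t → cong (λ x → (x - other j j′) * scale j j′) (sym (trans (cong (γ t) eq) (γᵣ t)))) (Deg-linear (other j j′) (scale j j′))
              ... | no ne = Deg-mono {0} {1} ℕ.z≤n (Deg-constant (λ t t′ → cong (λ x → (x - other j j′) * scale j j′) (γ≢ _ ne t t′)))
              summand : ∀ j → Dec (b ≡ rᵇ) → Deg D (λ t → separator j (γ t) * inner j (slot (γ t)))
              summand j (yes eq) = Deg-* 0 D
                (Deg-constant (λ t t′ → ∏-cong {n} (λ j′ → cong (λ x → (x - other j j′) * scale j j′) (away (λ eq′ → sepBlock≢ j j′ (trans eq′ (sym eq))) t t′))))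
                (slot-line j eq rⁱ refl)
              summand j (no ne) = subst (λ k → Deg k (λ t → separator j (γ t) * inner j (slot (γ t)))) (ℕₚ.+-identityʳ D) (Deg-* D 0
                (Deg-mono n≤D (subst (λ k → Deg k (λ t → separator j (γ t))) (ℕₚ.*-identityʳ n) (Deg-∏ {n} 1 _ (factor j))))
                (Deg-constant (λ t t′ → inner-respects j (λ x → away {b} {suc x} ne t t′))))

            direction : Coefficients
            direction g = U (gridPoint {m} g)

            separator-same : ∀ j y → separator j (flat (place b y (a j))) ≡ 1#
            separator-same j y = ∏-one _ (λ j′ → trans
              (cong (λ x → (x - other j j′) * scale j j′) (trans (flat-combine (place b y (a j)) (sepBlock j j′) (sepIndex j j′)) (place-diff b y (a j) _ (sepBlock≢ j j′) (sepIndex j j′))))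
              (inverseʳ _ (sep≢ j j′ ∘ x-y≡0⇒x≡y _ _)))

            separator-diff : ∀ j k y → k ≢ j → separator j (flat (place b y (a k))) ≡ 0#
            separator-diff j k y ne with punchView j k
            ... | here = contradiction refl ne
            ... | there j′ = ∏-zero _ j′ (trans
              (cong (λ x → (x - other j j′) * scale j j′) (trans (flat-combine (place b y (a (punchIn j j′))) (sepBlock j j′) (sepIndex j j′)) (place-diff b y (a (punchIn j j′)) _ (sepBlock≢ j j′) (sepIndex j j′))))
              (lem (other j j′) (scale j j′)))
              where
              lem : ∀ x y → (x - x) * y ≡ 0#
              lem = solve 2 (λ x y → (x :- x) :* y := :0) refl

            P-direction : ∀ j t y → P direction (place b (insertAt y i t) (a j)) ≡ bump j y * blend t
            P-direction j t y = begin
              P direction (place b y⁺ (a j))        ≡⟨ interpolate {m} U U-respects U-SepDeg z ⟨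
              U z                                   ≡⟨ sum-single _ j (λ k ne → trans (cong (_* inner k (slot z)) (separator-diff k j y⁺ (ne ∘ sym))) (zeroˡ _)) ⟩
              separator j z * inner j (slot z)      ≡⟨ cong (_* inner j (slot z)) (separator-same j y⁺) ⟩
              1# * inner j (slot z)                 ≡⟨ *-identityˡ _ ⟩
              inner j (slot z)                      ≡⟨ inner-respects j (λ x → trans (flat-combine (place b y⁺ (a j)) b (suc x)) (place-same b y⁺ (a j) (suc x))) ⟩
              inner j y⁺                            ≡⟨ cong₂ _*_ (bump-respects j (VFₚ.insertAt-punchIn y i t)) (cong blend (VFₚ.insertAt-lookup y i t)) ⟩
              bump j y * blend t                    ∎
              where
              y⁺ = insertAt y i t
              z = flat (place b y⁺ (a j))

          perturbed : Separated → Coefficients → (Fin (suc D) → K) → Coefficients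
          perturbed separated c μ g = c g + Direction.direction separated μ g

          perturbed-matrix : ∀ separated c μ l g g′ →
            eventMatrix (perturbed separated c μ) (η l) g g′ ≡ eventMatrix c (η l) g g′ + μ l * δ g g′
          perturbed-matrix separated c μ l = matrix-perturb {system c} {system (perturbed separated c μ)} {η l} {μ l} (λ j y → begin
            P (perturbed separated c μ) (z j y) - ω j     ≡⟨ cong (_- ω j) (combination-+ {m} c direction (flat (z j y))) ⟩
            (P c (z j y) + P direction (z j y)) - ω j     ≡⟨ cong (λ x → (P c (z j y) + x) - ω j) (P-direction j (η l) y) ⟩
            (P c (z j y) + bump j y * blend (η l)) - ω j  ≡⟨ cong (λ x → (P c (z j y) + bump j y * x) - ω j) (blend-η l) ⟩
            (P c (z j y) + bump j y * μ l) - ω j          ≡⟨ lem (P c (z j y)) (bump j y) (μ l) (ω j) ⟩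
            (P c (z j y) - ω j) + μ l * bump j y          ∎)
            where
            open Direction separated μ
            z : Fin S → Point n → BlockPoint
            z j y = place b (insertAt y i (η l)) (a j)
            lem : ∀ p b u w → (p + b * u) - w ≡ (p - w) + u * b
            lem = solve 4 (λ p b u w → (p :+ b :* u) :- w := (p :- w) :+ u :* b) refl

          -- Failing to be bad yields one place `η l` where the matrix is regular. Each solution
          -- gives a kernel vector of coordinate sum 1, the grid basis evaluated at its other n
          -- coordinates, at the place t given by its i-th coordinate; T distinct places are too
          -- many.
          few-solutions : ∀ c → ¬ Bad c → let T = suc (N ℕ.* suc D ℕ.+ D) in
            (∀ l → ∃ λ (ρ : Fin T → K) → Injective _≡_ _≡_ ρ × (∀ k → ρ k ≢ η l)) →
            (y : Fin T → Point S) → Injective _≡_ _≡_ (λ k → y k i) →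
            (∀ k j → P c (place b (y k) (a j)) ≡ ω j) → ⊥
          -- The first argument is some element of `Fin N`, here the code of the constant function
          -- 0.
          few-solutions c ¬bad avoid y inj sol = few-kernel-vectors⁺ {N} {D} (funToFin {n} {suc C.d} (λ _ → zero)) (eventMatrix c)
            (Deg-matrix (system-regular c)) (η l) regular ρ ρ-inj ρ≢ (λ k → y k i) inj
            (λ k g → Grid.basis κ κ-inj {n} g (rest k)) (λ k → basis-sum (rest k))
            (λ k → basis-kernel (system-regular c) (y k i) (rest k) (root k))
            where
            regularPlace = Finₚ.¬∀⟶∃¬ _ (λ l → LeftSingular (eventMatrix c (η l))) (λ l → leftSingular? (eventMatrix c (η l))) ¬bad
            l = proj₁ regularPlace
            regular = proj₂ regularPlace
            ρ = proj₁ (avoid l)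
            ρ-inj = proj₁ (proj₂ (avoid l))
            ρ≢ = proj₂ (proj₂ (avoid l))
            rest : ∀ k → Point n
            rest k = y k ∘ punchIn i
            reassemble : ∀ k → insertAt (rest k) i (y k i) ≗ y k
            reassemble k x with punchView i x
            ... | here = VFₚ.insertAt-lookup (rest k) i (y k i)
            ... | there l′ = VFₚ.insertAt-punchIn (rest k) i (y k i) l′
            root : ∀ k j → system c j (y k i) (rest k) ≡ 0#
            root k j = trans (cong (_- ω j) (trans (P-respects c (place-cong b (a j) (reassemble k))) (sol k j))) (-‿inverseʳ (ω j))

          Bad-cong : ∀ {c c′} → c ≗ c′ → Bad c → Bad c′
          Bad-cong {c} {c′} eq bad l = let w , nz , ker = bad l in
            w , nz , λ g′ → trans (sum-cong-≗ {N} (λ g → cong (λ x → w g * (C.multiplier g (Grid.gridPoint κ κ-inj {n} g′) * x))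
              (cong (_- ω (C.chosen g)) (sum-cong-≗ {suc D ℕ.^ m} (λ h → cong (Grid.basis η η-inj {m} h _ *_) (sym (eq h))))))) (ker g′)

          -- At the single place `η l` the shifts act as N + 1 distinct scalar shifts of one N × N
          -- matrix.
          few-bad-shifts : ∀ separated c l (μ : Fin (suc N) → Fin (suc D) → K) → Injective _≡_ _≡_ (λ k → μ k l) →
            (∀ k → Bad (perturbed separated c (μ k))) → ⊥
          few-bad-shifts separated c l μ inj bad = few-singular-shifts (eventMatrix c (η l)) (λ k → μ k l) inj (λ k →
            let w , nz , ker = bad k l in
            w , nz , λ g′ → trans (sum-cong-≗ {N} (λ g → cong (w g *_) (sym (perturbed-matrix separated c (μ k) l g g′)))) (ker g′))

-- Finite counting: pigeonhole, averaging and the union bound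

module Counting where
  open import Data.Nat using (ℕ; zero; suc; _+_; _*_; _^_; _≤_; _<_; z≤n; s≤s; _≤?_; >-nonZero)
  open import Data.Nat.Properties
  open import Data.Fin as Fin using (Fin; zero; suc; combine; funToFin; finToFun; inject≤)
  import Data.Fin.Properties as Finₚ
  open import Data.Fin.Permutation using (Permutation; _⟨$⟩ʳ_)
  open import Data.Product using (∃; _×_; _,_; proj₁; proj₂)
  open import Function using (_∘_)
  open import Function.Definitions using (Injective)
  open import Relation.Nullary using (¬_; Dec; yes; no; contradiction; ¬?)
  open import Relation.Binary.PropositionalEquality
  open import Algebra.Properties.Semiring.Sum +-*-semiring using (sum; sum-cong-≗; *-distribˡ-sum; ∑-comm; sum-permute)

  sum-mono : ∀ {n} {f g : Fin n → ℕ} → (∀ i → f i ≤ g i) → sum f ≤ sum g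
  sum-mono {zero} le = z≤n
  sum-mono {suc n} le = +-mono-≤ (le zero) (sum-mono (le ∘ suc))

  sum-const : ∀ n k → sum {n} (λ _ → k) ≡ n * k
  sum-const zero k = refl
  sum-const (suc n) k = cong (k +_) (sum-const n k)

  sum-≥-term : ∀ {n} (f : Fin n → ℕ) i → f i ≤ sum f
  sum-≥-term f zero = m≤m+n _ _
  sum-≥-term f (suc i) = ≤-trans (sum-≥-term (f ∘ suc) i) (m≤n+m _ _)

  χ : ∀ {p} {P : Set p} → Dec P → ℕ
  χ (yes _) = 1
  χ (no _) = 0

  χ-yes : ∀ {p} {P : Set p} (P? : Dec P) → P → 1 ≤ χ P?
  χ-yes (yes _) _ = s≤s z≤n
  χ-yes (no ¬p) p = contradiction p ¬p

  χ-no : ∀ {p} {P : Set p} (P? : Dec P) → ¬ P → χ P? ≡ 0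
  χ-no (yes p) ¬p = contradiction p ¬p
  χ-no (no _) _ = refl

  count : ∀ {n} {P : Fin n → Set} → (∀ i → Dec (P i)) → ℕ
  count P? = sum (λ i → χ (P? i))

  count-mono : ∀ {n} {P Q : Fin n → Set} (P? : ∀ i → Dec (P i)) (Q? : ∀ i → Dec (Q i)) → (∀ i → P i → Q i) → count P? ≤ count Q?
  count-mono P? Q? P⇒Q = sum-mono (λ i → χ-mono (P? i) (Q? i) (P⇒Q i))
    where
    χ-mono : ∀ {P Q : Set} (P? : Dec P) (Q? : Dec Q) → (P → Q) → χ P? ≤ χ Q?
    χ-mono (no _) Q? imp = z≤n
    χ-mono (yes p) Q? imp = χ-yes Q? (imp p)

  count-none : ∀ {n} {P : Fin n → Set} (P? : ∀ i → Dec (P i)) → (∀ i → ¬ P i) → count P? ≡ 0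
  count-none {n} P? none = trans (sum-cong-≗ {n} (λ i → χ-no (P? i) (none i))) (trans (sum-const n 0) (*-zeroʳ n))

  enumerate : ∀ {n} {P : Fin n → Set} (P? : ∀ i → Dec (P i)) →
    ∃ λ (e : Fin (count P?) → Fin n) → Injective _≡_ _≡_ e × (∀ k → P (e k))
  enumerate {zero} P? = (λ ()) , (λ {x} → contradiction x λ ()) , λ ()
  enumerate {suc n} P? with P? zero | enumerate (P? ∘ suc)
  ... | no _ | e , inj , Pe = suc ∘ e , inj ∘ Finₚ.suc-injective , Pe
  ... | yes p | e , inj , Pe = (λ { zero → zero ; (suc k) → suc (e k) }) ,
        (λ { {zero} {zero} eq → refl ; {suc k} {suc l} eq → cong suc (inj (Finₚ.suc-injective eq)) }) ,
        λ { zero → p ; (suc k) → Pe k }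

  -- A list of the values of x without repetition, with a representative index for each; `size` is
  -- the number of distinct values.
  record Classification {p q} (x : Fin p → Fin q) : Set where
    field
      size : ℕ
      representative : Fin size → Fin p
      class : Fin p → Fin size
      distinct : Injective _≡_ _≡_ (x ∘ representative)
      class-value : ∀ i → x i ≡ x (representative (class i))

  classify : ∀ {p q} (x : Fin p → Fin q) → Classification x
  classify {zero} x = record { size = 0 ; representative = λ () ; class = λ () ; distinct = λ {i} → contradiction i λ () ; class-value = λ () }
  classify {suc p} x with classify (x ∘ suc)
  ... | record { size = size ; representative = rep ; class = class ; distinct = distinct ; class-value = value }
    with Finₚ.any? (λ k → x zero Fin.≟ x (suc (rep k)))
  ... | yes (k , eq) = record
        { size = size ; representative = suc ∘ rep
        ; class = λ { zero → k ; (suc i) → class i } ; distinct = distinct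
        ; class-value = λ { zero → eq ; (suc i) → value i } }
  ... | no new = record
        { size = suc size
        ; representative = λ { zero → zero ; (suc k) → suc (rep k) }
        ; class = λ { zero → zero ; (suc i) → suc (class i) }
        ; distinct = λ { {zero} {zero} eq → refl ; {zero} {suc k} eq → contradiction (k , eq) new
                       ; {suc k} {zero} eq → contradiction (k , sym eq) new ; {suc k} {suc l} eq → cong suc (distinct eq) }
        ; class-value = λ { zero → refl ; (suc i) → value i } }

  -- If every coordinate took at most T values, the vectors would lie in a box of T^r elements. It
  -- serves both for labels and for vectors of shifts.
  varied-coordinate : ∀ {p q r T} (x : Fin p → Fin r → Fin q) → (∀ {k l} → x k ≗ x l → k ≡ l) → T ^ r < p →
    ∃ λ i → ∃ λ (ι : Fin (suc T) → Fin p) → Injective _≡_ _≡_ (λ k → x (ι k) i)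
  varied-coordinate {p} {q} {r} {T} x x-inj T^r<p with Finₚ.any? (λ i → suc T ≤? Classification.size (classify (λ k → x k i)))
  ... | yes (i , T<size) = i , (λ k → representative (inject≤ k T<size)) , (λ eq → Finₚ.inject≤-injective T<size T<size _ _ (distinct eq))
    where
    open Classification (classify (λ k → x k i))
  ... | no none = contradiction (x-inj same) (Finₚ.<⇒≢ k<l)
    where
    module Cl i = Classification (classify (λ k → x k i))
    small : ∀ i → Cl.size i ≤ T
    small i = ≮⇒≥ (λ lt → none (i , lt))
    code : Fin p → Fin (T ^ r)
    code k = funToFin (λ i → inject≤ (Cl.class i k) (small i))
    collision = Finₚ.pigeonhole T^r<p code
    k = proj₁ collision
    l = proj₁ (proj₂ collision)
    k<l = proj₁ (proj₂ (proj₂ collision))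
    same-class : ∀ i → Cl.class i k ≡ Cl.class i l
    same-class i = Finₚ.inject≤-injective (small i) (small i) _ _
      (trans (sym (Finₚ.finToFun-funToFin (λ i → inject≤ (Cl.class i k) (small i)) i))
        (trans (cong (λ z → finToFun z i) (proj₂ (proj₂ (proj₂ collision)))) (Finₚ.finToFun-funToFin (λ i → inject≤ (Cl.class i l) (small i)) i)))
    same : x k ≗ x l
    same i = trans (Cl.class-value i k) (trans (cong (λ c → x (Cl.representative i c) i) (same-class i)) (sym (Cl.class-value i l)))

  large-fibre : ∀ {A B} (f : Fin A → Fin B) → 1 ≤ B → ∃ λ b → A ≤ B * count (λ i → f i Fin.≟ b)
  large-fibre {zero} {suc B} f 1≤B = zero , z≤n
  large-fibre {suc A} {B} f 1≤B with Finₚ.any? (λ b → suc A ≤? B * count (λ i → f i Fin.≟ b))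
  ... | yes found = found
  ... | no none = contradiction too-small (<⇒≱ (*-monoʳ-< B {{>-nonZero 1≤B}} (n<1+n A)))
    where
    open ≤-Reasoning
    partition : ∀ {n} (f : Fin n → Fin B) → n ≤ sum {B} (λ b → count (λ i → f i Fin.≟ b))
    partition {n} f = begin
      n                                          ≡⟨ trans (sum-const n 1) (*-identityʳ n) ⟨
      sum {n} (λ _ → 1)                          ≤⟨ sum-mono (λ i → ≤-trans (χ-yes (f i Fin.≟ f i) refl) (sum-≥-term (λ b → χ (f i Fin.≟ b)) (f i))) ⟩
      sum {n} (λ i → sum {B} (λ b → χ (f i Fin.≟ b))) ≡⟨ ∑-comm {n} {B} (λ i b → χ (f i Fin.≟ b)) ⟩
      sum {B} (λ b → count (λ i → f i Fin.≟ b))  ∎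
    too-small : B * suc A ≤ B * A
    too-small = begin
      B * suc A                                            ≤⟨ *-monoʳ-≤ B (partition f) ⟩
      B * sum {B} (λ b → count (λ i → f i Fin.≟ b))        ≡⟨ *-distribˡ-sum B (λ b → count (λ i → f i Fin.≟ b)) ⟩
      sum {B} (λ b → B * count (λ i → f i Fin.≟ b))        ≤⟨ sum-mono (λ b → s≤s⁻¹ (≰⇒> (λ le → none (b , le)))) ⟩
      sum {B} (λ _ → A)                                    ≡⟨ sum-const B A ⟩
      B * A                                                ∎
      where
      open import Data.Nat using (s≤s⁻¹)

  -- Averaging over the shifts: each is a permutation and so preserves the count, and after
  -- exchanging the sums every c contributes at most ε. In terms of probability, B has measure at
  -- most ε / Λ.
  shift-bound : ∀ {Q Λ ε} {B : Fin Q → Set} (B? : ∀ c → Dec (B c)) (shift : Fin Λ → Permutation Q Q) →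
    (∀ c → count (λ l → B? (shift l ⟨$⟩ʳ c)) ≤ ε) → Λ * count B? ≤ Q * ε
  shift-bound {Q} {Λ} {ε} B? shift few = begin
    Λ * count B?                                          ≡⟨ sum-const Λ (count B?) ⟨
    sum {Λ} (λ l → count B?)                              ≡⟨ sum-cong-≗ {Λ} (λ l → sum-permute (λ c → χ (B? c)) (shift l)) ⟩
    sum {Λ} (λ l → sum {Q} (λ c → χ (B? (shift l ⟨$⟩ʳ c)))) ≡⟨ ∑-comm {Λ} {Q} (λ l c → χ (B? (shift l ⟨$⟩ʳ c))) ⟩
    sum {Q} (λ c → count (λ l → B? (shift l ⟨$⟩ʳ c)))     ≤⟨ sum-mono few ⟩
    sum {Q} (λ _ → ε)                                     ≡⟨ sum-const Q ε ⟩
    Q * ε                                                 ∎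
    where
    open ≤-Reasoning

  -- E events of probability at most ε / Λ each cannot cover everything when E ε < Λ; the fractions
  -- are cleared.
  union-bound : ∀ {Q E Λ ε} {B : Fin E → Fin Q → Set} (B? : ∀ e c → Dec (B e c)) →
    (∀ e → Λ * count (B? e) ≤ Q * ε) → E * ε < Λ → 1 ≤ Q → ∃ λ c → ∀ e → ¬ B e c
  union-bound {Q} {E} {Λ} {ε} {B} B? small Eε<Λ 1≤Q with Finₚ.any? (λ c → Finₚ.all? (λ e → ¬? (B? e c)))
  ... | yes found = found
  ... | no none = contradiction too-small (<⇒≱ (*-monoʳ-< Q {{>-nonZero 1≤Q}} Eε<Λ))
    where
    open ≤-Reasoning
    hit : ∀ c → 1 ≤ sum {E} (λ e → χ (B? e c))
    hit c with Finₚ.any? (λ e → B? e c)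
    ... | yes (e , bad) = ≤-trans (χ-yes (B? e c) bad) (sum-≥-term (λ e → χ (B? e c)) e)
    ... | no ¬bad = contradiction (c , λ e bad → ¬bad (e , bad)) none
    too-small : Q * Λ ≤ Q * (E * ε)
    too-small = begin
      Q * Λ                                            ≡⟨ *-comm Q Λ ⟩
      Λ * Q                                            ≡⟨ cong (Λ *_) (trans (sum-const Q 1) (*-identityʳ Q)) ⟨
      Λ * sum {Q} (λ _ → 1)                            ≤⟨ *-monoʳ-≤ Λ (sum-mono hit) ⟩
      Λ * sum {Q} (λ c → sum {E} (λ e → χ (B? e c)))   ≡⟨ cong (Λ *_) (∑-comm {Q} {E} (λ c e → χ (B? e c))) ⟩
      Λ * sum {E} (λ e → count (B? e))                 ≡⟨ *-distribˡ-sum Λ (λ e → count (B? e)) ⟩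
      sum {E} (λ e → Λ * count (B? e))                 ≤⟨ sum-mono small ⟩
      sum {E} (λ _ → Q * ε)                            ≡⟨ sum-const E (Q * ε) ⟩
      E * (Q * ε)                                      ≡⟨ trans (sym (*-assoc E Q ε)) (trans (cong (_* ε) (*-comm E Q)) (*-assoc Q E ε)) ⟩
      Q * (E * ε)                                      ∎

  module _ {a b c d : ℕ} where
    private
      triple : Fin b × Fin (c * d) → Fin b × Fin c × Fin d
      triple (y , r) = y , Fin.remQuot {c} d r

      nest : Fin a × Fin (b * (c * d)) → Fin a × Fin b × Fin c × Fin d
      nest (x , r) = x , triple (Fin.remQuot {b} (c * d) r)

    quadruple : Fin (a * (b * (c * d))) → Fin a × Fin b × Fin c × Fin d
    quadruple e = nest (Fin.remQuot {a} (b * (c * d)) e)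

    quadruple⁻¹ : Fin a × Fin b × Fin c × Fin d → Fin (a * (b * (c * d)))
    quadruple⁻¹ (x , y , z , w) = combine x (combine y (combine z w))

    quadruple-quadruple⁻¹ : ∀ t → quadruple (quadruple⁻¹ t) ≡ t
    quadruple-quadruple⁻¹ (x , y , z , w) = trans (cong nest (Finₚ.remQuot-combine {a} x _))
      (cong (x ,_) (trans (cong triple (Finₚ.remQuot-combine {b} y _)) (cong (y ,_) (Finₚ.remQuot-combine {c} z w))))

-- Existence of a polynomial avoiding all bad events

module GoodPolynomials where
  open Polynomials
  open PolynomialMatrices
  open Certificates
  open Events
  open Counting
  open import Data.Nat as ℕ using (ℕ; suc)
  import Data.Nat.Properties as ℕₚ
  open import Data.Fin as Fin using (Fin; suc; combine; punchIn; finToFun; funToFin; inject≤)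
  import Data.Fin.Properties as Finₚ
  open import Data.Fin.Permutation using (Permutation; permutation; _⟨$⟩ʳ_)
  open import Data.Product using (∃; _×_; _,_; proj₁; proj₂)
  open import Data.Empty using (⊥)
  open import Function using (_∘_)
  open import Function.Definitions using (Injective)
  open import Relation.Nullary using (¬_; Dec; yes; no; ¬?; _×-dec_; _→-dec_)
  open import Relation.Binary.PropositionalEquality

  -- N is the size of the certificate matrix, and T + 1 distinct values of t are contradictory as
  -- soon as the matrix is regular at one place.
  module Sizes (n D′ : ℕ) where
    S = suc n
    D = suc D′
    N = suc (D′ ℕ.+ n ℕ.* D) ℕ.^ n
    T = N ℕ.* suc D ℕ.+ D

  module EventCount (q v n : ℕ) where
    m = v ℕ.* suc (suc n)
    pointCodes = q ℕ.^ m
    -- The factors count the choices of `b`, `i`, `a` and `ω`.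
    E = v ℕ.* (suc n ℕ.* (pointCodes ℕ.^ suc n ℕ.* q ℕ.^ suc n))

  module GoodTheory {q : ℕ} (F : FieldOn (Fin q)) (v n D′ : ℕ) (n≤D : n ℕ.≤ suc D′) (1≤q : 1 ℕ.≤ q)
    (κ-size : suc n ℕ.* suc D′ ℕ.≤ q) (η-size : suc (suc D′) ℕ.≤ q) (ρ-size : suc (suc (Sizes.T n D′)) ℕ.≤ q)
    (few-events : EventCount.E q v n ℕ.* Sizes.N n D′ ℕ.^ suc (suc D′) ℕ.< q ℕ.^ suc (suc D′)) where
    open Sizes n D′ using (S; D; N; T)
    open EventCount q v n using (m; pointCodes; E)
    open FieldTheory F
    open EventTheory F
    open Places v n using (BlockPoint; place; flat; flat-combine)

    node : ∀ {k} → k ℕ.≤ q → Fin k → K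
    node k≤q i = inject≤ i k≤q

    node-injective : ∀ {k} (k≤q : k ℕ.≤ q) → Injective _≡_ _≡_ (node k≤q)
    node-injective k≤q = Finₚ.inject≤-injective k≤q k≤q _ _

    κ : Fin (suc n ℕ.* suc D′) → Fin q
    κ = node κ-size

    κ-injective : Injective _≡_ _≡_ κ
    κ-injective = node-injective κ-size

    η : Fin (suc (suc D′)) → Fin q
    η = node η-size

    η-injective : Injective _≡_ _≡_ η
    η-injective = node-injective η-size

    open Places.Family v n D′ n≤D κ κ-injective η η-injective public
      using (Coefficients; P; P-respects; Event; Bad; bad?; Separated; perturbed; few-bad-shifts; few-solutions; Bad-cong)
    module Fam = Places.Family v n D′ n≤D κ κ-injective η η-injective

    Θ = suc D ℕ.^ m
    Q = q ℕ.^ Θ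
    Λ = q ℕ.^ suc D

    coefficients : Fin Q → Coefficients
    coefficients = finToFun {q} {Θ}

    blockPoint : Fin pointCodes → BlockPoint
    blockPoint k b i = finToFun {q} {m} k (combine b i)

    toEvent : Fin v × Fin S × Fin (pointCodes ℕ.^ S) × Fin (q ℕ.^ S) → Event
    toEvent (b , i , α , β) = record { b = b ; i = i ; a = λ j → blockPoint (finToFun {pointCodes} {S} α j) ; ω = finToFun {q} {S} β }

    separated? : ∀ ev → Dec (Separated ev)
    separated? ev = Finₚ.all? (λ j → Finₚ.all? (λ j′ → ¬? (j Fin.≟ j′) →-dec
      Finₚ.any? (λ b′ → Finₚ.any? (λ i′ → ¬? (b′ Fin.≟ Event.b ev) ×-dec ¬? (Event.a ev j b′ i′ ≟K Event.a ev j′ b′ i′)))))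

    -- Separation belongs to the event, so unseparated codes are never bad and the union bound can
    -- run over all codes.
    BadCode : Fin E → Fin Q → Set
    BadCode e c = Separated (toEvent (quadruple {v} {S} e)) × Bad (toEvent (quadruple {v} {S} e)) (coefficients c)

    badCode? : ∀ e c → Dec (BadCode e c)
    badCode? e c = separated? (toEvent (quadruple {v} {S} e)) ×-dec bad? (toEvent (quadruple {v} {S} e)) (coefficients c)

    module _ (ev : Event) (separated : Separated ev) where
      u : Fin Λ → Coefficients
      u l = Fam.Direction.direction ev separated (finToFun {q} {suc D} l)

      shift : Fin Λ → Permutation Q Q
      shift l = permutation
        (λ c → funToFin (λ g → coefficients c g + u l g))
        (λ c → funToFin (λ g → coefficients c g - u l g))
        (λ c → inverse c (λ g x → x - u l g) (λ g x → x + u l g) (λ g x → cancel₁ x (u l g)))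
        (λ c → inverse c (λ g x → x + u l g) (λ g x → x - u l g) (λ g x → cancel₂ x (u l g)))
        where
        cancel₁ : ∀ x y → (x - y) + y ≡ x
        cancel₁ = solve 2 (λ x y → (x :- y) :+ y := x) refl
        cancel₂ : ∀ x y → (x + y) - y ≡ x
        cancel₂ = solve 2 (λ x y → (x :+ y) :- y := x) refl
        inverse : ∀ c (h h′ : Fin Θ → K → K) → (∀ g x → h′ g (h g x) ≡ x) →
          funToFin (λ g → h′ g (coefficients (funToFin (λ g → h g (coefficients c g))) g)) ≡ c
        inverse c h h′ eq = trans (funToFin-cong (λ g → trans (cong (h′ g) (Finₚ.finToFun-funToFin {Θ} (λ g → h g (coefficients c g)) g)) (eq g (coefficients c g))))
          (Finₚ.funToFin-finToFin {Θ} {q} c)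

      -- Among more than N^(D+1) bad vectors of shifts, some coordinate would take N + 1 values,
      -- against `few-bad-shifts`.
      few-bad : ∀ c → count (λ l → bad? ev (coefficients (shift l ⟨$⟩ʳ c))) ℕ.≤ N ℕ.^ suc D
      few-bad c = ℕₚ.≮⇒≥ (λ many →
        let e , e-inj , bad = enumerate (λ l → bad? ev (coefficients (shift l ⟨$⟩ʳ c)))
            l , ι , ι-inj = varied-coordinate {q = q} {suc D} {N} (λ k → finToFun {q} {suc D} (e k)) (λ eq → e-inj (finToFun-injective {suc D} eq)) many
        in few-bad-shifts ev separated (coefficients c) l (λ k → finToFun {q} {suc D} (e (ι k))) ι-inj
             (λ k → Bad-cong ev (Finₚ.finToFun-funToFin {Θ} _) (bad (ι k))))

    badCode-small : ∀ e → Λ ℕ.* count (badCode? e) ℕ.≤ Q ℕ.* N ℕ.^ suc D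
    badCode-small e = by-cases (separated? ev)
      where
      open ℕₚ.≤-Reasoning
      ev = toEvent (quadruple {v} {S} e)
      by-cases : Dec (Separated ev) → Λ ℕ.* count (badCode? e) ℕ.≤ Q ℕ.* N ℕ.^ suc D
      by-cases (yes separated) = ℕₚ.≤-trans
        (ℕₚ.*-monoʳ-≤ Λ (count-mono (badCode? e) (λ c → bad? ev (coefficients c)) (λ c → proj₂)))
        (shift-bound (λ c → bad? ev (coefficients c)) (shift ev separated) (few-bad ev separated))
      by-cases (no ¬separated) = begin
        Λ ℕ.* count (badCode? e) ≡⟨ cong (Λ ℕ.*_) (count-none (badCode? e) (λ c → ¬separated ∘ proj₁)) ⟩
        Λ ℕ.* 0                  ≡⟨ ℕₚ.*-zeroʳ Λ ⟩
        0                        ≤⟨ ℕ.z≤n ⟩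
        Q ℕ.* N ℕ.^ suc D        ∎

    private instance
      q≢0 : ℕ.NonZero q
      q≢0 = ℕ.>-nonZero 1≤q

    avoiding : ∀ l → ∃ λ (ρ : Fin (suc T) → K) → Injective _≡_ _≡_ ρ × (∀ k → ρ k ≢ η l)
    -- Both node families are initial segments of `Fin q`, so `η l` is node number `l′` of the
    -- longer one; removing it from T + 2 nodes leaves T + 1.
    avoiding l = (λ k → node ρ-size (punchIn l′ k)) ,
      (λ eq → Finₚ.punchIn-injective l′ _ _ (node-injective ρ-size eq)) ,
      λ k eq → Finₚ.punchInᵢ≢i l′ k (node-injective ρ-size (trans eq (Finₚ.toℕ-injective
        (trans (Finₚ.toℕ-inject≤ l η-size) (sym (trans (Finₚ.toℕ-inject≤ l′ ρ-size) (Finₚ.toℕ-inject≤ l D<T)))))))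
      where
      D<T : suc D ℕ.≤ suc (suc T)
      D<T = ℕ.s≤s (ℕₚ.m≤n⇒m≤1+n (ℕₚ.m≤n+m D (N ℕ.* suc D)))
      l′ = inject≤ l D<T

    SeparatedOff : Fin v → (Fin S → BlockPoint) → Set
    SeparatedOff b a = ∀ j j′ → j ≢ j′ → ∃ λ b′ → ∃ λ i′ → b′ ≢ b × a j b′ i′ ≢ a j′ b′ i′

    -- `ω` is universally quantified because the weights `W` are chosen after P. The bound T^S comes
    -- from `varied-coordinate`: beyond it, some coordinate of the labels takes T + 1 values.
    Good : Coefficients → Set
    Good c = ∀ b (a : Fin S → BlockPoint) (ω : Fin S → K) → SeparatedOff b a →
      ∀ {p} (y : Fin p → Fin S → K) → (∀ {k l} → y k ≗ y l → k ≡ l) → T ℕ.^ S ℕ.< p →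
      (∀ k j → P c (place b (y k) (a j)) ≡ ω j) → ⊥

    place-congʳ : ∀ b y {a a′ : BlockPoint} → (∀ b′ i → a b′ i ≡ a′ b′ i) → ∀ b′ i → place b y a b′ i ≡ place b y a′ b′ i
    place-congʳ b y eq b′ i with b′ Fin.≟ b
    ... | yes _ = refl
    ... | no _ = eq b′ i

    good-coefficients : ∃ Good
    good-coefficients = coefficients c , good
      where
      search = union-bound {Q} {E} {Λ} badCode? badCode-small few-events (ℕₚ.m^n>0 q Θ)
      c = proj₁ search
      good : Good (coefficients c)
      good b a ω separated y y-inj many sol =
        let i , ι , ι-inj = varied-coordinate y y-inj many
            code = b , i , funToFin (λ j → funToFin (flat (a j))) , funToFin ω
            ev = toEvent code
            same-a : ∀ j b′ x → Event.a ev j b′ x ≡ a j b′ x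
            same-a j b′ x = trans (cong (λ k → finToFun {q} {m} k (combine b′ x)) (Finₚ.finToFun-funToFin (λ j → funToFin (flat (a j))) j))
              (trans (Finₚ.finToFun-funToFin (flat (a j)) (combine b′ x)) (flat-combine (a j) b′ x))
            separated′ : Separated ev
            separated′ j j′ ne = let b′ , i′ , b′≢b , a≢ = separated j j′ ne in
              b′ , i′ , b′≢b , λ eq → a≢ (trans (sym (same-a j b′ i′)) (trans eq (same-a j′ b′ i′)))
            ¬bad : ¬ Bad ev (coefficients c)
            ¬bad bad = proj₂ search (quadruple⁻¹ code) (subst (λ t → Separated (toEvent t) × Bad (toEvent t) (coefficients c)) (sym (quadruple-quadruple⁻¹ code)) (separated′ , bad))
        in few-solutions ev (coefficients c) ¬bad avoiding (y ∘ ι) ι-inj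
             (λ k j → trans (P-respects (coefficients c) (place-congʳ b (y (ι k)) (same-a j))) (trans (sol (ι k) j) (sym (Finₚ.finToFun-funToFin ω j))))

-- A prime between 4^a and 16 · 4^a, following Erdős

module PrimeGaps where
  open import Data.Nat
  open import Data.Nat.Properties
  open import Data.Nat.Divisibility
  open import Data.Nat.DivMod using (m/n*n≡m)
  open import Data.Nat.Primality
  open import Data.Nat.Primality.Factorisation using (factorise)
  open import Data.Nat.Combinatorics
  open import Data.Nat.Induction using (<-wellFounded)
  open import Data.Nat.Solver using (module +-*-Solver)
  open import Algebra.Properties.CommutativeSemigroup *-commutativeSemigroup using (x∙yz≈y∙xz)
  open import Induction.WellFounded using (Acc; acc)
  open import Data.Fin using (Fin; toℕ; fromℕ<)
  import Data.Fin.Properties as Finₚ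
  open import Data.List using ([]; _∷_)
  open import Data.Nat.ListAction using (product)
  open import Data.List.Relation.Unary.All using ([]; _∷_)
  open import Data.Product using (∃; ∃₂; _×_; _,_)
  open import Data.Sum using (inj₁; inj₂; [_,_]′)
  open import Function using (_∘_)
  open import Relation.Nullary using (¬_; Dec; yes; no; contradiction; _×-dec_)
  open import Relation.Binary.PropositionalEquality
  open ≤-Reasoning

  -- The number of lattice paths: binomial coefficients indexed symmetrically, so that Pascal's rule
  -- involves no subtraction.
  lattice : ℕ → ℕ → ℕ
  lattice i j = (i + j) C i

  lattice-zeroˡ : ∀ j → lattice 0 j ≡ 1
  lattice-zeroˡ j = trans (nCk≡nC[n∸k] {0} {j} z≤n) (nCn≡1 j)

  lattice-zeroʳ : ∀ i → lattice i 0 ≡ 1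
  lattice-zeroʳ i = trans (cong (_C i) (+-identityʳ i)) (nCn≡1 i)

  lattice-pascal : ∀ i j → lattice (suc i) (suc j) ≡ lattice i (suc j) + lattice (suc i) j
  lattice-pascal i j = trans (sym (nCk+nC[k+1]≡[n+1]C[k+1] (i + suc j) i))
    (cong (λ n → lattice i (suc j) + n C suc i) (+-suc i j))

  lattice-! : ∀ i j → lattice i j * (i ! * j !) ≡ (i + j) !
  lattice-! i j = begin-equality
    lattice i j * (i ! * j !)                ≡⟨ cong (λ k → lattice i j * (i ! * k !)) (m+n∸m≡n i j) ⟨
    lattice i j * (i ! * (i + j ∸ i) !)      ≡⟨ cong (_* (i ! * (i + j ∸ i) !)) (nCk≡n!/k![n-k]! i≤i+j) ⟩
    ((i + j) ! / (i ! * (i + j ∸ i) !)) * (i ! * (i + j ∸ i) !) ≡⟨ m/n*n≡m (k![n∸k]!∣n! i≤i+j) ⟩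
    (i + j) !                                ∎
    where
    i≤i+j = m≤m+n i j
    instance _ = i !* (i + j ∸ i) !≢0

  lattice-sym : ∀ i j → lattice i j ≡ lattice j i
  lattice-sym i j = *-cancelʳ-≡ _ _ (i ! * j !) {{i !* j !≢0}} (begin-equality
    lattice i j * (i ! * j !) ≡⟨ lattice-! i j ⟩
    (i + j) !                 ≡⟨ cong _! (+-comm i j) ⟩
    (j + i) !                 ≡⟨ lattice-! j i ⟨
    lattice j i * (j ! * i !) ≡⟨ cong (lattice j i *_) (*-comm (j !) (i !)) ⟩
    lattice j i * (i ! * j !) ∎)

  lattice-absorb : ∀ i j → suc i * lattice (suc i) j ≡ suc (i + j) * lattice i j
  lattice-absorb i j = *-cancelʳ-≡ _ _ (i ! * j !) {{i !* j !≢0}} (begin-equality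
    suc i * lattice (suc i) j * (i ! * j !)       ≡⟨ lem (suc i) (lattice (suc i) j) (i !) (j !) ⟩
    lattice (suc i) j * (suc i ! * j !)           ≡⟨ lattice-! (suc i) j ⟩
    suc (i + j) * (i + j) !                       ≡⟨ cong (suc (i + j) *_) (lattice-! i j) ⟨
    suc (i + j) * (lattice i j * (i ! * j !))     ≡⟨ *-assoc (suc (i + j)) (lattice i j) (i ! * j !) ⟨
    suc (i + j) * lattice i j * (i ! * j !)       ∎)
    where
    lem : ∀ a b c d → a * b * (c * d) ≡ b * (a * c * d)
    lem = solve 4 (λ a b c d → a :* b :* (c :* d) := b :* (a :* c :* d)) refl
      where open +-*-Solver

  lattice-monoʳ : ∀ i j → lattice i j ≤ lattice i (suc j)
  lattice-monoʳ zero j = ≤-reflexive (trans (lattice-zeroˡ j) (sym (lattice-zeroˡ (suc j))))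
  lattice-monoʳ (suc i) j = ≤-trans (m≤n+m _ _) (≤-reflexive (sym (lattice-pascal i j)))

  lattice-monoˡ : ∀ i j → lattice i j ≤ lattice (suc i) j
  lattice-monoˡ i j = subst₂ _≤_ (lattice-sym j i) (lattice-sym j (suc i)) (lattice-monoʳ j i)

  2^m≤lattice : ∀ m → 2 ^ m ≤ lattice m m
  2^m≤lattice zero = ≤-refl
  2^m≤lattice (suc m) = begin
    2 * 2 ^ m                               ≡⟨ cong (2 ^ m +_) (+-identityʳ (2 ^ m)) ⟩
    2 ^ m + 2 ^ m                           ≤⟨ +-mono-≤ (≤-trans (2^m≤lattice m) (lattice-monoʳ m m)) (≤-trans (2^m≤lattice m) (lattice-monoˡ m m)) ⟩
    lattice m (suc m) + lattice (suc m) m   ≡⟨ lattice-pascal m m ⟨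
    lattice (suc m) (suc m)                 ∎

  lattice≤2^ : ∀ i j → lattice i j ≤ 2 ^ (i + j)
  lattice≤2^ zero j = ≤-trans (≤-reflexive (lattice-zeroˡ j)) (m^n>0 2 j)
  lattice≤2^ (suc i) zero = ≤-trans (≤-reflexive (lattice-zeroʳ (suc i))) (m^n>0 2 (suc i + 0))
  lattice≤2^ (suc i) (suc j) = begin
    lattice (suc i) (suc j)               ≡⟨ lattice-pascal i j ⟩
    lattice i (suc j) + lattice (suc i) j ≤⟨ +-mono-≤ (lattice≤2^ i (suc j)) (≤-trans (lattice≤2^ (suc i) j) (≤-reflexive (cong (2 ^_) (sym (+-suc i j))))) ⟩
    2 ^ (i + suc j) + 2 ^ (i + suc j)     ≡⟨ cong (2 ^ (i + suc j) +_) (+-identityʳ _) ⟨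
    2 ^ (suc i + suc j)                   ∎

  -- The denominators of Leibniz's harmonic triangle: 1 / D(i,j+1) = 1 / D(i,j) - 1 / D(i+1,j).
  denominator : ℕ → ℕ → ℕ
  denominator i j = suc (i + j) * lattice i j

  denominator-stepˡ : ∀ i j → suc i * denominator (suc i) j ≡ suc (suc (i + j)) * denominator i j
  denominator-stepˡ i j = begin-equality
    suc i * (suc (suc (i + j)) * lattice (suc i) j) ≡⟨ x∙yz≈y∙xz (suc i) (suc (suc (i + j))) (lattice (suc i) j) ⟩
    suc (suc (i + j)) * (suc i * lattice (suc i) j) ≡⟨ cong (suc (suc (i + j)) *_) (lattice-absorb i j) ⟩
    suc (suc (i + j)) * denominator i j             ∎

  denominator-sym : ∀ i j → denominator i j ≡ denominator j i
  denominator-sym i j = cong₂ _*_ (cong suc (+-comm i j)) (lattice-sym i j)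

  denominator-stepʳ : ∀ i j → suc j * denominator i (suc j) ≡ suc (suc (i + j)) * denominator i j
  denominator-stepʳ i j = begin-equality
    suc j * denominator i (suc j)         ≡⟨ cong (suc j *_) (denominator-sym i (suc j)) ⟩
    suc j * denominator (suc j) i         ≡⟨ denominator-stepˡ j i ⟩
    suc (suc (j + i)) * denominator j i   ≡⟨ cong₂ (λ a b → suc (suc a) * b) (+-comm j i) (denominator-sym j i) ⟩
    suc (suc (i + j)) * denominator i j   ∎

  -- Multiplying the harmonic relation by L: if L = u D(i,j) = w D(i+1,j), then L = (u - w)
  -- D(i,j+1). The edge j = 0 of the triangle consists of the numbers i + 1.
  denominator∣ : ∀ {n L} → (∀ i → 1 ≤ i → i ≤ n → i ∣ L) → ∀ i j → suc (i + j) ≤ n → denominator i j ∣ L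
  denominator∣ {L = L} common i zero le = subst (_∣ L) (sym (trans (cong₂ _*_ (cong suc (+-identityʳ i)) (lattice-zeroʳ i)) (*-identityʳ (suc i))))
    (common (suc i) (s≤s z≤n) (subst (λ k → suc k ≤ _) (+-identityʳ i) le))
  denominator∣ {n} {L} common i (suc j) le with denominator∣ common i j (≤-trans (s≤s (+-monoʳ-≤ i (n≤1+n j))) le)
                                                | denominator∣ common (suc i) j (subst (λ k → suc k ≤ n) (+-suc i j) le)
  ... | divides u L≡u | divides w L≡w = divides (u ∸ w) (*-cancelˡ-≡ _ _ (suc j) (begin-equality
    suc j * L                                              ≡⟨ m+n∸n≡m (suc j * L) (suc i * L) ⟨
    suc j * L + suc i * L ∸ suc i * L                      ≡⟨ cong (_∸ suc i * L) (trans (sym (*-distribʳ-+ L (suc j) (suc i))) (cong (_* L) (trans (cong suc (+-suc j i)) (cong (suc ∘ suc) (+-comm j i))))) ⟩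
    s * L ∸ suc i * L                                      ≡⟨ cong₂ _∸_ sL iL ⟩
    u * (s * d) ∸ w * (s * d)                              ≡⟨ *-distribʳ-∸ (s * d) u w ⟨
    (u ∸ w) * (s * d)                                      ≡⟨ cong ((u ∸ w) *_) (denominator-stepʳ i j) ⟨
    (u ∸ w) * (suc j * denominator i (suc j))              ≡⟨ x∙yz≈y∙xz (u ∸ w) (suc j) (denominator i (suc j)) ⟩
    suc j * ((u ∸ w) * denominator i (suc j))              ∎))
    where
    s = suc (suc (i + j))
    d = denominator i j
    sL : s * L ≡ u * (s * d)
    sL = trans (cong (s *_) L≡u) (x∙yz≈y∙xz s u d)
    iL : suc i * L ≡ w * (s * d)
    iL = trans (cong (suc i *_) L≡w) (trans (x∙yz≈y∙xz (suc i) w _) (cong (w *_) (denominator-stepˡ i j)))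

  -- A multiple of the central binomial coefficient is an entry of the harmonic triangle, by
  -- absorption.
  central∣ : ∀ {m L} → 1 ≤ m → (∀ i → 1 ≤ i → i ≤ m + m → i ∣ L) → lattice m m ∣ L
  central∣ {suc m} {L} _ common = ∣-trans (n∣m*n (suc m))
    (subst (_∣ L) (sym (lattice-absorb m (suc m))) (denominator∣ common m (suc m) ≤-refl))

  module _ {p : ℕ} (prime : Prime p) where
    private instance
      p≢0 : NonZero p
      p≢0 = prime⇒nonZero prime

    1<p : 1 < p
    1<p = nonTrivial⇒n>1 p {{prime⇒nonTrivial prime}}

    ∤⇒nonZero : ∀ {r} → ¬ (p ∣ r) → NonZero r
    ∤⇒nonZero {zero} p∤0 = contradiction (p ∣0) p∤0
    ∤⇒nonZero {suc r} _ = _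

    strip : ∀ n → 1 ≤ n → ∃₂ λ e r → n ≡ p ^ e * r × ¬ (p ∣ r)
    strip n = go n (<-wellFounded n)
      where
      go : ∀ n → Acc _<_ n → 1 ≤ n → ∃₂ λ e r → n ≡ p ^ e * r × ¬ (p ∣ r)
      go n (acc rec) 1≤n with p ∣? n
      ... | no p∤n = 0 , n , sym (*-identityˡ n) , p∤n
      ... | yes (divides zero n≡0) = contradiction (subst (1 ≤_) n≡0 1≤n) λ ()
      ... | yes (divides (suc k) n≡) with go (suc k) (rec smaller) (s≤s z≤n)
        where
        smaller : suc k < n
        smaller = subst (suc k <_) (sym n≡) (subst (_< suc k * p) (*-identityʳ (suc k)) (*-monoʳ-< (suc k) 1<p))
      ... | e , r , k≡ , p∤r = suc e , r , trans n≡ (trans (cong (_* p) k≡) (lem (p ^ e) r p)) , p∤r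
        where
        lem : ∀ a b c → a * b * c ≡ c * a * b
        lem = solve 3 (λ a b c → a :* b :* c := c :* a :* b) refl
          where open +-*-Solver

    -- This takes the place of Legendre's formula. If p^(a+1) > 2m, then p^a R is a common multiple
    -- of 1, ..., 2m, where R is the product of their parts prime to p. The central coefficient
    -- divides it, so p^(a+1) cannot divide that coefficient.
    prime-power-divides-small : ∀ {m} a → 1 ≤ m → p ^ a ∣ lattice m m → p ^ a ≤ m + m
    prime-power-divides-small {m} zero 1≤m _ = ≤-trans 1≤m (m≤m+n m m)
    prime-power-divides-small {m} (suc a) 1≤m pa∣ = ≮⇒≥ (λ 2m<pa →
      let R , p∤R , parts = coprimePart (m + m)
          common : ∀ i → 1 ≤ i → i ≤ m + m → i ∣ p ^ a * R
          common i 1≤i i≤2m = let e , r , i≡ , p∤r = strip i 1≤i in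
            subst (_∣ p ^ a * R) (sym i≡) (*-pres-∣ (m^≤ e a (s≤s⁻¹ (^-cancelʳ-< e (suc a) (≤-<-trans (≤-trans (subst (p ^ e ≤_) (sym i≡) (m≤m*n (p ^ e) r {{∤⇒nonZero p∤r}})) i≤2m) 2m<pa)))) (parts i 1≤i i≤2m e r i≡ p∤r))
      in p∤R (*-cancelˡ-∣ (p ^ a) {{m^n≢0 p a}} (subst (_∣ p ^ a * R) (*-comm p (p ^ a)) (∣-trans pa∣ (central∣ 1≤m common)))))
      where
      ^-cancelʳ-< : ∀ e f → p ^ e < p ^ f → e < f
      ^-cancelʳ-< e f lt = ≰⇒> (λ f≤e → <⇒≱ lt (^-monoʳ-≤ p f≤e))
      m^≤ : ∀ e f → e ≤ f → p ^ e ∣ p ^ f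
      m^≤ e f e≤f = divides (p ^ (f ∸ e)) (trans (cong (p ^_) (sym (m∸n+n≡m e≤f))) (^-distribˡ-+-* p (f ∸ e) e))
      unique : ∀ e r e′ r′ → p ^ e * r ≡ p ^ e′ * r′ → ¬ (p ∣ r) → ¬ (p ∣ r′) → r ≡ r′
      unique zero r zero r′ eq _ _ = trans (sym (*-identityˡ r)) (trans eq (*-identityˡ r′))
      unique zero r (suc e′) r′ eq ¬r _ = contradiction (divides (p ^ e′ * r′) (trans (sym (*-identityˡ r)) (trans eq (trans (*-assoc p (p ^ e′) r′) (*-comm p _))))) ¬r
      unique (suc e) r zero r′ eq _ ¬r′ = contradiction (divides (p ^ e * r) (trans (sym (*-identityˡ r′)) (trans (sym eq) (trans (*-assoc p (p ^ e) r) (*-comm p _))))) ¬r′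
      unique (suc e) r (suc e′) r′ eq ¬r ¬r′ = unique e r e′ r′
        (*-cancelˡ-≡ _ _ p (trans (sym (*-assoc p (p ^ e) r)) (trans eq (*-assoc p (p ^ e′) r′)))) ¬r ¬r′
      coprimePart : ∀ n → ∃ λ R → ¬ (p ∣ R) × (∀ i → 1 ≤ i → i ≤ n → ∀ e r → i ≡ p ^ e * r → ¬ (p ∣ r) → r ∣ R)
      coprimePart zero = 1 , (λ p∣1 → <⇒≱ 1<p (∣⇒≤ p∣1)) , λ i 1≤i i≤0 → contradiction (≤-trans 1≤i i≤0) λ ()
      coprimePart (suc n) with coprimePart n | strip (suc n) (s≤s z≤n)
      ... | R , p∤R , parts | e₀ , r₀ , n≡ , p∤r₀ = r₀ * R , (λ p∣ → [ p∤r₀ , p∤R ]′ (euclidsLemma r₀ R prime p∣)) , parts′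
        where
        parts′ : ∀ i → 1 ≤ i → i ≤ suc n → ∀ e r → i ≡ p ^ e * r → ¬ (p ∣ r) → r ∣ r₀ * R
        parts′ i 1≤i i≤ e r i≡ p∤r with m≤n⇒m<n∨m≡n i≤
        ... | inj₁ i<n = ∣-trans (parts i 1≤i (s≤s⁻¹ i<n) e r i≡ p∤r) (n∣m*n r₀)
        ... | inj₂ refl = subst (_∣ r₀ * R) (unique e₀ r₀ e r (trans (sym n≡) i≡) p∤r₀ p∤r) (m∣m*n R)

    prime∣!⇒≤ : ∀ n → p ∣ n ! → p ≤ n
    prime∣!⇒≤ zero p∣1 = contradiction (∣⇒≤ p∣1) (<⇒≱ 1<p)
    prime∣!⇒≤ (suc n) p∣ with euclidsLemma (suc n) (n !) prime p∣
    ... | inj₁ p∣sn = ∣⇒≤ p∣sn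
    ... | inj₂ p∣n! = m≤n⇒m≤1+n (prime∣!⇒≤ n p∣n!)

    prime∣central : ∀ k → k < p → p ≤ k + k → p ∣ lattice k k
    prime∣central k k<p p≤2k with euclidsLemma (lattice k k) (k ! * k !) prime
      (subst (p ∣_) (sym (lattice-! k k)) (m≤n⇒m∣n! (≤-trans (s≤s z≤n) 1<p) p≤2k))
      where
      m≤n⇒m∣n! : ∀ {m n} → 1 ≤ m → m ≤ n → m ∣ n !
      m≤n⇒m∣n! {m} {zero} 1≤m m≤0 = contradiction (≤-trans 1≤m m≤0) λ ()
      m≤n⇒m∣n! {m} {suc n} 1≤m m≤n with m≤n⇒m<n∨m≡n m≤n
      ... | inj₁ m<n = ∣-trans (m≤n⇒m∣n! 1≤m (s≤s⁻¹ m<n)) (n∣m*n (suc n))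
      ... | inj₂ refl = m∣m*n (n !)
    ... | inj₁ p∣l = p∣l
    ... | inj₂ p∣k!k! = contradiction ([ prime∣!⇒≤ k , prime∣!⇒≤ k ]′ (euclidsLemma (k !) (k !) prime p∣k!k!)) (<⇒≱ k<p)

  primorialFactor : ∀ {n} → Dec (Prime n) → ℕ
  primorialFactor {n} (yes _) = n
  primorialFactor (no _) = 1

  primorial : ℕ → ℕ
  primorial zero = 1
  primorial (suc n) = primorialFactor (prime? (suc n)) * primorial n

  -- M is the product of the primes in (k , i + k]. Each of them divides the central coefficient,
  -- and a new one exceeds all prime divisors of the M so far, so it divides the cofactor.
  primorial-block : ∀ k i → i ≤ k → ∃ λ M → primorial (i + k) ≡ M * primorial k × M ∣ lattice k k × (∀ {r} → Prime r → r ∣ M → r ≤ i + k)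
  primorial-block k zero _ = 1 , sym (*-identityˡ _) , 1∣ _ , λ pr r∣1 → contradiction (∣⇒≤ r∣1) (<⇒≱ (1<p pr))
  primorial-block k (suc i) i<k with primorial-block k i (≤-trans (n≤1+n i) i<k) | prime? (suc (i + k))
  ... | M , eq , M∣ , bound | no _ = M , trans (*-identityˡ _) eq , M∣ , λ pr r∣M → m≤n⇒m≤1+n (bound pr r∣M)
  ... | M , eq , divides c l≡ , bound | yes pr =
        suc (i + k) * M , trans (cong (suc (i + k) *_) eq) (sym (*-assoc (suc (i + k)) M _)) ,
        subst (suc (i + k) * M ∣_) (sym l≡) (*-monoˡ-∣ M p∣c) ,
        λ pr′ r∣ → [ ∣⇒≤ , (λ r∣M → m≤n⇒m≤1+n (bound pr′ r∣M)) ]′ (euclidsLemma (suc (i + k)) M pr′ r∣)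
    where
    p∣c : suc (i + k) ∣ c
    p∣c = [ (λ p∣c → p∣c) , (λ p∣M → contradiction (bound pr p∣M) (<⇒≱ (n<1+n (i + k)))) ]′
      (euclidsLemma c M pr (subst (suc (i + k) ∣_) l≡ (prime∣central pr k (s≤s (m≤n+m k i)) (+-monoˡ-≤ k i<k))))

  primorial-double : ∀ k → primorial (k + k) ≤ 4 ^ k * primorial k
  primorial-double k with primorial-block k k ≤-refl
  ... | M , eq , M∣ , _ = begin
    primorial (k + k)   ≡⟨ eq ⟩
    M * primorial k     ≤⟨ *-monoˡ-≤ (primorial k) (≤-trans (∣⇒≤ {{>-nonZero (≤-trans (m^n>0 2 k) (2^m≤lattice k))}} M∣) (lattice≤2^ k k)) ⟩
    2 ^ (k + k) * primorial k ≡⟨ cong (_* primorial k) (trans (cong (2 ^_) (cong (k +_) (sym (+-identityʳ k)))) (sym (^-*-assoc 2 2 k))) ⟩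
    4 ^ k * primorial k ∎

  -- Powers of 2 suffice because the gap is sought above 4^a, and for them doubling alone gives the
  -- bound.
  primorial-2^ : ∀ b → primorial (2 ^ b) ≤ 4 ^ (2 ^ b)
  primorial-2^ zero = s≤s z≤n
  primorial-2^ (suc b) = begin
    primorial (2 ^ b + (2 ^ b + 0))   ≡⟨ cong (λ k → primorial (2 ^ b + k)) (+-identityʳ (2 ^ b)) ⟩
    primorial (2 ^ b + 2 ^ b)         ≤⟨ primorial-double (2 ^ b) ⟩
    4 ^ (2 ^ b) * primorial (2 ^ b)   ≤⟨ *-monoʳ-≤ (4 ^ (2 ^ b)) (primorial-2^ b) ⟩
    4 ^ (2 ^ b) * 4 ^ (2 ^ b)         ≡⟨ ^-distribˡ-+-* 4 (2 ^ b) (2 ^ b) ⟨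
    4 ^ (2 ^ b + 2 ^ b)               ≡⟨ cong (λ k → 4 ^ (2 ^ b + k)) (+-identityʳ (2 ^ b)) ⟨
    4 ^ (2 ^ suc b)                   ∎

  noPrimeDivisor⇒≡1 : ∀ n → 1 ≤ n → (∀ {p} → Prime p → ¬ (p ∣ n)) → n ≡ 1
  noPrimeDivisor⇒≡1 n 1≤n none with factorise n {{>-nonZero 1≤n}}
  ... | record { factors = [] ; isFactorisation = eq } = eq
  ... | record { factors = p ∷ ps ; isFactorisation = eq ; factorsPrime = pr ∷ _ } =
        contradiction (subst (p ∣_) (sym eq) (m∣m*n (product ps))) (none pr)

  -- Primes above s ≥ √B divide n at most once, so only the at most s primes up to s contribute more than themselves.
  product-bound : ∀ {B s} → B < suc s * suc s → 1 ≤ B → ∀ i n → 1 ≤ n →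
    (∀ {p} → Prime p → ∀ a → p ^ a ∣ n → p ^ a ≤ B) → (∀ {p} → Prime p → p ∣ n → p ≤ i) →
    n ≤ primorial i * B ^ (i ⊓ s)
  product-bound _ _ zero n 1≤n _ small = ≤-reflexive (noPrimeDivisor⇒≡1 n 1≤n (λ pr p∣n → contradiction (≤-trans (1<p pr) (small pr p∣n)) λ ()))
  product-bound {B} {s} B<s² 1≤B (suc i) n 1≤n powers small with prime? (suc i)
  ... | no ¬pr = begin
      n                               ≤⟨ product-bound B<s² 1≤B i n 1≤n powers small′ ⟩
      primorial i * B ^ (i ⊓ s)       ≤⟨ *-mono-≤ (≤-reflexive (sym (*-identityˡ (primorial i)))) (^-monoʳ-≤ B {{>-nonZero 1≤B}} (⊓-monoˡ-≤ s (n≤1+n i))) ⟩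
      1 * primorial i * B ^ (suc i ⊓ s) ∎
    where
    small′ : ∀ {p} → Prime p → p ∣ n → p ≤ i
    small′ pr p∣n with m≤n⇒m<n∨m≡n (small pr p∣n)
    ... | inj₁ p<si = s≤s⁻¹ p<si
    ... | inj₂ refl = contradiction pr ¬pr
  ... | yes pr with strip pr n 1≤n
  ...   | e , r , n≡ , p∤r = by-size (i <? s)
    where
    p = suc i
    1≤r : 1 ≤ r
    1≤r = >-nonZero⁻¹ r {{∤⇒nonZero pr p∤r}}
    r∣n : r ∣ n
    r∣n = divides (p ^ e) n≡
    IH : r ≤ primorial i * B ^ (i ⊓ s)
    IH = product-bound B<s² 1≤B i r 1≤r (λ pr′ a pa∣r → powers pr′ a (∣-trans pa∣r r∣n)) small′
      where
      small′ : ∀ {q} → Prime q → q ∣ r → q ≤ i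
      small′ pr′ q∣r with m≤n⇒m<n∨m≡n (small pr′ (∣-trans q∣r r∣n))
      ... | inj₁ q<si = s≤s⁻¹ q<si
      ... | inj₂ refl = contradiction q∣r p∤r
    pe≤B : p ^ e ≤ B
    pe≤B = powers pr e (divides r (trans n≡ (*-comm (p ^ e) r)))
    by-size : Dec (i < s) → n ≤ p * primorial i * B ^ (suc i ⊓ s)
    by-size (yes i<s) = begin
      n                                     ≡⟨ n≡ ⟩
      p ^ e * r                             ≤⟨ *-mono-≤ pe≤B IH ⟩
      B * (primorial i * B ^ (i ⊓ s))       ≡⟨ x∙yz≈y∙xz B (primorial i) (B ^ (i ⊓ s)) ⟩
      primorial i * B ^ suc (i ⊓ s)         ≡⟨ cong (λ k → primorial i * B ^ k) (trans (cong suc (m≤n⇒m⊓n≡m (<⇒≤ i<s))) (sym (m≤n⇒m⊓n≡m i<s))) ⟩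
      primorial i * B ^ (suc i ⊓ s)         ≤⟨ *-monoˡ-≤ (B ^ (suc i ⊓ s)) (m≤n*m (primorial i) p) ⟩
      p * primorial i * B ^ (suc i ⊓ s)     ∎
    by-size (no i≮s) = begin
      n                                     ≡⟨ n≡ ⟩
      p ^ e * r                             ≤⟨ *-mono-≤ (pe≤p e pe≤B) IH ⟩
      p * (primorial i * B ^ (i ⊓ s))       ≡⟨ *-assoc p (primorial i) _ ⟨
      p * primorial i * B ^ (i ⊓ s)         ≤⟨ *-monoʳ-≤ (p * primorial i) (^-monoʳ-≤ B {{>-nonZero 1≤B}} (⊓-monoˡ-≤ s (n≤1+n i))) ⟩
      p * primorial i * B ^ (suc i ⊓ s)     ∎
      where
      pe≤p : ∀ e → p ^ e ≤ B → p ^ e ≤ p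
      pe≤p zero _ = s≤s z≤n
      pe≤p (suc zero) _ = ≤-reflexive (*-identityʳ p)
      pe≤p (suc (suc e)) pe≤B = contradiction (≤-trans (begin
        suc s * suc s     ≤⟨ *-mono-≤ (s≤s (≮⇒≥ i≮s)) (s≤s (≮⇒≥ i≮s)) ⟩
        p * p             ≤⟨ *-monoʳ-≤ p (m≤m*n p (p ^ e) {{m^n≢0 p e}}) ⟩
        p ^ suc (suc e)   ∎) pe≤B) (<⇒≱ B<s²)

  -- With y = 2^a this is 2y² + 2 (a + 2) · 4y < 8y², divided by y: the comparison of exponents of 2
  -- behind `prime-gap`.
  exponent-gap : ∀ a → 3 ≤ a → 8 * a + 16 < 6 * 2 ^ a
  exponent-gap a 3≤a = subst (λ a → 8 * a + 16 < 6 * 2 ^ a) (m∸n+n≡m 3≤a) (go (a ∸ 3))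
    where
    go : ∀ k → 8 * (k + 3) + 16 < 6 * 2 ^ (k + 3)
    go zero = s≤s (m≤m+n 40 7)
    go (suc k) = begin-strict
      8 * suc (k + 3) + 16             ≡⟨ solve 1 (λ x → con 8 :* (con 1 :+ x) :+ con 16 := con 8 :* x :+ con 16 :+ con 8) refl (k + 3) ⟩
      8 * (k + 3) + 16 + 8             <⟨ +-mono-<-≤ (go k) (≤-trans (m≤n*m 8 (6 * 1)) (≤-trans (*-monoʳ-≤ 6 {8} {2 ^ (k + 3)} (^-monoʳ-≤ 2 (m≤n+m 3 k))) ≤-refl)) ⟩
      6 * 2 ^ (k + 3) + 6 * 2 ^ (k + 3) ≡⟨ solve 1 (λ x → con 6 :* x :+ con 6 :* x := con 6 :* (con 2 :* x)) refl (2 ^ (k + 3)) ⟩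
      6 * 2 ^ suc (k + 3)              ∎
      where open +-*-Solver

  -- Without a prime in the interval, all prime divisors of the central coefficient of order m = 8x
  -- are at most x = 4^a. Then it is at most 4^x (2m)^s, which is less than 2^m, whereas it is at
  -- least 2^m.
  prime-gap : ∀ a → 3 ≤ a → ∃ λ p → Prime p × 4 ^ a < p × p ≤ 16 * 4 ^ a
  prime-gap a 3≤a with Finₚ.any? {n = suc (16 * 4 ^ a)} (λ i → prime? (toℕ i) ×-dec (4 ^ a <? toℕ i))
  ... | yes (i , pr , x<p) = toℕ i , pr , x<p , s≤s⁻¹ (Finₚ.toℕ<n i)
  ... | no none = contradiction too-small (<⇒≱ (^-monoʳ-< 2 (s≤s (s≤s z≤n)) exponents))
    where
    x = 4 ^ a
    m = 8 * x
    2m≡ : m + m ≡ 16 * x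
    2m≡ = solve 1 (λ x → con 8 :* x :+ con 8 :* x := con 16 :* x) refl x
      where open +-*-Solver
    -- The exact square root of 2m = 16x, available because x is a power of 4.
    s = 2 ^ (a + 2)
    x≡2^ : x ≡ 2 ^ a * 2 ^ a
    x≡2^ = trans (^-*-assoc 2 2 a) (trans (cong (2 ^_) (cong (a +_) (+-identityʳ a))) (^-distribˡ-+-* 2 a a))
    s² : s * s ≡ m + m
    s² = trans (trans (cong (λ k → k * k) (^-distribˡ-+-* 2 a 2)) (trans (solve 1 (λ y → (y :* con 4) :* (y :* con 4) := con 16 :* (y :* y)) refl (2 ^ a)) (cong (16 *_) (sym x≡2^)))) (sym 2m≡)
      where open +-*-Solver
    1≤m : 1 ≤ m
    1≤m = ≤-trans (m^n>0 4 a) (m≤n*m x 8)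
    no-large : ∀ {p} → Prime p → p ∣ lattice m m → p ≤ x
    no-large {p} pr p∣ = ≮⇒≥ (λ x<p → none (fromℕ< p<bound , subst Prime (sym (Finₚ.toℕ-fromℕ< p<bound)) pr , subst (x <_) (sym (Finₚ.toℕ-fromℕ< p<bound)) x<p))
      where
      p<bound : p < suc (16 * x)
      p<bound = s≤s (subst (p ≤_) 2m≡ (subst (_≤ m + m) (*-identityʳ p) (prime-power-divides-small pr 1 1≤m (subst (_∣ lattice m m) (sym (*-identityʳ p)) p∣))))
    1≤l : 1 ≤ lattice m m
    1≤l = ≤-trans (m^n>0 2 m) (2^m≤lattice m)
    x-as-2^ : x ≡ 2 ^ (2 * a)
    x-as-2^ = ^-*-assoc 2 2 a
    2m-as-2^ : m + m ≡ 2 ^ (2 * (a + 2))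
    2m-as-2^ = trans (sym s²) (trans (sym (^-distribˡ-+-* 2 (a + 2) (a + 2))) (cong (2 ^_) (cong (a + 2 +_) (sym (+-identityʳ (a + 2))))))
    exponents : 2 * x + 2 * (a + 2) * s < m
    exponents = begin-strict
      2 * x + 2 * (a + 2) * s                ≡⟨ cong₂ (λ y z → 2 * y + 2 * (a + 2) * z) x≡2^ (^-distribˡ-+-* 2 a 2) ⟩
      2 * (y * y) + 2 * (a + 2) * (y * 4)    ≡⟨ solve 2 (λ y a → con 2 :* (y :* y) :+ con 2 :* (a :+ con 2) :* (y :* con 4) := con 2 :* (y :* y) :+ (con 8 :* a :+ con 16) :* y) refl y a ⟩
      2 * (y * y) + (8 * a + 16) * y         <⟨ +-monoʳ-< (2 * (y * y)) (*-monoˡ-< y {{m^n≢0 2 a}} (exponent-gap a 3≤a)) ⟩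
      2 * (y * y) + 6 * y * y                ≡⟨ solve 1 (λ y → con 2 :* (y :* y) :+ con 6 :* y :* y := con 8 :* (y :* y)) refl y ⟩
      8 * (y * y)                            ≡⟨ cong (8 *_) x≡2^ ⟨
      m                                      ∎
      where
      open +-*-Solver
      y = 2 ^ a
    too-small : 2 ^ m ≤ 2 ^ (2 * x + 2 * (a + 2) * s)
    too-small = begin
      2 ^ m                                   ≤⟨ 2^m≤lattice m ⟩
      lattice m m                             ≤⟨ product-bound {m + m} {s} (subst (_< suc s * suc s) s² (*-mono-< (n<1+n s) (n<1+n s))) (≤-trans 1≤m (m≤m+n m m)) x (lattice m m) 1≤l (λ pr a → prime-power-divides-small pr a 1≤m) no-large ⟩
      primorial x * (m + m) ^ (x ⊓ s)         ≤⟨ *-mono-≤ (subst (λ k → primorial k ≤ 4 ^ k) (sym x-as-2^) (primorial-2^ (2 * a))) (^-monoʳ-≤ (m + m) {{>-nonZero (≤-trans 1≤m (m≤m+n m m))}} (m⊓n≤n x s)) ⟩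
      4 ^ x * (m + m) ^ s                     ≡⟨ cong₂ _*_ (^-*-assoc 2 2 x) (trans (cong (_^ s) 2m-as-2^) (^-*-assoc 2 (2 * (a + 2)) s)) ⟩
      2 ^ (2 * x) * 2 ^ (2 * (a + 2) * s)     ≡⟨ ^-distribˡ-+-* 2 (2 * x) (2 * (a + 2) * s) ⟨
      2 ^ (2 * x + 2 * (a + 2) * s)           ∎

-- Prime fields

module ResidueFields where
  open Polynomials
  open import Data.Nat as ℕ using (ℕ; NonZero)
  import Data.Nat.Properties as ℕₚ
  open import Data.Nat.DivMod using (_%_; m%n<n; %-distribˡ-+; %-distribˡ-*; [m+kn]%n≡m%n; m<n⇒m%n≡m)
  open import Data.Nat.Primality using (Prime; prime⇒nonZero; prime⇒nonTrivial)
  open import Data.Nat.Coprimality using (prime⇒coprime; coprime-Bézout) renaming (sym to coprime-sym)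
  open import Data.Nat.GCD using (module Bézout)
  open import Data.Fin as Fin using (Fin; toℕ; fromℕ<)
  import Data.Fin.Properties as Finₚ
  open import Data.Product using (∃; _,_; proj₁; proj₂)
  open import Algebra.Bundles using (CommutativeRing)
  open import Algebra.Structures using (IsCommutativeRing)
  open import Relation.Nullary using (yes; no; contradiction)
  open import Relation.Binary.PropositionalEquality

  module _ {p : ℕ} (prime : Prime p) where
    private instance
      p≢0 : NonZero p
      p≢0 = prime⇒nonZero prime

    residue : ℕ → Fin p
    residue a = fromℕ< (m%n<n a p)

    residue-cong : ∀ {a b} → a % p ≡ b % p → residue a ≡ residue b
    residue-cong eq = Finₚ.fromℕ<-cong _ _ eq _ _

    toℕ-residue : ∀ a → toℕ (residue a) ≡ a % p
    toℕ-residue a = Finₚ.toℕ-fromℕ< (m%n<n a p)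

    residue-toℕ : ∀ i → residue (toℕ i) ≡ i
    residue-toℕ i = Finₚ.toℕ-injective (trans (toℕ-residue (toℕ i)) (m<n⇒m%n≡m (Finₚ.toℕ<n i)))

    infixl 6 _⊕_
    infixl 7 _⊗_

    _⊕_ _⊗_ : Fin p → Fin p → Fin p
    i ⊕ j = residue (toℕ i ℕ.+ toℕ j)
    i ⊗ j = residue (toℕ i ℕ.* toℕ j)

    ⊖_ : Fin p → Fin p
    ⊖ i = residue (p ℕ.∸ toℕ i)

    𝟘 𝟙 : Fin p
    𝟘 = residue 0
    𝟙 = residue 1

    residue-+ : ∀ a b → residue a ⊕ residue b ≡ residue (a ℕ.+ b)
    residue-+ a b = residue-cong (trans (cong₂ (λ x y → (x ℕ.+ y) % p) (toℕ-residue a) (toℕ-residue b)) (sym (%-distribˡ-+ a b p)))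

    residue-* : ∀ a b → residue a ⊗ residue b ≡ residue (a ℕ.* b)
    residue-* a b = residue-cong (trans (cong₂ (λ x y → (x ℕ.* y) % p) (toℕ-residue a) (toℕ-residue b)) (sym (%-distribˡ-* a b p)))

    ⊕-residueˡ : ∀ a j → residue a ⊕ j ≡ residue (a ℕ.+ toℕ j)
    ⊕-residueˡ a j = trans (cong (residue a ⊕_) (sym (residue-toℕ j))) (residue-+ a (toℕ j))

    ⊗-residueˡ : ∀ a j → residue a ⊗ j ≡ residue (a ℕ.* toℕ j)
    ⊗-residueˡ a j = trans (cong (residue a ⊗_) (sym (residue-toℕ j))) (residue-* a (toℕ j))

    ⊕-comm : ∀ i j → i ⊕ j ≡ j ⊕ i
    ⊕-comm i j = cong residue (ℕₚ.+-comm (toℕ i) (toℕ j))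

    ⊗-comm : ∀ i j → i ⊗ j ≡ j ⊗ i
    ⊗-comm i j = cong residue (ℕₚ.*-comm (toℕ i) (toℕ j))

    ⊕-assoc : ∀ i j k → (i ⊕ j) ⊕ k ≡ i ⊕ (j ⊕ k)
    ⊕-assoc i j k = trans (⊕-residueˡ _ k) (trans (cong residue (ℕₚ.+-assoc (toℕ i) (toℕ j) (toℕ k)))
      (sym (trans (⊕-comm i (j ⊕ k)) (trans (⊕-residueˡ _ i) (cong residue (ℕₚ.+-comm _ (toℕ i)))))))

    ⊗-assoc : ∀ i j k → (i ⊗ j) ⊗ k ≡ i ⊗ (j ⊗ k)
    ⊗-assoc i j k = trans (⊗-residueˡ _ k) (trans (cong residue (ℕₚ.*-assoc (toℕ i) (toℕ j) (toℕ k)))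
      (sym (trans (⊗-comm i (j ⊗ k)) (trans (⊗-residueˡ _ i) (cong residue (ℕₚ.*-comm _ (toℕ i)))))))

    ⊕-identityˡ : ∀ i → 𝟘 ⊕ i ≡ i
    ⊕-identityˡ i = trans (⊕-residueˡ 0 i) (residue-toℕ i)

    ⊗-identityˡ : ∀ i → 𝟙 ⊗ i ≡ i
    ⊗-identityˡ i = trans (⊗-residueˡ 1 i) (trans (cong residue (ℕₚ.*-identityˡ (toℕ i))) (residue-toℕ i))

    ⊖-inverseˡ : ∀ i → (⊖ i) ⊕ i ≡ 𝟘
    ⊖-inverseˡ i = trans (⊕-residueˡ _ i) (residue-cong (trans (cong (_% p) (trans (ℕₚ.m∸n+n≡m (ℕₚ.<⇒≤ (Finₚ.toℕ<n i))) (sym (ℕₚ.*-identityˡ p)))) ([m+kn]%n≡m%n 0 1 p)))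

    ⊗-distribˡ-⊕ : ∀ i j k → i ⊗ (j ⊕ k) ≡ (i ⊗ j) ⊕ (i ⊗ k)
    ⊗-distribˡ-⊕ i j k = trans (⊗-comm i (j ⊕ k)) (trans (⊗-residueˡ _ i)
      (trans (cong residue (trans (ℕₚ.*-comm _ (toℕ i)) (ℕₚ.*-distribˡ-+ (toℕ i) (toℕ j) (toℕ k))))
        (sym (residue-+ (toℕ i ℕ.* toℕ j) (toℕ i ℕ.* toℕ k)))))

    isCommutativeRing : IsCommutativeRing _≡_ _⊕_ _⊗_ ⊖_ 𝟘 𝟙
    isCommutativeRing = record
      { isRing = record
        { +-isAbelianGroup = record
          { isGroup = record
            { isMonoid = record
              { isSemigroup = record
                { isMagma = record { isEquivalence = isEquivalence ; ∙-cong = cong₂ _⊕_ }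
                ; assoc = ⊕-assoc }
              ; identity = ⊕-identityˡ , λ i → trans (⊕-comm i 𝟘) (⊕-identityˡ i) }
            ; inverse = ⊖-inverseˡ , λ i → trans (⊕-comm i (⊖ i)) (⊖-inverseˡ i)
            ; ⁻¹-cong = cong ⊖_ }
          ; comm = ⊕-comm }
        ; *-cong = cong₂ _⊗_
        ; *-assoc = ⊗-assoc
        ; *-identity = ⊗-identityˡ , λ i → trans (⊗-comm i 𝟙) (⊗-identityˡ i)
        ; distrib = ⊗-distribˡ-⊕ , λ i j k → trans (⊗-comm (j ⊕ k) i) (trans (⊗-distribˡ-⊕ i j k) (cong₂ _⊕_ (⊗-comm i j) (⊗-comm i k))) }
      ; *-comm = ⊗-comm }

    private
      ring : CommutativeRing _ _
      ring = record { isCommutativeRing = isCommutativeRing }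

    open import Algebra.Properties.Ring (CommutativeRing.ring ring) using (-‿distribʳ-*; -‿involutive)
    open import Algebra.Properties.Group (CommutativeRing.+-group ring) using (inverseʳ-unique)

    inverse : ∀ i → i ≢ 𝟘 → ∃ λ j → i ⊗ j ≡ 𝟙
    inverse i i≢0 = fromBézout (coprime-Bézout (coprime-sym (prime⇒coprime prime {{ℕ.≢-nonZero i≢ℕ0}} (Finₚ.toℕ<n i))))
      where
      i≢ℕ0 : toℕ i ≢ 0
      i≢ℕ0 eq = i≢0 (trans (sym (residue-toℕ i)) (cong residue eq))
      times : ∀ x → i ⊗ residue x ≡ residue (x ℕ.* toℕ i)
      times x = trans (⊗-comm i (residue x)) (⊗-residueˡ x i)
      fromBézout : Bézout.Identity.Identity 1 (toℕ i) p → ∃ λ j → i ⊗ j ≡ 𝟙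
      fromBézout (Bézout.Identity.+- x y eq) = residue x , trans (times x) (residue-cong (trans (cong (_% p) (sym eq)) ([m+kn]%n≡m%n 1 y p)))
      -- Here 1 + x i = y p, so the inverse of i is -x.
      fromBézout (Bézout.Identity.-+ x y eq) = ⊖ residue x , trans (sym (-‿distribʳ-* i (residue x)))
        (trans (cong ⊖_ (inverseʳ-unique 𝟙 (i ⊗ residue x) (trans (cong (𝟙 ⊕_) (times x)) (trans (residue-+ 1 (x ℕ.* toℕ i))
          (trans (cong residue eq) (residue-cong ([m+kn]%n≡m%n 0 y p))))))) (-‿involutive 𝟙))

    fieldOfResidues : FieldOn (Fin p)
    fieldOfResidues = record
      { isCommutativeRing = isCommutativeRing
      ; inv = inv
      ; inverseʳ = inv-correct
      ; 𝟙≢𝟘 = λ eq → contradiction (trans (sym (toℕ-one)) (trans (cong toℕ eq) (toℕ-residue 0))) λ eq′ → contradiction (trans eq′ (m<n⇒m%n≡m (ℕₚ.<-trans ℕ.z<s 1<p))) λ ()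
      ; _≟K_ = Fin._≟_ }
      where
      1<p = ℕ.nonTrivial⇒n>1 p {{prime⇒nonTrivial prime}}
      toℕ-one : toℕ 𝟙 ≡ 1
      toℕ-one = trans (toℕ-residue 1) (m<n⇒m%n≡m 1<p)
      inv : Fin p → Fin p
      inv i with i Fin.≟ 𝟘
      ... | yes _ = 𝟘
      ... | no i≢0 = proj₁ (inverse i i≢0)
      inv-correct : ∀ i → i ≢ 𝟘 → i ⊗ inv i ≡ 𝟙
      inv-correct i i≢0 with i Fin.≟ 𝟘
      ... | yes eq = contradiction eq i≢0
      ... | no ne = proj₂ (inverse i ne)

-- Images of edges, and transversals of complete partite hypergraphs

module PartiteHypergraphs where
  open import Defs
  open import Data.Nat using (ℕ; zero; suc; _≡ᵇ_)
  open import Data.Nat.Properties using (≡⇒≡ᵇ)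
  open import Data.Bool using (true; false; T; T?; if_then_else_)
  open import Data.Bool.Properties using (T-∧; T-≡)
  open import Data.Bool.ListAction using (and)
  open import Data.Fin as Fin using (Fin; zero; suc; _↑ˡ_; _↑ʳ_; inject₁; fromℕ; combine; remQuot)
  import Data.Fin.Properties as Finₚ
  open import Data.Fin.Subset using (Subset; ⁅_⁆; _∪_; ⊥; ∣_∣; _∈_; _∉_; inside; outside)
  open import Data.Fin.Subset.Properties using (x∈⁅y⁆⇒x≡y; x∈⁅x⁆; x∈p∪q⁻; x∈p∪q⁺; ∉⊥; ∪-identityˡ; ∣⊥∣≡0)
  open import Data.List as List using (List; []; _∷_; allFin; tabulate; filter; length)
  open import Data.List.Relation.Unary.Any using (here; there)
  import Data.List.Relation.Unary.Any as Any
  open import Data.List.Membership.Propositional using () renaming (_∈_ to _∈ˡ_)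
  open import Data.List.Membership.Propositional.Properties using (∈-allFin; ∈-filter⁺; ∈-++⁺ˡ; ∈-++⁺ʳ; ∈-map⁺)
  open import Data.Vec as Vec using (Vec; []; _∷_; lookup; _∷ʳ_)
  open import Data.Vec.Properties using (lookup∘tabulate)
  open import Data.Product using (∃; _×_; _,_; proj₁; proj₂)
  open import Data.Sum using (inj₁; inj₂)
  open import Function using (_∘_; Equivalence)
  open import Function.Definitions using (Injective)
  open import Relation.Nullary using (¬_; yes; no; contradiction)
  open import Relation.Nullary.Decidable using (⌊_⌋; toWitness; fromWitness)
  open import Relation.Unary using (Decidable)
  open import Relation.Binary.PropositionalEquality

  module _ {v n : ℕ} (φ : Fin v → Fin n) (e : Subset v) where
    private
      imgOf : List (Fin v) → Subset n
      imgOf = List.foldr (λ x acc → (if lookup e x then ⁅ φ x ⁆ else ⊥) ∪ acc) ⊥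

      ∈-imgOf⁺ : ∀ xs {x} → x ∈ˡ xs → lookup e x ≡ true → φ x ∈ imgOf xs
      ∈-imgOf⁺ (x ∷ xs) (here refl) eq rewrite eq = x∈p∪q⁺ (inj₁ (x∈⁅x⁆ (φ x)))
      ∈-imgOf⁺ (x ∷ xs) (there x∈) eq = x∈p∪q⁺ (inj₂ (∈-imgOf⁺ xs x∈ eq))

      ∈-imgOf⁻ : ∀ xs {y} → y ∈ imgOf xs → ∃ λ x → lookup e x ≡ true × φ x ≡ y
      ∈-imgOf⁻ [] y∈ = contradiction y∈ ∉⊥
      ∈-imgOf⁻ (x ∷ xs) y∈ with lookup e x in eq | x∈p∪q⁻ (if lookup e x then ⁅ φ x ⁆ else ⊥) (imgOf xs) y∈
      ... | true | inj₁ y∈x = x , eq , sym (x∈⁅y⁆⇒x≡y (φ x) y∈x)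
      ... | false | inj₁ y∈⊥ = contradiction y∈⊥ ∉⊥
      ... | true | inj₂ y∈xs = ∈-imgOf⁻ xs y∈xs
      ... | false | inj₂ y∈xs = ∈-imgOf⁻ xs y∈xs

    ∈-img⁺ : ∀ {x} → lookup e x ≡ true → φ x ∈ img φ e
    ∈-img⁺ {x} = ∈-imgOf⁺ (allFin v) (∈-allFin x)

    ∈-img⁻ : ∀ {y} → y ∈ img φ e → ∃ λ x → lookup e x ≡ true × φ x ≡ y
    ∈-img⁻ = ∈-imgOf⁻ (allFin v)

  ∣⁅x⁆∪p∣ : ∀ {n} (x : Fin n) (p : Subset n) → x ∉ p → ∣ ⁅ x ⁆ ∪ p ∣ ≡ suc ∣ p ∣
  ∣⁅x⁆∪p∣ zero (true ∷ p) x∉ = contradiction Vec.here x∉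
  ∣⁅x⁆∪p∣ zero (false ∷ p) x∉ = cong (suc ∘ ∣_∣) (∪-identityˡ p)
  ∣⁅x⁆∪p∣ (suc x) (true ∷ p) x∉ = cong suc (∣⁅x⁆∪p∣ x p (x∉ ∘ Vec.there))
  ∣⁅x⁆∪p∣ (suc x) (false ∷ p) x∉ = ∣⁅x⁆∪p∣ x p (x∉ ∘ Vec.there)

  img-∷ : ∀ {v n} (φ : Fin (suc v) → Fin n) b (e : Subset v) → img φ (b ∷ e) ≡ (if b then ⁅ φ zero ⁆ else ⊥) ∪ img (φ ∘ suc) e
  img-∷ {v} φ b e = cong ((if b then ⁅ φ zero ⁆ else ⊥) ∪_) (go (λ i → i))
    where
    go : ∀ {m} (f : Fin m → Fin v) →
      List.foldr (λ x acc → (if lookup (b ∷ e) x then ⁅ φ x ⁆ else ⊥) ∪ acc) ⊥ (tabulate (suc ∘ f)) ≡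
      List.foldr (λ x acc → (if lookup e x then ⁅ φ (suc x) ⁆ else ⊥) ∪ acc) ⊥ (tabulate f)
    go {zero} f = refl
    go {suc m} f = cong ((if lookup e (f zero) then ⁅ φ (suc (f zero)) ⁆ else ⊥) ∪_) (go (f ∘ suc))

  ∣img∣ : ∀ {v n} (φ : Fin v → Fin n) → Injective _≡_ _≡_ φ → (e : Subset v) → ∣ img φ e ∣ ≡ ∣ e ∣
  ∣img∣ {n = n} φ inj [] = ∣⊥∣≡0 n
  ∣img∣ φ inj (true ∷ e) = trans (cong ∣_∣ (img-∷ φ true e)) (trans
    (∣⁅x⁆∪p∣ (φ zero) (img (φ ∘ suc) e) (λ z∈ → let x , _ , eq = ∈-img⁻ (φ ∘ suc) e z∈ in contradiction (inj eq) λ ()))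
    (cong suc (∣img∣ (φ ∘ suc) (Finₚ.suc-injective ∘ inj) e)))
  ∣img∣ φ inj (false ∷ e) = trans (cong ∣_∣ (trans (img-∷ φ false e) (∪-identityˡ _))) (∣img∣ (φ ∘ suc) (Finₚ.suc-injective ∘ inj) e)

  ∈-allSubsets : ∀ {n} (e : Subset n) → e ∈ˡ allSubsets n
  ∈-allSubsets [] = here refl
  ∈-allSubsets {suc n} (false ∷ e) = ∈-++⁺ˡ (∈-map⁺ (outside ∷_) (∈-allSubsets e))
  ∈-allSubsets {suc n} (true ∷ e) = ∈-++⁺ʳ (List.map (outside ∷_) (allSubsets n)) (∈-map⁺ (inside ∷_) (∈-allSubsets e))

  -- `edgeCount` filters with a decision procedure local to its definition; this makes it comparable
  -- with `edges`.
  length-filter-irrelevant : ∀ {A : Set} {P : A → Set} (P? Q? : Decidable P) xs → length (filter P? xs) ≡ length (filter Q? xs)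
  length-filter-irrelevant P? Q? [] = refl
  length-filter-irrelevant P? Q? (x ∷ xs) with P? x | Q? x
  ... | yes _ | yes _ = cong suc (length-filter-irrelevant P? Q? xs)
  ... | no _ | no _ = length-filter-irrelevant P? Q? xs
  ... | yes p | no ¬p = contradiction p ¬p
  ... | no ¬p | yes p = contradiction p ¬p

  length-filter-none : ∀ {A : Set} {P : A → Set} (P? : Decidable P) {n} (f : Fin n → A) → (∀ i → ¬ P (f i)) → length (filter P? (tabulate f)) ≡ 0
  length-filter-none P? {zero} f none = refl
  length-filter-none P? {suc n} f none with P? (f zero)
  ... | yes p = contradiction p (none zero)
  ... | no _ = length-filter-none P? (f ∘ suc) (none ∘ suc)

  length-filter-single : ∀ {A : Set} {P : A → Set} (P? : Decidable P) {n} (f : Fin n → A) i → P (f i) → (∀ j → P (f j) → j ≡ i) → length (filter P? (tabulate f)) ≡ 1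
  length-filter-single P? f zero p unique with P? (f zero)
  ... | yes _ = cong suc (length-filter-none P? (f ∘ suc) (λ i q → contradiction (unique (suc i) q) λ ()))
  ... | no ¬p = contradiction p ¬p
  length-filter-single P? f (suc i) p unique with P? (f zero)
  ... | yes q = contradiction (unique zero q) λ ()
  ... | no _ = length-filter-single P? (f ∘ suc) i p (λ j q → Finₚ.suc-injective (unique (suc j) q))

  edges : ∀ {v} (H : Hypergraph v) → List (Subset v)
  edges {v} H = filter (λ e → T? (edge H e)) (allSubsets v)

  length-edges : ∀ {v} (H : Hypergraph v) → length (edges H) ≡ edgeCount H
  length-edges {v} H = length-filter-irrelevant (λ e → T? (edge H e)) _ (allSubsets v)

  edge-index : ∀ {v} (H : Hypergraph v) e → T (edge H e) → ∃ λ i → List.lookup (edges H) i ≡ e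
  edge-index H e isEdge = Any.index e∈ , sym (lookup-index e∈)
    where
    open import Data.List.Relation.Unary.Any.Properties using (lookup-index)
    e∈ = ∈-filter⁺ (λ e → T? (edge H e)) (∈-allSubsets e) isEdge

  partOf-↑ˡ : ∀ {r} t (ts : Vec ℕ r) c → partOf (t ∷ ts) (c ↑ˡ Vec.sum ts) ≡ zero
  partOf-↑ˡ t ts c rewrite Finₚ.splitAt-↑ˡ t c (Vec.sum ts) = refl

  partOf-↑ʳ : ∀ {r} t (ts : Vec ℕ r) x → partOf (t ∷ ts) (t ↑ʳ x) ≡ suc (partOf ts x)
  partOf-↑ʳ t ts x rewrite Finₚ.splitAt-↑ʳ t (Vec.sum ts) x = refl

  -- When `ch i` lies in part i, this is the set of all `ch i`: a vertex belongs to it when it is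
  -- the choice made for its own part.
  transversal : ∀ {r} (ts : Vec ℕ r) → (Fin r → Fin (Vec.sum ts)) → Subset (Vec.sum ts)
  transversal ts ch = Vec.tabulate (λ x → ⌊ x Fin.≟ ch (partOf ts x) ⌋)

  module _ {r} (ts : Vec ℕ r) (ch : Fin r → Fin (Vec.sum ts)) where
    ∈-transversal⁻ : ∀ x → lookup (transversal ts ch) x ≡ true → x ≡ ch (partOf ts x)
    ∈-transversal⁻ x eq = toWitness (Equivalence.from T-≡ (trans (sym (lookup∘tabulate _ x)) eq))

    ∈-transversal⁺ : ∀ x → x ≡ ch (partOf ts x) → lookup (transversal ts ch) x ≡ true
    ∈-transversal⁺ x eq = trans (lookup∘tabulate _ x) (Equivalence.to T-≡ (fromWitness eq))

    transversal-edge : (∀ i → partOf ts (ch i) ≡ i) → T (edge (KPartite ts) (transversal ts ch))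
    transversal-edge part-ch = all-true (allFin r)
      where
      once : ∀ i → countInPart ts (transversal ts ch) i ≡ 1
      once i = length-filter-single _ (λ x → x) (ch i)
        (Equivalence.from T-∧ (Equivalence.from T-≡ (∈-transversal⁺ (ch i) (cong ch (sym (part-ch i)))) , fromWitness (part-ch i)))
        (λ x q → let inE , inPart = Equivalence.to T-∧ q in
          trans (∈-transversal⁻ x (Equivalence.to T-≡ inE)) (cong ch (toWitness inPart)))
      all-true : ∀ is → T (and (List.map (λ i → countInPart ts (transversal ts ch) i ≡ᵇ 1) is))
      all-true [] = _
      all-true (i ∷ is) = Equivalence.from T-∧ (≡⇒≡ᵇ _ 1 (once i) , all-true is)

  partVertex : ∀ {k} (s : Vec ℕ k) p i → Fin (lookup s i) → Fin (Vec.sum (s ∷ʳ p))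
  partVertex (t ∷ s) p zero c = c ↑ˡ Vec.sum (s ∷ʳ p)
  partVertex (t ∷ s) p (suc i) c = t ↑ʳ partVertex s p i c

  lastVertex : ∀ {k} (s : Vec ℕ k) p → Fin p → Fin (Vec.sum (s ∷ʳ p))
  lastVertex [] p y = y ↑ˡ 0
  lastVertex (t ∷ s) p y = t ↑ʳ lastVertex s p y

  partVertex-injective : ∀ {k} (s : Vec ℕ k) p i → Injective _≡_ _≡_ (partVertex s p i)
  partVertex-injective (t ∷ s) p zero eq = Finₚ.↑ˡ-injective (Vec.sum (s ∷ʳ p)) _ _ eq
  partVertex-injective (t ∷ s) p (suc i) eq = partVertex-injective s p i (Finₚ.↑ʳ-injective t _ _ eq)

  lastVertex-injective : ∀ {k} (s : Vec ℕ k) p → Injective _≡_ _≡_ (lastVertex s p)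
  lastVertex-injective [] p eq = Finₚ.↑ˡ-injective 0 _ _ eq
  lastVertex-injective (t ∷ s) p eq = lastVertex-injective s p (Finₚ.↑ʳ-injective t _ _ eq)

  partOf-partVertex : ∀ {k} (s : Vec ℕ k) p i c → partOf (s ∷ʳ p) (partVertex s p i c) ≡ inject₁ i
  partOf-partVertex (t ∷ s) p zero c = partOf-↑ˡ t (s ∷ʳ p) c
  partOf-partVertex (t ∷ s) p (suc i) c = trans (partOf-↑ʳ t (s ∷ʳ p) _) (cong suc (partOf-partVertex s p i c))

  partOf-lastVertex : ∀ {k} (s : Vec ℕ k) p y → partOf (s ∷ʳ p) (lastVertex s p y) ≡ fromℕ k
  partOf-lastVertex [] p y = partOf-↑ˡ p [] y
  partOf-lastVertex (t ∷ s) p y = trans (partOf-↑ʳ t (s ∷ʳ p) _) (cong suc (partOf-lastVertex s p y))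

  choose : ∀ {k} (s : Vec ℕ k) p → (∀ i → Fin (lookup s i)) → Fin p → Fin (suc k) → Fin (Vec.sum (s ∷ʳ p))
  choose [] p x y zero = y ↑ˡ 0
  choose (t ∷ s) p x y zero = x zero ↑ˡ Vec.sum (s ∷ʳ p)
  choose (t ∷ s) p x y (suc i) = t ↑ʳ choose s p (x ∘ suc) y i

  choose-inject₁ : ∀ {k} (s : Vec ℕ k) p x y i → choose s p x y (inject₁ i) ≡ partVertex s p i (x i)
  choose-inject₁ (t ∷ s) p x y zero = refl
  choose-inject₁ (t ∷ s) p x y (suc i) = cong (t ↑ʳ_) (choose-inject₁ s p (x ∘ suc) y i)

  choose-fromℕ : ∀ {k} (s : Vec ℕ k) p x y → choose s p x y (fromℕ k) ≡ lastVertex s p y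
  choose-fromℕ [] p x y = refl
  choose-fromℕ (t ∷ s) p x y = cong (t ↑ʳ_) (choose-fromℕ s p (x ∘ suc) y)

  partOf-choose : ∀ {k} (s : Vec ℕ k) p x y i → partOf (s ∷ʳ p) (choose s p x y i) ≡ i
  partOf-choose [] p x y zero = partOf-↑ˡ p [] y
  partOf-choose (t ∷ s) p x y zero = partOf-↑ˡ t (s ∷ʳ p) (x zero)
  partOf-choose (t ∷ s) p x y (suc i) = trans (partOf-↑ʳ t (s ∷ʳ p) _) (cong suc (partOf-choose s p (x ∘ suc) y i))

  -- Mixed-radix digits, numbering the s₁⋯s_k ways to choose one vertex from each of the first k
  -- parts.
  tuple : ∀ {k} (s : Vec ℕ k) → Fin (productV s) → ∀ i → Fin (lookup s i)
  tuple (t ∷ s) j zero = proj₁ (remQuot {t} (productV s) j)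
  tuple (t ∷ s) j (suc i) = tuple s (proj₂ (remQuot {t} (productV s) j)) i

  tuple-injective : ∀ {k} (s : Vec ℕ k) {j j′} → (∀ i → tuple s j i ≡ tuple s j′ i) → j ≡ j′
  tuple-injective [] {zero} {zero} eq = refl
  tuple-injective (t ∷ s) {j} {j′} eq = trans (sym (Finₚ.combine-remQuot {t} (productV s) j))
    (trans (cong₂ combine (eq zero) (tuple-injective s (eq ∘ suc))) (Finₚ.combine-remQuot {t} (productV s) j′))

-- The hypergraph G, its copies of H, and why it contains no large complete partite hypergraph

module RandomHypergraphs where
  open import Defs
  open Polynomials
  open Certificates
  open Events
  open Counting
  open PartiteHypergraphs
  open import Data.Nat as ℕ using (ℕ; zero; suc)
  import Data.Nat.Properties as ℕₚ
  open import Data.Bool using (Bool; true; false; T; T?; if_then_else_)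
  import Data.Bool.Properties as Boolₚ
  open import Data.Fin as Fin using (Fin; zero; suc; combine; finToFun; funToFin; inject≤; inject₁; fromℕ)
  import Data.Fin.Properties as Finₚ
  open import Data.Fin.Relation.Unary.Top using (view; ‵fromℕ; ‵inject₁)
  open import Data.Fin.Subset using (Subset; ⊤; ∣_∣; _∈_)
  open import Data.Fin.Subset.Properties using (anySubset?)
  import Data.List as List
  open import Data.Vec as Vec using (Vec; lookup; _∷ʳ_)
  open import Data.Vec.Properties using (≡-dec; tabulate∘lookup; lookup∘tabulate; tabulate-cong; lookup-replicate)
  open import Data.Vec.Functional using () renaming (_∷_ to _∷ᶠ_)
  open import Data.Product using (∃; _×_; _,_; proj₁; proj₂)
  import Data.Sum
  open import Data.Sum using (_⊎_; inj₁; inj₂)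
  open import Data.Empty using () renaming (⊥ to Empty)
  open import Function using (_∘_; Equivalence)
  open import Function.Definitions using (Injective)
  open import Relation.Nullary using (¬_; Dec; yes; no; contradiction; _×-dec_; _⊎-dec_)
  open import Relation.Nullary.Decidable using (⌊_⌋; toWitness; fromWitness)
  open import Relation.Binary.PropositionalEquality

  subset-ext : ∀ {n} {e e′ : Subset n} → (∀ x → lookup e x ≡ lookup e′ x) → e ≡ e′
  subset-ext {e = e} {e′} eq = trans (sym (tabulate∘lookup e)) (trans (tabulate-cong eq) (tabulate∘lookup e′))

  _≟ˢ_ : ∀ {n} (e e′ : Subset n) → Dec (e ≡ e′)
  _≟ˢ_ = ≡-dec Boolₚ._≟_

  bool-ext : ∀ {b b′ : Bool} → (b ≡ true → b′ ≡ true) → (b′ ≡ true → b ≡ true) → b ≡ b′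
  bool-ext {true} f g = sym (f refl)
  bool-ext {false} {true} f g = g refl
  bool-ext {false} {false} f g = refl

  lookup-⊤ : ∀ {n} (x : Fin n) → lookup (⊤ {n}) x ≡ true
  lookup-⊤ x = lookup-replicate x true

  module Construction {q : ℕ} (F : FieldOn (Fin q)) (v n bound : ℕ) where
    open FieldTheory F using (0#; 1#; 1≢0; _≟K_)
    open EventTheory F using (K; module Places)
    open Places v n using (S; BlockPoint; place; place-same; place-diff)

    Label : Set
    Label = Fin (q ℕ.^ S)

    -- The leading 1 tells a block with label 0 apart from an empty block, so P sees which edge of H
    -- is used.
    occupied : Label → Fin (suc S) → K
    occupied ψ = 1# ∷ᶠ finToFun {q} {S} ψ

    occupied-injective : ∀ {ψ ψ′} → ψ ≢ ψ′ → ∃ λ i → occupied ψ i ≢ occupied ψ′ i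
    occupied-injective ne = let i , differ = ≢⇒differ {S} {q} ne in suc i , differ

    point : Subset v → (Fin v → Label) → BlockPoint
    point e y b i = if lookup e b then occupied (y b) i else 0#

    point-true : ∀ e y b → lookup e b ≡ true → ∀ i → point e y b i ≡ occupied (y b) i
    point-true e y b eq i rewrite eq = refl

    point-false : ∀ e y b → lookup e b ≡ false → ∀ i → point e y b i ≡ 0#
    point-false e y b eq i rewrite eq = refl

    Separated : Fin v → (Fin S → BlockPoint) → Set
    Separated b a = ∀ j j′ → j ≢ j′ → ∃ λ b′ → ∃ λ i′ → b′ ≢ b × a j b′ i′ ≢ a j′ b′ i′

    module Vertices (N : ℕ) (enough : v ℕ.* q ℕ.^ S ℕ.≤ N) where

      -- Vertices of G that are not of this form remain isolated.
      vertex : Fin v → Label → Fin N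
      vertex b ψ = inject≤ (combine b ψ) enough

      vertex-injective : ∀ {b b′ ψ ψ′} → vertex b ψ ≡ vertex b′ ψ′ → b ≡ b′ × ψ ≡ ψ′
      vertex-injective {b} {b′} {ψ} {ψ′} eq = Finₚ.combine-injective b ψ b′ ψ′ (Finₚ.inject≤-injective enough enough _ _ eq)

      place-vertices : (Fin v → Label) → Fin v → Fin N
      place-vertices y b = vertex b (y b)

      place-vertices-injective : ∀ y → Injective _≡_ _≡_ (place-vertices y)
      place-vertices-injective y eq = proj₁ (vertex-injective eq)

    module Graph (P : BlockPoint → K) {r : ℕ} (H : Hypergraph v) (H-uniform : Uniform r H)
      (N : ℕ) (enough : v ℕ.* q ℕ.^ S ℕ.≤ N) (1≤q : 1 ℕ.≤ q) where
      open Vertices N enough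

      assignments = (q ℕ.^ S) ℕ.^ v

      assignment : Fin assignments → Fin v → Label
      assignment = finToFun {q ℕ.^ S} {v}

      edgeTotal = List.length (edges H)

      -- W is chosen as the most frequent vector of values (P (point e y))_e over all assignments y.
      profile : Fin assignments → Fin (q ℕ.^ edgeTotal)
      profile k = funToFin (λ i → P (point (List.lookup (edges H) i) (assignment k)))

      popular = large-fibre profile (ℕₚ.m^n>0 q {{ℕ.>-nonZero 1≤q}} edgeTotal)

      profile⋆ : Fin (q ℕ.^ edgeTotal)
      profile⋆ = proj₁ popular

      copies : ℕ
      copies = count (λ k → profile k Fin.≟ profile⋆)

      many-copies : assignments ℕ.≤ q ℕ.^ edgeTotal ℕ.* copies
      many-copies = proj₂ popular

      W : Subset v → K
      W e with Finₚ.any? (λ i → List.lookup (edges H) i ≟ˢ e)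
      ... | yes (i , _) = finToFun {q} {edgeTotal} profile⋆ i
      -- A default for sets that are not edges of H; membership in G tests `W` only at edges.
      ... | no _ = 0#

      popular-edge : ∀ k → profile k ≡ profile⋆ → ∀ e → T (edge H e) → P (point e (assignment k)) ≡ W e
      popular-edge k eq e isEdge with Finₚ.any? (λ i → List.lookup (edges H) i ≟ˢ e)
      ... | yes (i , refl) = trans (sym (Finₚ.finToFun-funToFin _ i)) (cong (λ z → finToFun {q} {edgeTotal} z i) eq)
      ... | no none = contradiction (edge-index H e isEdge) none

      -- The edges of G are the images of the edges e of H under vertex maps y with P (point e y) = W e.
      EdgeData : Subset N → Subset v → Fin assignments → Set
      EdgeData e′ e k = T (edge H e) × img (place-vertices (assignment k)) e ≡ e′ × P (point e (assignment k)) ≡ W e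

      edgeData? : ∀ e′ → Dec (∃ λ e → ∃ λ k → EdgeData e′ e k)
      edgeData? e′ = anySubset? (λ e → Finₚ.any? (λ k →
        T? (edge H e) ×-dec (img (place-vertices (assignment k)) e ≟ˢ e′) ×-dec (P (point e (assignment k)) ≟K W e)))

      G : Hypergraph N
      G = record { edge = λ e′ → ⌊ edgeData? e′ ⌋ }

      G-uniform : Uniform r G
      G-uniform e′ isEdge = let e , k , He , eq , _ = toWitness {a? = edgeData? e′} isEdge in
        trans (cong ∣_∣ (sym eq)) (trans (∣img∣ (place-vertices (assignment k)) (place-vertices-injective (assignment k)) e) (H-uniform e He))

      -- Distinct assignments already give distinct vertex sets: a copy has exactly one vertex in
      -- each block, so its vertex set determines the labels, and no division by automorphisms of H
      -- occurs.
      G-copies : AtLeastCopies copies H G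
      G-copies = (λ x → record
          { map = place-vertices (assignment (choice x))
          ; injective = place-vertices-injective (assignment (choice x))
          ; preserves = λ e He → fromWitness {a? = edgeData? (img (place-vertices (assignment (choice x))) e)} (e , choice x , He , refl , popular-edge (choice x) (choice-popular x) e He) }) ,
        λ x x′ ne (same , _) → ne (choice-injective (finToFun-injective {v} {q ℕ.^ S} (same-labels x x′ same)))
        where
        chosen = enumerate (λ k → profile k Fin.≟ profile⋆)
        choice = proj₁ chosen
        choice-injective = proj₁ (proj₂ chosen)
        choice-popular = proj₂ (proj₂ chosen)
        same-labels : ∀ x x′ → img (place-vertices (assignment (choice x))) ⊤ ≡ img (place-vertices (assignment (choice x′))) ⊤ →
          assignment (choice x) ≗ assignment (choice x′)
        same-labels x x′ eq b with ∈-img⁻ (place-vertices (assignment (choice x′))) ⊤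
          (subst (place-vertices (assignment (choice x)) b ∈_) eq (∈-img⁺ (place-vertices (assignment (choice x))) ⊤ (lookup-⊤ b)))
        ... | b′ , _ , same with vertex-injective same
        ... | refl , labels = sym labels

    Goodness : (BlockPoint → K) → Set
    Goodness P = ∀ b (a : Fin S → BlockPoint) (ω : Fin S → K) → Separated b a →
      ∀ {p} (y : Fin p → Fin S → K) → (∀ {k l} → y k ≗ y l → k ≡ l) → bound ℕ.< p →
      (∀ k j → P (place b (y k) (a j)) ≡ ω j) → Empty

    module Selections {k} (s : Vec ℕ k) (S≡ : S ≡ productV s) (p : ℕ) where

      tuple′ : Fin S → ∀ i → Fin (lookup s i)
      tuple′ j = tuple s (Fin.cast S≡ j)

      tuple′-injective : ∀ {j j′} → (∀ i → tuple′ j i ≡ tuple′ j′ i) → j ≡ j′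
      tuple′-injective {j} {j′} eq = Finₚ.toℕ-injective (trans (sym (Finₚ.toℕ-cast S≡ j)) (trans (cong Fin.toℕ (tuple-injective s eq)) (Finₚ.toℕ-cast S≡ j′)))

      front : Fin S → Fin k → Fin (Vec.sum (s ∷ʳ p))
      front j i = partVertex s p i (tuple′ j i)

      back : Fin p → Fin (Vec.sum (s ∷ʳ p))
      back = lastVertex s p

      front≢back : ∀ j i x → front j i ≢ back x
      front≢back j i x eq = Finₚ.fromℕ≢inject₁ (trans (sym (partOf-lastVertex s p x)) (trans (cong (partOf (s ∷ʳ p)) (sym eq)) (partOf-partVertex s p i (tuple′ j i))))

      front-part : ∀ {j j′ i i′} → front j i ≡ front j′ i′ → i ≡ i′
      front-part {j} {j′} {i} {i′} eq = Finₚ.inject₁-injective (trans (sym (partOf-partVertex s p i (tuple′ j i)))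
        (trans (cong (partOf (s ∷ʳ p)) eq) (partOf-partVertex s p i′ (tuple′ j′ i′))))

      selection : Fin S → Fin p → Fin (suc k) → Fin (Vec.sum (s ∷ʳ p))
      selection j x = choose s p (tuple′ j) x

      edgeK : Fin S → Fin p → Subset (Vec.sum (s ∷ʳ p))
      edgeK j x = transversal (s ∷ʳ p) (selection j x)

      data Member (j : Fin S) (x : Fin p) : Fin (Vec.sum (s ∷ʳ p)) → Set where
        at-front : ∀ i → Member j x (front j i)
        at-back : Member j x (back x)

      member : ∀ j x u → lookup (edgeK j x) u ≡ true → Member j x u
      member j x u isIn = subst (Member j x) (sym (∈-transversal⁻ (s ∷ʳ p) (selection j x) u isIn)) (chosen (partOf (s ∷ʳ p) u))
        where
        chosen : ∀ i → Member j x (selection j x i)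
        chosen i with view i
        ... | ‵fromℕ = subst (Member j x) (sym (choose-fromℕ s p (tuple′ j) x)) at-back
        ... | ‵inject₁ i′ = subst (Member j x) (sym (choose-inject₁ s p (tuple′ j) x i′)) (at-front i′)

      selection∈ : ∀ j x i → lookup (edgeK j x) (selection j x i) ≡ true
      selection∈ j x i = ∈-transversal⁺ (s ∷ʳ p) (selection j x) _ (cong (selection j x) (sym (partOf-choose s p (tuple′ j) x i)))

      front∈ : ∀ j x i → lookup (edgeK j x) (front j i) ≡ true
      front∈ j x i = subst (λ u → lookup (edgeK j x) u ≡ true) (choose-inject₁ s p (tuple′ j) x i) (selection∈ j x (inject₁ i))

      back∈ : ∀ j x → lookup (edgeK j x) (back x) ≡ true
      back∈ j x = subst (λ u → lookup (edgeK j x) u ≡ true) (choose-fromℕ s p (tuple′ j) x) (selection∈ j x (fromℕ k))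

    module Freeness {k} (s : Vec ℕ k) (S≡ : S ≡ productV s) (p : ℕ) (large : v ℕ.* bound ℕ.< p)
      (P : BlockPoint → K) (P-respects : ∀ {z z′} → (∀ b i → z b i ≡ z′ b i) → P z ≡ P z′) (good : Goodness P)
      (N : ℕ) (enough : v ℕ.* q ℕ.^ S ℕ.≤ N) (W : Subset v → K)
      (f : Fin (Vec.sum (s ∷ʳ p)) → Fin N) (f-injective : Injective _≡_ _≡_ f)
      (pattern-edge : Fin S → Fin p → Subset v) (labels : Fin S → Fin p → Fin v → Label)
      (same-image : ∀ j x → img (Vertices.place-vertices N enough (labels j x)) (pattern-edge j x) ≡ img f (Selections.edgeK s S≡ p j x))
      (weight : ∀ j x → P (point (pattern-edge j x) (labels j x)) ≡ W (pattern-edge j x)) where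
      open Vertices N enough
      open Selections s S≡ p

      locate : ∀ j x u → lookup (edgeK j x) u ≡ true → ∃ λ b → lookup (pattern-edge j x) b ≡ true × vertex b (labels j x b) ≡ f u
      locate j x u isIn = ∈-img⁻ (place-vertices (labels j x)) (pattern-edge j x) (subst (f u ∈_) (sym (same-image j x)) (∈-img⁺ f (edgeK j x) isIn))

      -- Every edge of the copy comes with its own edge of H and its own labels. They agree at
      -- common vertices because a vertex determines its block and label.
      at-label : ∀ j x {u b ψ} → lookup (edgeK j x) u ≡ true → vertex b ψ ≡ f u → lookup (pattern-edge j x) b ≡ true × labels j x b ≡ ψ
      at-label j x {u} isIn eq with locate j x u isIn
      ... | b , isIn′ , eq′ with vertex-injective (trans eq′ (sym eq))
      ... | refl , same = isIn′ , same

      origin : ∀ j x b → lookup (pattern-edge j x) b ≡ true → ∃ λ u → lookup (edgeK j x) u ≡ true × f u ≡ vertex b (labels j x b)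
      origin j x b isIn = ∈-img⁻ f (edgeK j x) (subst (vertex b (labels j x b) ∈_) (same-image j x) (∈-img⁺ (place-vertices (labels j x)) (pattern-edge j x) isIn))

      -- An arbitrary vertex of the last part, at which blocks and labels of the front vertices are
      -- read off; by `front-at` they are the same at every other x.
      x₀ : Fin p
      x₀ = Fin.fromℕ< (ℕₚ.≤-trans (ℕ.s≤s ℕ.z≤n) large)

      frontBlock : Fin S → Fin k → Fin v
      frontBlock j i = proj₁ (locate j x₀ (front j i) (front∈ j x₀ i))

      frontLabel : Fin S → Fin k → Label
      frontLabel j i = labels j x₀ (frontBlock j i)

      front-vertex : ∀ j i → vertex (frontBlock j i) (frontLabel j i) ≡ f (front j i)
      front-vertex j i = proj₂ (proj₂ (locate j x₀ (front j i) (front∈ j x₀ i)))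

      backBlock : Fin p → Fin v
      backBlock x = proj₁ (locate zero x (back x) (back∈ zero x))

      backLabel : Fin p → Label
      backLabel x = labels zero x (backBlock x)

      back-vertex : ∀ x → vertex (backBlock x) (backLabel x) ≡ f (back x)
      back-vertex x = proj₂ (proj₂ (locate zero x (back x) (back∈ zero x)))

      front-at : ∀ j x i → lookup (pattern-edge j x) (frontBlock j i) ≡ true × labels j x (frontBlock j i) ≡ frontLabel j i
      front-at j x i = at-label j x (front∈ j x i) (front-vertex j i)

      back-at : ∀ j x → lookup (pattern-edge j x) (backBlock x) ≡ true × labels j x (backBlock x) ≡ backLabel x
      back-at j x = at-label j x (back∈ j x) (back-vertex x)

      -- The edge (j , x) has only one label per block, so two of its vertices in one block would
      -- coincide.
      frontBlock≢backBlock : ∀ j x i → frontBlock j i ≢ backBlock x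
      frontBlock≢backBlock j x i eq = front≢back j i x (f-injective (trans (sym (front-vertex j i)) (trans
        (cong₂ vertex eq (trans (sym (proj₂ (front-at j x i))) (trans (cong (labels j x) eq) (proj₂ (back-at j x))))) (back-vertex x))))

      pattern-origin : ∀ j x b → lookup (pattern-edge j x) b ≡ true → b ≡ backBlock x ⊎ (∃ λ i → frontBlock j i ≡ b)
      pattern-origin j x b isIn with origin j x b isIn
      ... | u , isInK , eq with member j x u isInK
      ... | at-front i = inj₂ (i , proj₁ (vertex-injective (trans (front-vertex j i) eq)))
      ... | at-back = inj₁ (sym (proj₁ (vertex-injective (trans (back-vertex x) eq))))

      -- The last part may spread over all v blocks; a most popular one still holds more than
      -- `bound` of its vertices. This is the origin of the factor v in `large`.
      fibre = large-fibre backBlock (ℕₚ.≤-trans (ℕ.s≤s ℕ.z≤n) (Finₚ.toℕ<n (backBlock x₀)))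

      b⋆ : Fin v
      b⋆ = proj₁ fibre

      fibreSize = count (λ x → backBlock x Fin.≟ b⋆)

      bound<fibreSize : bound ℕ.< fibreSize
      bound<fibreSize = ℕₚ.≰⇒> (λ small → ℕₚ.<⇒≱ large (ℕₚ.≤-trans (proj₂ fibre) (ℕₚ.*-monoʳ-≤ v small)))

      fibre-elements = enumerate (λ x → backBlock x Fin.≟ b⋆)

      ι : Fin fibreSize → Fin p
      ι = proj₁ fibre-elements

      ι-block : ∀ x → backBlock (ι x) ≡ b⋆
      ι-block = proj₂ (proj₂ fibre-elements)

      frontAt? : ∀ j b → Dec (∃ λ i → frontBlock j i ≡ b)
      frontAt? j b = Finₚ.any? (λ i → frontBlock j i Fin.≟ b)

      fill : ∀ {j b} → Dec (∃ λ i → frontBlock j i ≡ b) → Fin (suc S) → K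
      fill {j} (yes (i , _)) = occupied (frontLabel j i)
      fill (no _) = λ _ → 0#

      a : Fin S → BlockPoint
      a j b = fill (frontAt? j b)

      -- On the fibre the edge of H under (j , x) depends on j alone, so a single value of `W` is
      -- prescribed for all x.
      expected-edge : Fin S → Subset v
      expected-edge j = Vec.tabulate (λ b → ⌊ (b Fin.≟ b⋆) ⊎-dec frontAt? j b ⌋)

      pattern-expected : ∀ j x → pattern-edge j (ι x) ≡ expected-edge j
      pattern-expected j x = subset-ext (λ b → trans (bool-ext (forward b) (backward b)) (sym (lookup∘tabulate _ b)))
        where
        forward : ∀ b → lookup (pattern-edge j (ι x)) b ≡ true → ⌊ (b Fin.≟ b⋆) ⊎-dec frontAt? j b ⌋ ≡ true
        forward b isIn = Equivalence.to Boolₚ.T-≡ (fromWitness {a? = (b Fin.≟ b⋆) ⊎-dec frontAt? j b} (Data.Sum.map (λ eq → trans eq (ι-block x)) (λ w → w) (pattern-origin j (ι x) b isIn)))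
        present : ∀ b → b ≡ b⋆ ⊎ (∃ λ i → frontBlock j i ≡ b) → lookup (pattern-edge j (ι x)) b ≡ true
        present b (inj₁ refl) = subst (λ b → lookup (pattern-edge j (ι x)) b ≡ true) (ι-block x) (proj₁ (back-at j (ι x)))
        present b (inj₂ (i , refl)) = proj₁ (front-at j (ι x) i)
        backward : ∀ b → ⌊ (b Fin.≟ b⋆) ⊎-dec frontAt? j b ⌋ ≡ true → lookup (pattern-edge j (ι x)) b ≡ true
        backward b isExpected = present b (toWitness {a? = (b Fin.≟ b⋆) ⊎-dec frontAt? j b} (Equivalence.from Boolₚ.T-≡ isExpected))

      solutions : ∀ x j → P (place b⋆ (finToFun {q} {S} (backLabel (ι x))) (a j)) ≡ W (expected-edge j)
      solutions x j = trans (P-respects {place b⋆ (finToFun {q} {S} (backLabel (ι x))) (a j)} {point e y} (λ b i → same b i (b Fin.≟ b⋆)))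
        (trans (weight j (ι x)) (cong W (pattern-expected j x)))
        where
        e = pattern-edge j (ι x)
        y = labels j (ι x)
        back-here : lookup e b⋆ ≡ true × y b⋆ ≡ backLabel (ι x)
        back-here = subst (λ b → lookup e b ≡ true × y b ≡ backLabel (ι x)) (ι-block x) (back-at j (ι x))
        empty : ∀ b → b ≢ b⋆ → ¬ (∃ λ i → frontBlock j i ≡ b) → lookup e b ≡ false
        empty b b≢ none = Boolₚ.¬-not (λ eq → Data.Sum.[ (λ b≡ → b≢ (trans b≡ (ι-block x))) , none ]′ (pattern-origin j (ι x) b eq))
        a-point : ∀ b i → b ≢ b⋆ → (d : Dec (∃ λ i → frontBlock j i ≡ b)) → fill d i ≡ point e y b i
        a-point b i b≢ (yes (i′ , refl)) = sym (trans (point-true e y b (proj₁ (front-at j (ι x) i′)) i) (cong (λ ψ → occupied ψ i) (proj₂ (front-at j (ι x) i′))))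
        a-point b i b≢ (no none) = sym (point-false e y b (empty b b≢ none) i)
        same : ∀ b i → Dec (b ≡ b⋆) → place b⋆ (finToFun {q} {S} (backLabel (ι x))) (a j) b i ≡ point e y b i
        same b i (yes refl) = trans (place-same b⋆ (finToFun {q} {S} (backLabel (ι x))) (a j) i)
          (sym (trans (point-true e y b⋆ (proj₁ back-here) i) (cong (λ ψ → occupied ψ i) (proj₂ back-here))))
        same b i (no b≢) = trans (place-diff b⋆ (finToFun {q} {S} (backLabel (ι x))) (a j) b b≢ i) (a-point b i b≢ (frontAt? j b))

      a-front : ∀ j i i′ → a j (frontBlock j i) i′ ≡ occupied (frontLabel j i) i′
      a-front j i i′ = by-cases (frontAt? j (frontBlock j i))
        where
        by-cases : (d : Dec (∃ λ i″ → frontBlock j i″ ≡ frontBlock j i)) → fill d i′ ≡ occupied (frontLabel j i) i′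
        by-cases (no none) = contradiction (i , refl) none
        by-cases (yes (i″ , eq)) = cong (λ ψ → occupied ψ i′) (trans (sym (proj₂ (front-at j x₀ i″))) (trans (cong (labels j x₀) eq) (proj₂ (front-at j x₀ i))))

      -- Let choices j and j′ differ in part i, and look at the block of the i-th vertex of j.
      -- Either j′ leaves it empty, and the mark 1 meets 0; or j′ has a vertex there, and equal
      -- labels would make the two vertices equal, hence both in part i and equal there. This block
      -- is not `b⋆` because it shares an edge with a vertex in `b⋆`.
      separated : Separated b⋆ a
      separated j j′ j≢j′ = b , proj₁ differ , b≢b⋆ , λ eq → proj₂ differ (trans (sym (a-front j i (proj₁ differ))) eq)
        where
        differing = Finₚ.¬∀⟶∃¬ k (λ i → tuple′ j i ≡ tuple′ j′ i) (λ i → tuple′ j i Fin.≟ tuple′ j′ i) (j≢j′ ∘ tuple′-injective)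
        i = proj₁ differing
        b = frontBlock j i
        b≢b⋆ : b ≢ b⋆
        b≢b⋆ eq = frontBlock≢backBlock j (ι x₁) i (trans eq (sym (ι-block x₁)))
          where
          x₁ : Fin fibreSize
          x₁ = Fin.fromℕ< (ℕₚ.≤-trans (ℕ.s≤s ℕ.z≤n) bound<fibreSize)
        clash : ∀ {i″} → i ≡ i″ → front j i ≢ front j′ i″
        clash refl eq = proj₂ differing (partVertex-injective s p i eq)
        by-cases : (d : Dec (∃ λ i″ → frontBlock j′ i″ ≡ b)) → ∃ λ i′ → occupied (frontLabel j i) i′ ≢ fill d i′
        by-cases (no none) = zero , 1≢0
        by-cases (yes (i″ , eq)) = occupied-injective (λ same →
          let eq′ = f-injective (trans (sym (front-vertex j i)) (trans (cong₂ vertex (sym eq) same) (front-vertex j′ i″)))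
          in clash (front-part {j} {j′} eq′) eq′)
        differ : ∃ λ i′ → occupied (frontLabel j i) i′ ≢ a j′ b i′
        differ = by-cases (frontAt? j′ b)

      backLabel-injective : ∀ {x x′} → finToFun {q} {S} (backLabel (ι x)) ≗ finToFun (backLabel (ι x′)) → x ≡ x′
      backLabel-injective {x} {x′} eq = proj₁ (proj₂ fibre-elements) (lastVertex-injective s p (f-injective
        (trans (sym (back-vertex (ι x))) (trans (cong₂ vertex (trans (ι-block x) (sym (ι-block x′))) (finToFun-injective {S} {q} eq)) (back-vertex (ι x′))))))

      KPartite-free : Empty
      KPartite-free = good b⋆ a (W ∘ expected-edge) separated (λ x → finToFun (backLabel (ι x))) backLabel-injective bound<fibreSize solutions

    module _ {k} (s : Vec ℕ k) (S≡ : S ≡ productV s) (p : ℕ) (large : v ℕ.* bound ℕ.< p)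
      (P : BlockPoint → K) (P-respects : ∀ {z z′} → (∀ b i → z b i ≡ z′ b i) → P z ≡ P z′) (good : Goodness P)
      {r : ℕ} (H : Hypergraph v) (H-uniform : Uniform r H)
      (N : ℕ) (enough : v ℕ.* q ℕ.^ S ℕ.≤ N) (1≤q : 1 ℕ.≤ q) where
      open Graph P H H-uniform N enough 1≤q
      open Selections s S≡ p

      G-free : ¬ Contains (KPartite (s ∷ʳ p)) G
      G-free φ = Freeness.KPartite-free s S≡ p large P P-respects good N enough W (Embedding.map φ) (Embedding.injective φ)
        (λ j x → proj₁ (imageEdge j x)) (λ j x → assignment (proj₁ (proj₂ (imageEdge j x))))
        (λ j x → proj₁ (proj₂ (proj₂ (proj₂ (imageEdge j x))))) (λ j x → proj₂ (proj₂ (proj₂ (proj₂ (imageEdge j x)))))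
        where
        imageEdge : ∀ j x → ∃ λ e → ∃ λ y → EdgeData (img (Embedding.map φ) (edgeK j x)) e y
        imageEdge j x = toWitness {a? = edgeData? (img (Embedding.map φ) (edgeK j x))}
          (Embedding.preserves φ (edgeK j x) (transversal-edge (s ∷ʳ p) (selection j x) (partOf-choose s p (tuple′ j) x)))

open import Defs
open Polynomials
open Events
open GoodPolynomials
open RandomHypergraphs
open PartiteHypergraphs
open ResidueFields
open PrimeGaps
open import Data.Nat using (ℕ; zero; suc; _+_; _*_; _^_; _≤_; _<_; z≤n; s≤s; _≤?_; NonZero; >-nonZero; pred)
open import Data.Nat.Properties
open import Data.Nat.Primality using (Prime)
open import Data.Nat.Solver using (module +-*-Solver)
open import Data.Fin using (zero; suc)
open import Data.Vec using (Vec; []; _∷_; lookup; _∷ʳ_)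
open import Data.Product using (Σ; ∃; ∃-syntax; _×_; _,_; proj₁; proj₂)
open import Function using (_∘_)
open import Relation.Nullary using (¬_; yes; no; contradiction)
open import Relation.Binary.PropositionalEquality

-- Choice of the parameters and the final count

-- The number of events is v S q^(mS+S), so one further power of q absorbs every constant.
event-bound : ∀ q v n X d → 1 ≤ q → v * suc n * X < q → v * suc (suc n) * suc n + suc n < d → EventCount.E q v n * X < q ^ d
event-bound q v n X d 1≤q few A<d = begin-strict
  E * X                            ≡⟨ cong (λ w → v * (S * w) * X) (trans (cong (_* q ^ S) (^-*-assoc q m S)) (sym (^-distribˡ-+-* q (m * S) S))) ⟩
  v * (S * q ^ A) * X              ≡⟨ solve 4 (λ a b w x → a :* (b :* w) :* x := a :* b :* x :* w) refl v S (q ^ A) X ⟩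
  v * S * X * q ^ A                <⟨ *-monoˡ-< (q ^ A) {{m^n≢0 q A}} few ⟩
  q ^ suc A                        ≤⟨ ^-monoʳ-≤ q A<d ⟩
  q ^ d                            ∎
  where
  open ≤-Reasoning
  open +-*-Solver
  open EventCount q v n
  S = suc n
  A = m * S + S
  instance
    q≢0 : NonZero q
    q≢0 = >-nonZero 1≤q

-- There are at most v S q^(mS+S) events and each is bad with probability at most (N / q)^(D+1), where D = D′ + 1 ≥ mS + S.
threshold : (v n D′ : ℕ) → ℕ
threshold v n D′ = suc n * suc D′ + (suc (suc D′) + (suc (suc (Sizes.T n D′)) + suc (v * suc n * Sizes.N n D′ ^ suc (suc D′))))

module _ {k} (s : Vec ℕ k) {n} (S≡ : suc n ≡ productV s) (v : ℕ) {D′} (D′≡ : v * suc (suc n) * suc n + suc n + n ≡ D′)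
  (H : Hypergraph v) (H-uniform : Uniform (suc k) H) where
  open Sizes n D′ using (T; N)

  hypergraph-over-field : ∀ {q} → Prime q → threshold v n D′ ≤ q → ∀ M → v * q ^ suc n ≤ M →
    Σ (Hypergraph M) λ G → Uniform (suc k) G ×
      (∀ p → v * T ^ suc n < p → ¬ Contains (KPartite (s ∷ʳ p)) G) ×
      ∃ λ X → AtLeastCopies X H G × (q ^ suc n) ^ v ≤ q ^ edgeCount H * X
  hypergraph-over-field {q} pr large M enough =
    Gr.G , Gr.G-uniform ,
    (λ p p-large → Co.G-free s S≡ p p-large (Go.P c) (Go.P-respects c) good H H-uniform M enough 1≤q) ,
    Gr.copies , Gr.G-copies , subst (λ e → (q ^ suc n) ^ v ≤ q ^ e * Gr.copies) (length-edges H) Gr.many-copies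
    where
    a₁ = suc n * suc D′
    a₂ = suc (suc D′)
    a₃ = suc (suc T)
    a₄ = suc (v * suc n * N ^ suc (suc D′))
    κ-size : a₁ ≤ q
    κ-size = ≤-trans (m≤m+n a₁ _) large
    rest₁ : a₂ + (a₃ + a₄) ≤ q
    rest₁ = ≤-trans (m≤n+m _ a₁) large
    rest₂ : a₃ + a₄ ≤ q
    rest₂ = ≤-trans (m≤n+m _ a₂) rest₁
    1≤q : 1 ≤ q
    1≤q = ≤-trans (s≤s z≤n) rest₁
    n≤D : n ≤ suc D′
    n≤D = m≤n⇒m≤1+n (subst (n ≤_) D′≡ (m≤n+m n _))
    A<d : v * suc (suc n) * suc n + suc n < suc (suc D′)
    A<d = s≤s (m≤n⇒m≤1+n (subst (v * suc (suc n) * suc n + suc n ≤_) D′≡ (m≤m+n _ n)))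
    F = fieldOfResidues pr
    module Go = GoodTheory F v n D′ n≤D 1≤q κ-size (≤-trans (m≤m+n a₂ _) rest₁) (≤-trans (m≤m+n a₃ a₄) rest₂)
      (event-bound q v n (N ^ suc (suc D′)) (suc (suc D′)) 1≤q (≤-trans (m≤n+m a₄ a₃) rest₂) A<d)
    module Co = Construction F v n (T ^ suc n)
    c = proj₁ Go.good-coefficients
    good : Co.Goodness (Go.P c)
    good = proj₂ Go.good-coefficients
    module Gr = Co.Graph (Go.P c) H H-uniform M enough 1≤q

crossing : ∀ (g : ℕ → ℕ) M a j → g a ≤ M → M < g (j + a) → ∃ λ b → a ≤ b × g b ≤ M × M < g (suc b)
crossing g M a zero ga≤M M<ga = contradiction ga≤M (<⇒≱ M<ga)
crossing g M a (suc j) ga≤M M<g with g (suc a) ≤? M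
... | no gsa≰M = a , ≤-refl , ga≤M , ≰⇒> gsa≰M
... | yes gsa≤M with crossing g M (suc a) j gsa≤M (subst (λ x → M < g x) (sym (+-suc j a)) M<g)
...   | b , sa≤b , gb≤M , M<gsb = b , ≤-trans (n≤1+n a) sa≤b , gb≤M , M<gsb

^-distribʳ-* : ∀ n a b → (a * b) ^ n ≡ a ^ n * b ^ n
^-distribʳ-* zero a b = refl
^-distribʳ-* (suc n) a b = trans (cong (a * b *_) (^-distribʳ-* n a b))
  (solve 4 (λ a b c d → a :* b :* (c :* d) := a :* c :* (b :* d)) refl a b (a ^ n) (b ^ n))
  where open +-*-Solver

n<4^n : ∀ n → n < 4 ^ n
n<4^n zero = s≤s z≤n
n<4^n (suc n) = begin-strict
  suc n            <⟨ s≤s (n<4^n n) ⟩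
  1 + 4 ^ n        ≤⟨ +-mono-≤ (m^n>0 4 n) (m≤m+n (4 ^ n) _) ⟩
  4 ^ suc n        ∎
  where open ≤-Reasoning

-- Take the a at which (v + 1)(16 · 4^a)^S passes M and a prime above 4^a; the loss is at most 16 ·
-- 4 = 64 per factor q. The factor v + 1 gives room for the v blocks and also q^S ≤ M, even for v =
-- 0.
prime-size : ∀ v S Q → 1 ≤ S → ∃ λ d → ∃ λ N → 1 ≤ d × (∀ M → N ≤ M →
  ∃ λ q → Prime q × Q ≤ q × suc v * q ^ S ≤ M × M ≤ d * q ^ S)
prime-size v S Q 1≤S = suc v * 64 ^ S , g a₀ , *-mono-≤ {1} {suc v} (s≤s z≤n) (m^n>0 64 S) , find
  where
  open ≤-Reasoning
  open +-*-Solver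
  -- 3 for `prime-gap`, and Q because Q ≤ a < 4^a < q.
  a₀ = 3 + Q
  g : ℕ → ℕ
  g a = suc v * (16 * 4 ^ a) ^ S
  M<g : ∀ M → M < g (M + a₀)
  M<g M = begin-strict
    M                          <⟨ n<4^n M ⟩
    4 ^ M                      ≤⟨ ^-monoʳ-≤ 4 (m≤m+n M a₀) ⟩
    4 ^ (M + a₀)               ≤⟨ m≤n*m (4 ^ (M + a₀)) 16 ⟩
    16 * 4 ^ (M + a₀)          ≡⟨ *-identityʳ _ ⟨
    (16 * 4 ^ (M + a₀)) ^ 1    ≤⟨ ^-monoʳ-≤ (16 * 4 ^ (M + a₀)) {{>-nonZero (≤-trans (m^n>0 4 (M + a₀)) (m≤n*m _ 16))}} 1≤S ⟩
    (16 * 4 ^ (M + a₀)) ^ S    ≤⟨ m≤n*m ((16 * 4 ^ (M + a₀)) ^ S) (suc v) ⟩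
    g (M + a₀)                 ∎
  find : ∀ M → g a₀ ≤ M → ∃ λ q → Prime q × Q ≤ q × suc v * q ^ S ≤ M × M ≤ (suc v * 64 ^ S) * q ^ S
  find M large with crossing g M a₀ M large (M<g M)
  ... | a , a₀≤a , ga≤M , M<gsa with prime-gap a (≤-trans (m≤m+n 3 Q) a₀≤a)
  ...   | q , pr , 4^a<q , q≤ = q , pr ,
          (begin
            Q       ≤⟨ m≤n+m Q 3 ⟩
            a₀      ≤⟨ a₀≤a ⟩
            a       ≤⟨ <⇒≤ (n<4^n a) ⟩
            4 ^ a   ≤⟨ <⇒≤ 4^a<q ⟩
            q       ∎) ,
          ≤-trans (*-monoʳ-≤ (suc v) (^-monoˡ-≤ S q≤)) ga≤M ,
          (begin
            M                                ≤⟨ <⇒≤ M<gsa ⟩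
            suc v * (16 * 4 ^ suc a) ^ S     ≡⟨ cong (λ x → suc v * x ^ S) (solve 1 (λ x → con 16 :* (con 4 :* x) := con 64 :* x) refl (4 ^ a)) ⟩
            suc v * (64 * 4 ^ a) ^ S         ≤⟨ *-monoʳ-≤ (suc v) (^-monoˡ-≤ S (*-monoʳ-≤ 64 (<⇒≤ 4^a<q))) ⟩
            suc v * (64 * q) ^ S             ≡⟨ cong (suc v *_) (^-distribʳ-* S 64 q) ⟩
            suc v * (64 ^ S * q ^ S)         ≡⟨ *-assoc (suc v) (64 ^ S) (q ^ S) ⟨
            (suc v * 64 ^ S) * q ^ S         ∎)

-- Only q^S is comparable with M, so the factor q^e becomes a power of M after raising everything to
-- the power S.
copy-count : ∀ {M d q S v e X} → M ≤ d * q ^ S → q ^ S ≤ M → (q ^ S) ^ v ≤ q ^ e * X →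
  M ^ (v * S) ≤ d ^ (v * S) * (X ^ S * M ^ e)
copy-count {M} {d} {q} {S} {v} {e} {X} M≤ q^S≤M many = begin
  M ^ (v * S)                             ≤⟨ ^-monoˡ-≤ (v * S) M≤ ⟩
  (d * q ^ S) ^ (v * S)                   ≡⟨ ^-distribʳ-* (v * S) d (q ^ S) ⟩
  d ^ (v * S) * (q ^ S) ^ (v * S)         ≡⟨ cong (d ^ (v * S) *_) (^-*-assoc (q ^ S) v S) ⟨
  d ^ (v * S) * ((q ^ S) ^ v) ^ S         ≤⟨ *-monoʳ-≤ (d ^ (v * S)) (^-monoˡ-≤ S many) ⟩
  d ^ (v * S) * (q ^ e * X) ^ S           ≡⟨ cong (d ^ (v * S) *_) (trans (^-distribʳ-* S (q ^ e) X) (*-comm ((q ^ e) ^ S) (X ^ S))) ⟩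
  d ^ (v * S) * (X ^ S * (q ^ e) ^ S)     ≡⟨ cong (λ z → d ^ (v * S) * (X ^ S * z)) (trans (^-*-assoc q e S) (trans (cong (q ^_) (*-comm e S)) (sym (^-*-assoc q S e)))) ⟩
  d ^ (v * S) * (X ^ S * (q ^ S) ^ e)     ≤⟨ *-monoʳ-≤ (d ^ (v * S)) (*-monoʳ-≤ (X ^ S) (^-monoˡ-≤ e q^S≤M)) ⟩
  d ^ (v * S) * (X ^ S * M ^ e)           ∎
  where open ≤-Reasoning

productV-positive : ∀ {k} (s : Vec ℕ k) → (∀ i → 1 ≤ lookup s i) → 1 ≤ productV s
productV-positive [] _ = s≤s z≤n
productV-positive (t ∷ s) pos = *-mono-≤ (pos zero) (productV-positive s (pos ∘ suc))

theorem1p4 : (k : ℕ) → 1 ≤ k → (s : Vec ℕ k) → (∀ i → 1 ≤ lookup s i) →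
    (v : ℕ) (H : Hypergraph v) → Uniform (suc k) H →
    ∃[ c ] (1 ≤ c × (∀ p → c ≤ p →
    ∃[ d ] ∃[ N ] (1 ≤ d × (∀ n → N ≤ n →
    Σ (Hypergraph n) λ G → Uniform (suc k) G × ¬ Contains (KPartite (s ∷ʳ p)) G ×
    ∃[ X ] (AtLeastCopies X H G ×
    n ^ (v * productV s) ≤ d * (X ^ productV s * n ^ edgeCount H))))))
-- T^S bounds the labels that can complete S separated points within one block, and v is the number
-- of blocks.
theorem1p4 k _ s positive v H H-uniform = suc (v * Sizes.T n D′ ^ suc n) , s≤s z≤n , λ p p-large →
  let d , N , 1≤d , find = prime-size v (suc n) (threshold v n D′) (s≤s z≤n) in
  d ^ (v * productV s) , N , m^n>0 d {{>-nonZero 1≤d}} (v * productV s) , λ M M-large →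
  let q , pr , q-large , lower , upper = find M M-large
      G , uniform , free , X , copies , many =
        hypergraph-over-field s S≡ v refl H H-uniform pr q-large M (≤-trans (m≤n+m (v * q ^ suc n) (q ^ suc n)) lower)
  in G , uniform , free p p-large , X , copies ,
     subst (λ S → M ^ (v * S) ≤ d ^ (v * S) * (X ^ S * M ^ edgeCount H)) S≡
       (copy-count {M} {d} {q} {suc n} {v} {edgeCount H} {X} upper (≤-trans (m≤m+n (q ^ suc n) (v * q ^ suc n)) lower) many)
  where
  n = pred (productV s)
  S≡ : suc n ≡ productV s
  S≡ = suc-pred (productV s) {{>-nonZero (productV-positive s positive)}}
  -- The part mS + S is the exponent of q in the number of events, to be exceeded by D + 1; the last
  -- n ensures n ≤ D.
  D′ = v * suc (suc n) * suc n + suc n + n
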